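{- Let $(x_n)_{n\ge1}$ be the van der Corput sequence in base 2. Then $$\limsup_{N\to\infty}\frac1{N^2}\prod_{n=1}^N|2\sin(\pi x_n)|=\frac1{2\pi}$$ and $$\liminf_{N\to\infty}\prod_{n=1}^N|2\sin(\pi x_n)|=\pi.$$
   Context: The van der Corput sequence in base 2 is defined as follows: for $n\in\mathbb N$, $n\ge 1$, with (finite) binary expansion $n=a_0+a_12+a_22^2+\cdots$, digits $a_i\in\{0,1\}$, put $x_n=\frac{a_0}{2}+\frac{a_1}{2^2}+\frac{a_2}{2^3}+\cdots$. -}

module Defs where

open import Algebra.Bundles using (CommutativeRing)
open import Data.Integer as ℤ using (+_)
import Data.Integer.Properties as ℤₚ
open import Data.Nat as ℕ using (ℕ; zero; suc; _!)
open import Data.Nat.Coprimality as C using (1-coprimeTo)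
open import Data.Nat.DivMod as DivMod using ()
import Data.Nat.Properties as ℕₚ
open import Data.Product using (Σ; ∃; _×_; _,_; proj₁; proj₂)
open import Data.Rational
  using (ℚ; mkℚ; 0ℚ; 1ℚ; ½; _+_; _-_; _*_; -_; ∣_∣; _⊔_; _/_; 1/_; _≤_; _<_;
         *≤*; toℚᵘ; ↧ₙ_; Positive; positive; nonNegative)
open import Data.Rational.Properties
import Data.Rational.Unnormalised as ℚᵘ
import Data.Rational.Unnormalised.Properties as ℚᵘₚ
open import Data.Rational.Solver using (module +-*-Solver)
open import Data.Sum using (inj₁; inj₂)
open import Relation.Binary.PropositionalEquality
  using (_≡_; refl; sym; trans; cong; cong₂; subst; subst₂)

open import Algebra.Properties.Semiring.Exp (CommutativeRing.semiring +-*-commutativeRing)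
  using (_^_)

open +-*-Solver using (solve; _:=_; _:+_; _:*_; _:-_; :-_; con)

∑< : ℕ → (ℕ → ℚ) → ℚ
∑< zero    f = 0ℚ
∑< (suc n) f = ∑< n f + f n

digit : ℕ → ℕ → ℕ
digit n i = (n DivMod./ (2 ℕ.^ i)) {{ℕₚ.m^n≢0 2 i}} DivMod.% 2

-- The expansion may be cut off after n digits, since n < 2ⁿ.
vanDerCorput : ℕ → ℚ
vanDerCorput n = ∑< n λ i → (+ digit n i / (2 ℕ.^ suc i)) {{ℕₚ.m^n≢0 2 (suc i)}}

p<p+1 : ∀ p → p < p + 1ℚ
p<p+1 p = subst (_< p + 1ℚ) (+-identityʳ p) (+-monoʳ-< p (positive⁻¹ 1ℚ))

+-mono-0≤ : ∀ {p q} → 0ℚ ≤ p → 0ℚ ≤ q → 0ℚ ≤ p + q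
+-mono-0≤ {p} {q} 0≤p 0≤q = subst (_≤ p + q) (+-identityˡ 0ℚ) (+-mono-≤ 0≤p 0≤q)

*-monoʳ-≤′ : ∀ {p q r} → 0ℚ ≤ r → p ≤ q → r * p ≤ r * q
*-monoʳ-≤′ {r = r} 0≤r = *-monoˡ-≤-nonNeg r {{nonNegative 0≤r}}

*-monoˡ-≤′ : ∀ {p q r} → 0ℚ ≤ r → p ≤ q → p * r ≤ q * r
*-monoˡ-≤′ {r = r} 0≤r = *-monoʳ-≤-nonNeg r {{nonNegative 0≤r}}

*-mono-0≤ : ∀ {p q} → 0ℚ ≤ p → 0ℚ ≤ q → 0ℚ ≤ p * q
*-mono-0≤ {p} {q} 0≤p 0≤q = subst (_≤ p * q) (*-zeroʳ p) (*-monoʳ-≤′ 0≤p 0≤q)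

*-mono-≤′ : ∀ {p q r s} → 0ℚ ≤ r → 0ℚ ≤ q → p ≤ q → r ≤ s → p * r ≤ q * s
*-mono-≤′ 0≤r 0≤q p≤q r≤s = ≤-trans (*-monoˡ-≤′ 0≤r p≤q) (*-monoʳ-≤′ 0≤q r≤s)

∣p*q∣≤ : ∀ {p q P Q} → ∣ p ∣ ≤ P → ∣ q ∣ ≤ Q → ∣ p * q ∣ ≤ P * Q
∣p*q∣≤ {p} {q} {P} {Q} p≤P q≤Q = subst (_≤ P * Q) (sym (∣p*q∣≡∣p∣*∣q∣ p q))
  (*-mono-≤′ (0≤∣p∣ q) (≤-trans (0≤∣p∣ p) p≤P) p≤P q≤Q)

∣p+q∣≤ : ∀ {p q P Q} → ∣ p ∣ ≤ P → ∣ q ∣ ≤ Q → ∣ p + q ∣ ≤ P + Q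
∣p+q∣≤ {p} {q} p≤P q≤Q = ≤-trans (∣p+q∣≤∣p∣+∣q∣ p q) (+-mono-≤ p≤P q≤Q)

∣p-q∣≡∣q-p∣ : ∀ p q → ∣ p - q ∣ ≡ ∣ q - p ∣
∣p-q∣≡∣q-p∣ p q = trans
  (cong ∣_∣ (solve 2 (λ x y → x :- y := :- (y :- x)) refl p q)) (∣-p∣≡∣p∣ (q - p))

p≤∣p∣ : ∀ p → p ≤ ∣ p ∣
p≤∣p∣ p with ≤-total 0ℚ p
... | inj₁ 0≤p = ≤-reflexive (sym (0≤p⇒∣p∣≡p 0≤p))
... | inj₂ p≤0 = ≤-trans p≤0 (0≤∣p∣ p)

∣p∣≤ : ∀ {p q} → p ≤ q → - p ≤ q → ∣ p ∣ ≤ q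
∣p∣≤ {p} {q} p≤q -p≤q with ∣p∣≡p∨∣p∣≡-p p
... | inj₁ eq = subst (_≤ q) (sym eq) p≤q
... | inj₂ eq = subst (_≤ q) (sym eq) -p≤q

∣p∣-∣q∣≤∣p-q∣ : ∀ p q → ∣ p ∣ - ∣ q ∣ ≤ ∣ p - q ∣
∣p∣-∣q∣≤∣p-q∣ p q = subst (∣ p ∣ - ∣ q ∣ ≤_)
  (solve 2 (λ x y → (x :+ y) :- y := x) refl ∣ p - q ∣ ∣ q ∣)
  (+-monoˡ-≤ (- ∣ q ∣) (subst (λ r → ∣ r ∣ ≤ ∣ p - q ∣ + ∣ q ∣)
    (solve 2 (λ x y → (x :- y) :+ y := x) refl p q) (∣p+q∣≤∣p∣+∣q∣ (p - q) q)))

∣∣p∣-∣q∣∣≤∣p-q∣ : ∀ p q → ∣ ∣ p ∣ - ∣ q ∣ ∣ ≤ ∣ p - q ∣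
∣∣p∣-∣q∣∣≤∣p-q∣ p q = ∣p∣≤ (∣p∣-∣q∣≤∣p-q∣ p q) (subst₂ _≤_
  (solve 2 (λ x y → x :- y := :- (y :- x)) refl ∣ q ∣ ∣ p ∣)
  (∣p-q∣≡∣q-p∣ q p) (∣p∣-∣q∣≤∣p-q∣ q p))

ι : ℕ → ℚ
ι n = mkℚ (+ n) 0 (C.sym (1-coprimeTo n))

0≤ι : ∀ n → 0ℚ ≤ ι n
0≤ι n = nonNegative⁻¹ (ι n)

ι-mono-≤ : ∀ {m n} → m ℕ.≤ n → ι m ≤ ι n
ι-mono-≤ {m} {n} m≤n = *≤* (subst₂ ℤ._≤_ (sym (ℤₚ.*-identityʳ (+ m)))
  (sym (ℤₚ.*-identityʳ (+ n))) (ℤ.+≤+ m≤n))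

ι-homo-* : ∀ m n → ι (m ℕ.* n) ≡ ι m * ι n
ι-homo-* m n = toℚᵘ-injective (ℚᵘₚ.≃-trans
  (ℚᵘ.*≡* (cong (ℤ._* + 1) (ℤₚ.pos-* m n))) (ℚᵘₚ.≃-sym (toℚᵘ-homo-* (ι m) (ι n))))

ι-homo-+1 : ∀ n → ι (suc n) ≡ ι n + 1ℚ
ι-homo-+1 n = toℚᵘ-injective (ℚᵘₚ.≃-trans (ℚᵘ.*≡* (cong (ℤ._* + 1)
  (trans (cong +_ (ℕₚ.+-comm 1 n)) (cong (ℤ._+ + 1) (sym (ℤₚ.*-identityʳ (+ n)))))))
  (ℚᵘₚ.≃-sym (toℚᵘ-homo-+ (ι n) 1ℚ)))

ι-homo-^ : ∀ m n → ι (m ℕ.^ n) ≡ ι m ^ n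
ι-homo-^ m zero    = refl
ι-homo-^ m (suc n) = trans (ι-homo-* m (m ℕ.^ n)) (cong (ι m *_) (ι-homo-^ m n))

1/n*n≡1 : ∀ n .{{_ : ℕ.NonZero n}} → (+ 1 / n) * ι n ≡ 1ℚ
1/n*n≡1 n@(suc n-1) = toℚᵘ-injective (begin-equality
  toℚᵘ ((+ 1 / n) * ι n)           ≃⟨ toℚᵘ-homo-* (+ 1 / n) (ι n) ⟩
  toℚᵘ (+ 1 / n) ℚᵘ.* toℚᵘ (ι n)   ≃⟨ ℚᵘₚ.*-congʳ (toℚᵘ-fromℚᵘ (ℚᵘ.mkℚᵘ (+ 1) n-1)) ⟩
  ℚᵘ.mkℚᵘ (+ 1) n-1 ℚᵘ.* toℚᵘ (ι n) ≃⟨ ℚᵘₚ.*-inverseˡ (toℚᵘ (ι n)) ⟩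
  toℚᵘ 1ℚ                          ∎)
  where open ℚᵘₚ.≤-Reasoning

0≤1/n : ∀ n .{{_ : ℕ.NonZero n}} → 0ℚ ≤ + 1 / n
0≤1/n n = nonNegative⁻¹ (+ 1 / n) {{normalize-nonNeg 1 n}}

∣p∣≤ι : ∀ p → ∣ p ∣ ≤ ι (ℤ.∣ ℚ.numerator p ∣)
∣p∣≤ι (mkℚ n d _) = *≤* (ℤₚ.*-monoˡ-≤-nonNeg (+ ℤ.∣ n ∣) (ℤ.+≤+ (ℕ.s≤s ℕ.z≤n)))

1≤ι[↧p]*p : ∀ {p} → 0ℚ < p → 1ℚ ≤ ι (↧ₙ p) * p
1≤ι[↧p]*p {p} 0<p with positive 0<p
1≤ι[↧p]*p {p@(mkℚ (+ suc n) d _)} 0<p | _ =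
  toℚᵘ-cancel-≤ (ℚᵘₚ.≤-respʳ-≃ (ℚᵘₚ.≃-sym (toℚᵘ-homo-* (ι (suc d)) p))
    (ℚᵘ.*≤* (subst₂ ℤ._≤_ (cong +_ (sym (trans (ℕₚ.*-identityˡ _) (ℕₚ.*-identityˡ (suc d)))))
      (cong +_ (sym (ℕₚ.*-identityʳ (suc d ℕ.* suc n)))) (ℤ.+≤+ (ℕₚ.m≤m*n (suc d) (suc n))))))

n<2^n : ∀ n → n ℕ.< 2 ℕ.^ n
n<2^n zero    = ℕ.s≤s ℕ.z≤n
n<2^n (suc n) = ℕₚ.≤-trans (ℕₚ.≤-reflexive (ℕₚ.+-comm 1 (suc n)))
  (subst (suc n ℕ.+ 1 ℕ.≤_) (cong (2 ℕ.^ n ℕ.+_) (sym (ℕₚ.+-identityʳ _)))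
    (ℕₚ.+-mono-≤ (n<2^n n) (ℕₚ.m^n>0 2 n)))

0≤½^n : ∀ n → 0ℚ ≤ ½ ^ n
0≤½^n zero    = nonNegative⁻¹ 1ℚ
0≤½^n (suc n) = *-mono-0≤ (nonNegative⁻¹ ½) (0≤½^n n)

½^n*2^n≡1 : ∀ n → ½ ^ n * ι 2 ^ n ≡ 1ℚ
½^n*2^n≡1 zero    = refl
½^n*2^n≡1 (suc n) = trans
  (solve 2 (λ h t → (con ½ :* h) :* (con (ι 2) :* t) := h :* t) refl (½ ^ n) (ι 2 ^ n))
  (½^n*2^n≡1 n)

½^n≤ : ∀ {p} → 0ℚ < p → ∀ n → ↧ₙ p ℕ.≤ n → ½ ^ n ≤ p
½^n≤ {p} 0<p n d≤n = begin
  ½ ^ n                    ≡⟨ *-identityʳ (½ ^ n) ⟨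
  ½ ^ n * 1ℚ               ≤⟨ *-monoʳ-≤′ (0≤½^n n) (≤-trans (1≤ι[↧p]*p 0<p)
                                (*-monoˡ-≤′ (<⇒≤ 0<p) (ι-mono-≤ (ℕₚ.≤-trans d≤n (ℕₚ.<⇒≤ (n<2^n n)))))) ⟩
  ½ ^ n * (ι (2 ℕ.^ n) * p) ≡⟨ *-assoc (½ ^ n) _ p ⟨
  ½ ^ n * ι (2 ℕ.^ n) * p   ≡⟨ cong (λ t → ½ ^ n * t * p) (ι-homo-^ 2 n) ⟩
  ½ ^ n * ι 2 ^ n * p       ≡⟨ cong (_* p) (½^n*2^n≡1 n) ⟩
  1ℚ * p                    ≡⟨ *-identityˡ p ⟩
  p                         ∎
  where open ≤-Reasoning

-- ℝ is the completion of ℚ by Cauchy sequences; its equality is _≈ᵣ_, not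
-- propositional equality.

IsCauchy : (ℕ → ℚ) → Set
IsCauchy s = ∀ ε → 0ℚ < ε → ∃ λ N → ∀ m n → N ℕ.≤ m → N ℕ.≤ n → ∣ s m - s n ∣ < ε

record ℝ : Set where
  constructor mkℝ
  field
    seq    : ℕ → ℚ
    cauchy : IsCauchy seq

open ℝ public

infix 4 _≈ᵣ_ _≤ᵣ_ _<ᵣ_

_≈ᵣ_ : ℝ → ℝ → Set
x ≈ᵣ y = ∀ ε → 0ℚ < ε → ∃ λ N → ∀ n → N ℕ.≤ n → ∣ seq x n - seq y n ∣ < ε

_≤ᵣ_ : ℝ → ℝ → Set
x ≤ᵣ y = ∀ ε → 0ℚ < ε → ∃ λ N → ∀ n → N ℕ.≤ n → seq x n < seq y n + ε

_<ᵣ_ : ℝ → ℝ → Set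
x <ᵣ y = ∃ λ ε → 0ℚ < ε × ∃ λ N → ∀ n → N ℕ.≤ n → seq x n + ε < seq y n

cauchy-scaled : ∀ s K → 0ℚ ≤ K →
  (∀ ε → 0ℚ < ε → ∃ λ N → ∀ m n → N ℕ.≤ m → N ℕ.≤ n → ∣ s m - s n ∣ ≤ K * ε) → IsCauchy s
cauchy-scaled s K 0≤K h ε 0<ε = proj₁ (h δ 0<δ) , λ m n N≤m N≤n → begin-strict
  ∣ s m - s n ∣   ≤⟨ proj₂ (h δ 0<δ) m n N≤m N≤n ⟩
  K * δ           <⟨ *-monoˡ-<-pos δ (p<p+1 K) ⟩
  (K + 1ℚ) * δ    ≡⟨ *-comm (K + 1ℚ) δ ⟩
  ε * 1/K+1 * (K + 1ℚ) ≡⟨ *-assoc ε 1/K+1 (K + 1ℚ) ⟩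
  ε * (1/K+1 * (K + 1ℚ)) ≡⟨ cong (ε *_) (*-inverseˡ (K + 1ℚ)) ⟩
  ε * 1ℚ          ≡⟨ *-identityʳ ε ⟩
  ε               ∎
  where
  open ≤-Reasoning
  instance
    K+1-pos : Positive (K + 1ℚ)
    K+1-pos = positive (≤-<-trans 0≤K (p<p+1 K))
    K+1≢0 = pos⇒nonZero (K + 1ℚ)
    ε-pos : Positive ε
    ε-pos = positive 0<ε
  1/K+1 = 1/ (K + 1ℚ)
  instance
    1/K+1-pos : Positive 1/K+1
    1/K+1-pos = 1/pos⇒pos (K + 1ℚ)
  δ = ε * 1/K+1
  instance
    δ-pos : Positive δ
    δ-pos = pos*pos⇒pos ε 1/K+1
  0<δ : 0ℚ < δ
  0<δ = positive⁻¹ δ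

eventually-bounded : ∀ x → ∃ λ b → ∃ λ N → ∀ n → N ℕ.≤ n → ∣ seq x n ∣ ≤ ι b
eventually-bounded (mkℝ s c) = suc a , N , λ n N≤n → begin
  ∣ s n ∣                    ≡⟨ cong ∣_∣ (solve 2 (λ x y → x := y :+ (x :- y)) refl (s n) (s N)) ⟩
  ∣ s N + (s n - s N) ∣      ≤⟨ ∣p+q∣≤ (∣p∣≤ι (s N)) (<⇒≤ (proj₂ (c 1ℚ (positive⁻¹ 1ℚ)) n N N≤n ℕₚ.≤-refl)) ⟩
  ι a + 1ℚ                   ≡⟨ ι-homo-+1 a ⟨
  ι (suc a)                  ∎
  where
  open ≤-Reasoning
  N = proj₁ (c 1ℚ (positive⁻¹ 1ℚ))
  a = ℤ.∣ ℚ.numerator (s N) ∣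

fromℚ : ℚ → ℝ
fromℚ p = mkℝ (λ _ → p) λ ε 0<ε → 0 , λ _ _ _ _ →
  subst (_< ε) (sym (cong ∣_∣ (+-inverseʳ p))) 0<ε

0ᵣ 1ᵣ 2ᵣ : ℝ
0ᵣ = fromℚ 0ℚ
1ᵣ = fromℚ 1ℚ
2ᵣ = fromℚ (+ 2 / 1)

∣_∣ᵣ : ℝ → ℝ
∣ x ∣ᵣ = mkℝ (λ n → ∣ seq x n ∣) λ ε 0<ε → let N , h = cauchy x ε 0<ε in
  N , λ m n N≤m N≤n → ≤-<-trans (∣∣p∣-∣q∣∣≤∣p-q∣ (seq x m) (seq x n)) (h m n N≤m N≤n)

infixl 7 _*ᵣ_

_*ᵣ_ : ℝ → ℝ → ℝ
x *ᵣ y = mkℝ (λ n → seq x n * seq y n) (cauchy-scaled (λ n → seq x n * seq y n) (ι a + ι b) (+-mono-0≤ (0≤ι a) (0≤ι b)) λ ε 0<ε →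
  let M , f = cauchy x ε 0<ε
      N , g = cauchy y ε 0<ε
  in (A ℕ.⊔ B) ℕ.⊔ (M ℕ.⊔ N) , λ m n ≤m ≤n →
     let M≤m = ≤⇒M M N ≤m ; M≤n = ≤⇒M M N ≤n ; N≤m = ≤⇒N M N ≤m ; N≤n = ≤⇒N M N ≤n in begin
  ∣ seq x m * seq y m - seq x n * seq y n ∣
    ≡⟨ cong ∣_∣ (solve 4 (λ p q r s → p :* q :- r :* s := p :* (q :- s) :+ (p :- r) :* s) refl
         (seq x m) (seq y m) (seq x n) (seq y n)) ⟩
  ∣ seq x m * (seq y m - seq y n) + (seq x m - seq x n) * seq y n ∣
    ≤⟨ ∣p+q∣≤ (∣p*q∣≤ {seq x m} (boundx m (≤⇒A M N ≤m)) (<⇒≤ (g m n N≤m N≤n)))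
              (∣p*q∣≤ (<⇒≤ (f m n M≤m M≤n)) (boundy n (≤⇒B M N ≤n))) ⟩
  ι a * ε + ε * ι b
    ≡⟨ solve 3 (λ p q e → p :* e :+ e :* q := (p :+ q) :* e) refl (ι a) (ι b) ε ⟩
  (ι a + ι b) * ε ∎)
  where
  open ≤-Reasoning
  a = proj₁ (eventually-bounded x)
  A = proj₁ (proj₂ (eventually-bounded x))
  boundx = proj₂ (proj₂ (eventually-bounded x))
  b = proj₁ (eventually-bounded y)
  B = proj₁ (proj₂ (eventually-bounded y))
  boundy = proj₂ (proj₂ (eventually-bounded y))
  module _ (M N : ℕ) {n : ℕ} (le : (A ℕ.⊔ B) ℕ.⊔ (M ℕ.⊔ N) ℕ.≤ n) where
    ≤⇒AB = ℕₚ.m⊔n≤o⇒m≤o (A ℕ.⊔ B) (M ℕ.⊔ N) le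
    ≤⇒MN = ℕₚ.m⊔n≤o⇒n≤o (A ℕ.⊔ B) (M ℕ.⊔ N) le
    ≤⇒A = ℕₚ.m⊔n≤o⇒m≤o A B ≤⇒AB
    ≤⇒B = ℕₚ.m⊔n≤o⇒n≤o A B ≤⇒AB
    ≤⇒M = ℕₚ.m⊔n≤o⇒m≤o M N ≤⇒MN
    ≤⇒N = ℕₚ.m⊔n≤o⇒n≤o M N ≤⇒MN

-- If 0 < x is witnessed by ε then seq x is eventually above ε, so truncating
-- it below at ε does not change the limit and keeps all terms invertible.
recip : (x : ℝ) → 0ᵣ <ᵣ x → ℝ
recip x (ε , 0<ε , N , h) = mkℝ inv (cauchy-scaled inv (R * R) (*-mono-0≤ 0≤R 0≤R) λ η 0<η →
  let M , f = cauchy x η 0<η in N ℕ.⊔ M , λ m n ≤m ≤n → begin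
  ∣ inv m - inv n ∣
    ≡⟨ cong ∣_∣ (inv-diff m n) ⟩
  ∣ inv m * inv n * (trunc n - trunc m) ∣
    ≤⟨ ∣p*q∣≤ (∣p*q∣≤ (∣inv∣≤ m) (∣inv∣≤ n))
         (subst₂ (λ p q → ∣ p - q ∣ ≤ η)
            (sym (trunc≡ n (ℕₚ.m⊔n≤o⇒m≤o N M ≤n))) (sym (trunc≡ m (ℕₚ.m⊔n≤o⇒m≤o N M ≤m)))
            (<⇒≤ (f n m (ℕₚ.m⊔n≤o⇒n≤o N M ≤n) (ℕₚ.m⊔n≤o⇒n≤o N M ≤m)))) ⟩
  R * R * η ∎)
  where
  open ≤-Reasoning
  trunc : ℕ → ℚ
  trunc n = ε ⊔ seq x n
  instance
    ε-pos : Positive ε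
    ε-pos = positive 0<ε
    ε≢0 = pos⇒nonZero ε
    trunc-pos : ∀ {n} → Positive (trunc n)
    trunc-pos {n} = positive (<-≤-trans 0<ε (p≤p⊔q ε (seq x n)))
    trunc≢0 : ∀ {n} → _
    trunc≢0 {n} = pos⇒nonZero (trunc n)
  inv : ℕ → ℚ
  inv n = 1/ trunc n
  R : ℚ
  R = 1/ ε
  0≤R : 0ℚ ≤ R
  0≤R = <⇒≤ (positive⁻¹ R {{1/pos⇒pos ε}})
  0≤inv : ∀ n → 0ℚ ≤ inv n
  0≤inv n = <⇒≤ (positive⁻¹ (inv n) {{1/pos⇒pos (trunc n)}})
  trunc≡ : ∀ n → N ℕ.≤ n → trunc n ≡ seq x n
  trunc≡ n N≤n = p≤q⇒p⊔q≡q (<⇒≤ (subst (_< seq x n) (+-identityˡ ε) (h n N≤n)))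
  ∣inv∣≤ : ∀ n → ∣ inv n ∣ ≤ R
  ∣inv∣≤ n = begin
    ∣ inv n ∣           ≡⟨ 0≤p⇒∣p∣≡p (0≤inv n) ⟩
    inv n               ≡⟨ *-identityʳ (inv n) ⟨
    inv n * 1ℚ          ≡⟨ cong (inv n *_) (*-inverseʳ ε) ⟨
    inv n * (ε * R)     ≤⟨ *-monoʳ-≤′ (0≤inv n) (*-monoˡ-≤′ 0≤R (p≤p⊔q ε (seq x n))) ⟩
    inv n * (trunc n * R) ≡⟨ *-assoc (inv n) (trunc n) R ⟨
    inv n * trunc n * R ≡⟨ cong (_* R) (*-inverseˡ (trunc n)) ⟩
    1ℚ * R              ≡⟨ *-identityˡ R ⟩
    R                   ∎
  inv-diff : ∀ m n → inv m - inv n ≡ inv m * inv n * (trunc n - trunc m)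
  inv-diff m n = begin-equality
    inv m - inv n
      ≡⟨ cong₂ _-_ (*-identityʳ (inv m)) (*-identityʳ (inv n)) ⟨
    inv m * 1ℚ - inv n * 1ℚ
      ≡⟨ cong₂ (λ p q → inv m * p - inv n * q) (*-inverseˡ (trunc n)) (*-inverseˡ (trunc m)) ⟨
    inv m * (inv n * trunc n) - inv n * (inv m * trunc m)
      ≡⟨ solve 4 (λ i j t u → i :* (j :* t) :- j :* (i :* u) := i :* j :* (t :- u)) refl
           (inv m) (inv n) (trunc n) (trunc m) ⟩
    inv m * inv n * (trunc n - trunc m) ∎

∏ : ℕ → (ℕ → ℝ) → ℝ
∏ zero    f = 1ᵣ
∏ (suc n) f = ∏ n f *ᵣ f (suc n)

sinTerm : ℚ → ℕ → ℚ
sinTerm x k = (- 1ℚ) ^ k * (+ 1 / suc (2 ℕ.* k) !) {{suc (2 ℕ.* k) ℕₚ.!≢0}} * x ^ suc (2 ℕ.* k)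

sinSum : ℚ → ℕ → ℚ
sinSum x n = ∑< n (sinTerm x)

c^k≤M*k! : ∀ c k → suc c ℕ.^ k ℕ.≤ suc c ℕ.^ suc c ℕ.* k !
c^k≤M*k! c zero = ℕₚ.≤-trans (ℕₚ.m^n>0 (suc c) (suc c)) (ℕₚ.m≤m*n _ 1)
c^k≤M*k! c (suc k) with ℕₚ.≤-total (suc k) (suc c)
... | inj₁ k≤c = ℕₚ.≤-trans (ℕₚ.^-monoʳ-≤ (suc c) k≤c) (ℕₚ.m≤m*n _ (suc k !) {{suc k ℕₚ.!≢0}})
... | inj₂ c≤k = ℕₚ.≤-trans (ℕₚ.*-mono-≤ c≤k (c^k≤M*k! c k)) (ℕₚ.≤-reflexive eq)
  where
  M = suc c ℕ.^ suc c
  eq : suc k ℕ.* (M ℕ.* k !) ≡ M ℕ.* (suc k ℕ.* k !)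
  eq = trans (sym (ℕₚ.*-assoc (suc k) M (k !)))
    (trans (cong (ℕ._* k !) (ℕₚ.*-comm (suc k) M)) (ℕₚ.*-assoc M (suc k) (k !)))

[m*n]^k : ∀ m n k → (m ℕ.* n) ℕ.^ k ≡ m ℕ.^ k ℕ.* n ℕ.^ k
[m*n]^k m n zero    = refl
[m*n]^k m n (suc k) = trans (cong (m ℕ.* n ℕ.*_) ([m*n]^k m n k))
  (ℕₚ.[m*n]*[o*p]≡[m*o]*[n*p] m n (m ℕ.^ k) (n ℕ.^ k))

k!≤[j+k]! : ∀ j k → k ! ℕ.≤ (j ℕ.+ k) !
k!≤[j+k]! zero    k = ℕₚ.≤-refl
k!≤[j+k]! (suc j) k = ℕₚ.≤-trans (k!≤[j+k]! j k) (ℕₚ.m≤n*m _ (suc (j ℕ.+ k)))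

sinTerm-majorant : ∀ b → ∃ λ M → ∀ k →
  suc (2 ℕ.* k) ℕ.* b ℕ.^ (2 ℕ.* k) ℕ.* 2 ℕ.^ k ℕ.≤ M ℕ.* suc (2 ℕ.* k) !
sinTerm-majorant b = M , λ k → begin
  suc (2 ℕ.* k) ℕ.* b ℕ.^ (2 ℕ.* k) ℕ.* 2 ℕ.^ k
    ≡⟨ ℕₚ.*-assoc (suc (2 ℕ.* k)) (b ℕ.^ (2 ℕ.* k)) (2 ℕ.^ k) ⟩
  suc (2 ℕ.* k) ℕ.* (b ℕ.^ (2 ℕ.* k) ℕ.* 2 ℕ.^ k)
    ≡⟨ cong (λ p → suc (2 ℕ.* k) ℕ.* (p ℕ.* 2 ℕ.^ k)) (ℕₚ.^-*-assoc b 2 k) ⟨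
  suc (2 ℕ.* k) ℕ.* ((b ℕ.^ 2) ℕ.^ k ℕ.* 2 ℕ.^ k)
    ≡⟨ cong (suc (2 ℕ.* k) ℕ.*_) ([m*n]^k (b ℕ.^ 2) 2 k) ⟨
  suc (2 ℕ.* k) ℕ.* c ℕ.^ k
    ≤⟨ ℕₚ.*-monoʳ-≤ (suc (2 ℕ.* k)) (ℕₚ.≤-trans (ℕₚ.^-monoˡ-≤ k (ℕₚ.n≤1+n c)) (c^k≤M*k! c k)) ⟩
  suc (2 ℕ.* k) ℕ.* (M ℕ.* k !)
    ≤⟨ ℕₚ.*-monoʳ-≤ (suc (2 ℕ.* k)) (ℕₚ.*-monoʳ-≤ M (k!≤[2k]! k)) ⟩
  suc (2 ℕ.* k) ℕ.* (M ℕ.* (2 ℕ.* k) !)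
    ≡⟨ ℕₚ.*-assoc (suc (2 ℕ.* k)) M ((2 ℕ.* k) !) ⟨
  suc (2 ℕ.* k) ℕ.* M ℕ.* (2 ℕ.* k) !
    ≡⟨ cong (ℕ._* (2 ℕ.* k) !) (ℕₚ.*-comm (suc (2 ℕ.* k)) M) ⟩
  M ℕ.* suc (2 ℕ.* k) ℕ.* (2 ℕ.* k) !
    ≡⟨ ℕₚ.*-assoc M (suc (2 ℕ.* k)) ((2 ℕ.* k) !) ⟩
  M ℕ.* suc (2 ℕ.* k) ! ∎
  where
  open ℕₚ.≤-Reasoning
  c = b ℕ.^ 2 ℕ.* 2
  M = suc c ℕ.^ suc c
  k!≤[2k]! : ∀ k → k ! ℕ.≤ (2 ℕ.* k) !
  k!≤[2k]! k = subst (λ n → k ! ℕ.≤ (k ℕ.+ n) !) (sym (ℕₚ.+-identityʳ k)) (k!≤[j+k]! k k)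

module SinBounds (b : ℕ) where
  open ≤-Reasoning

  B : ℚ
  B = ι b

  M : ℚ
  M = ι (proj₁ (sinTerm-majorant b))

  0≤M : 0ℚ ≤ M
  0≤M = 0≤ι (proj₁ (sinTerm-majorant b))

  1/[2k+1]! : ℕ → ℚ
  1/[2k+1]! k = (+ 1 / suc (2 ℕ.* k) !) {{suc (2 ℕ.* k) ℕₚ.!≢0}}

  0≤1/[2k+1]! : ∀ k → 0ℚ ≤ 1/[2k+1]! k
  0≤1/[2k+1]! k = 0≤1/n (suc (2 ℕ.* k) !) {{suc (2 ℕ.* k) ℕₚ.!≢0}}

  0≤B^n : ∀ n → 0ℚ ≤ B ^ n
  0≤B^n zero    = nonNegative⁻¹ 1ℚ
  0≤B^n (suc n) = *-mono-0≤ (0≤ι b) (0≤B^n n)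

  majorant : ∀ k → ι (suc (2 ℕ.* k)) * B ^ (2 ℕ.* k) * 1/[2k+1]! k ≤ M * ½ ^ k
  majorant k = begin
    a * r                     ≡⟨ *-identityʳ (a * r) ⟨
    a * r * 1ℚ                ≡⟨ cong (a * r *_) (½^n*2^n≡1 k) ⟨
    a * r * (h * t)           ≡⟨ solve 4 (λ a r h t → a :* r :* (h :* t) := a :* t :* (r :* h)) refl a r h t ⟩
    a * t * (r * h)           ≤⟨ *-monoˡ-≤′ (*-mono-0≤ (0≤1/[2k+1]! k) (0≤½^n k)) nat ⟩
    M * F * (r * h)           ≡⟨ solve 4 (λ m f r h → m :* f :* (r :* h) := m :* h :* (r :* f)) refl M F r h ⟩
    M * h * (r * F)           ≡⟨ cong (M * h *_) (1/n*n≡1 (suc (2 ℕ.* k) !) {{suc (2 ℕ.* k) ℕₚ.!≢0}}) ⟩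
    M * h * 1ℚ                ≡⟨ *-identityʳ (M * h) ⟩
    M * h                     ∎
    where
    a = ι (suc (2 ℕ.* k)) * B ^ (2 ℕ.* k)
    r = 1/[2k+1]! k
    h = ½ ^ k
    t = ι 2 ^ k
    F = ι (suc (2 ℕ.* k) !)
    nat : a * t ≤ M * F
    nat = subst₂ _≤_
      (trans (ι-homo-* (suc (2 ℕ.* k) ℕ.* b ℕ.^ (2 ℕ.* k)) (2 ℕ.^ k)) (cong₂ _*_
        (trans (ι-homo-* (suc (2 ℕ.* k)) (b ℕ.^ (2 ℕ.* k))) (cong (ι (suc (2 ℕ.* k)) *_) (ι-homo-^ b (2 ℕ.* k))))
        (ι-homo-^ 2 k)))
      (ι-homo-* (proj₁ (sinTerm-majorant b)) (suc (2 ℕ.* k) !))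
      (ι-mono-≤ (proj₂ (sinTerm-majorant b) k))

  ∣sign∣≤1 : ∀ k → ∣ (- 1ℚ) ^ k ∣ ≤ 1ℚ
  ∣sign∣≤1 zero    = ≤-refl
  ∣sign∣≤1 (suc k) = ∣p*q∣≤ { - 1ℚ} ≤-refl (∣sign∣≤1 k)

  ∣coeff∣≤ : ∀ k → ∣ (- 1ℚ) ^ k * 1/[2k+1]! k ∣ ≤ 1ℚ * 1/[2k+1]! k
  ∣coeff∣≤ k = ∣p*q∣≤ { (- 1ℚ) ^ k } (∣sign∣≤1 k) (≤-reflexive (0≤p⇒∣p∣≡p (0≤1/[2k+1]! k)))

  ∣x^n∣≤ : ∀ {x} → ∣ x ∣ ≤ B → ∀ n → ∣ x ^ n ∣ ≤ B ^ n
  ∣x^n∣≤     x≤B zero    = ≤-refl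
  ∣x^n∣≤ {x} x≤B (suc n) = ∣p*q∣≤ {x} x≤B (∣x^n∣≤ x≤B n)

  ∣x^n-y^n∣≤ : ∀ {x y} → ∣ x ∣ ≤ B → ∣ y ∣ ≤ B → ∀ n →
    ∣ x ^ suc n - y ^ suc n ∣ ≤ ι (suc n) * B ^ n * ∣ x - y ∣
  ∣x^n-y^n∣≤ {x} {y} x≤B y≤B zero = ≤-reflexive
    (trans (cong ∣_∣ (cong₂ _-_ (*-identityʳ x) (*-identityʳ y))) (sym (*-identityˡ ∣ x - y ∣)))
  ∣x^n-y^n∣≤ {x} {y} x≤B y≤B (suc n) = begin
    ∣ x * X - y * Y ∣
      ≡⟨ cong ∣_∣ (solve 4 (λ x y X Y → x :* X :- y :* Y := x :* (X :- Y) :+ (x :- y) :* Y) refl x y X Y) ⟩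
    ∣ x * (X - Y) + (x - y) * Y ∣
      ≤⟨ ∣p+q∣≤ (∣p*q∣≤ {x} x≤B (∣x^n-y^n∣≤ x≤B y≤B n)) (∣p*q∣≤ {x - y} ≤-refl (∣x^n∣≤ y≤B (suc n))) ⟩
    B * (ι (suc n) * B ^ n * d) + d * (B * B ^ n)
      ≡⟨ solve 4 (λ b i p d → b :* (i :* p :* d) :+ d :* (b :* p) := (i :+ con 1ℚ) :* (b :* p) :* d) refl
           B (ι (suc n)) (B ^ n) d ⟩
    (ι (suc n) + 1ℚ) * (B * B ^ n) * d
      ≡⟨ cong (λ i → i * (B * B ^ n) * d) (ι-homo-+1 (suc n)) ⟨
    ι (suc (suc n)) * B ^ suc n * d ∎
    where
    X = x ^ suc n
    Y = y ^ suc n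
    d = ∣ x - y ∣

  ∣sinTerm∣≤ : ∀ {x} → ∣ x ∣ ≤ B → ∀ k → ∣ sinTerm x k ∣ ≤ B * M * ½ ^ k
  ∣sinTerm∣≤ {x} x≤B k = begin
    ∣ sinTerm x k ∣
      ≤⟨ ∣p*q∣≤ { (- 1ℚ) ^ k * r } (∣coeff∣≤ k) (∣x^n∣≤ x≤B (suc (2 ℕ.* k))) ⟩
    1ℚ * r * (B * p)
      ≡⟨ solve 3 (λ r b p → con 1ℚ :* r :* (b :* p) := b :* (con 1ℚ :* (p :* r))) refl r B p ⟩
    B * (1ℚ * (p * r))
      ≤⟨ *-monoʳ-≤′ (0≤ι b) (*-monoˡ-≤′ (*-mono-0≤ (0≤B^n (2 ℕ.* k)) (0≤1/[2k+1]! k)) (ι-mono-≤ {1} (ℕ.s≤s ℕ.z≤n))) ⟩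
    B * (ι (suc (2 ℕ.* k)) * (p * r))
      ≡⟨ cong (B *_) (*-assoc (ι (suc (2 ℕ.* k))) p r) ⟨
    B * (ι (suc (2 ℕ.* k)) * p * r)
      ≤⟨ *-monoʳ-≤′ (0≤ι b) (majorant k) ⟩
    B * (M * ½ ^ k)
      ≡⟨ *-assoc B M (½ ^ k) ⟨
    B * M * ½ ^ k ∎
    where
    r = 1/[2k+1]! k
    p = B ^ (2 ℕ.* k)

  sinTerm-lipschitz : ∀ {x y} → ∣ x ∣ ≤ B → ∣ y ∣ ≤ B → ∀ k →
    ∣ sinTerm x k - sinTerm y k ∣ ≤ M * ½ ^ k * ∣ x - y ∣
  sinTerm-lipschitz {x} {y} x≤B y≤B k = begin
    ∣ sinTerm x k - sinTerm y k ∣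
      ≡⟨ cong ∣_∣ (solve 3 (λ c X Y → c :* X :- c :* Y := c :* (X :- Y)) refl
           ((- 1ℚ) ^ k * r) (x ^ suc (2 ℕ.* k)) (y ^ suc (2 ℕ.* k))) ⟩
    ∣ (- 1ℚ) ^ k * r * (x ^ suc (2 ℕ.* k) - y ^ suc (2 ℕ.* k)) ∣
      ≤⟨ ∣p*q∣≤ { (- 1ℚ) ^ k * r } (∣coeff∣≤ k) (∣x^n-y^n∣≤ x≤B y≤B (2 ℕ.* k)) ⟩
    1ℚ * r * (a * d)
      ≡⟨ solve 3 (λ r a d → con 1ℚ :* r :* (a :* d) := a :* r :* d) refl r a d ⟩
    a * r * d
      ≤⟨ *-monoˡ-≤′ (0≤∣p∣ (x - y)) (majorant k) ⟩
    M * ½ ^ k * d ∎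
    where
    r = 1/[2k+1]! k
    a = ι (suc (2 ℕ.* k)) * B ^ (2 ℕ.* k)
    d = ∣ x - y ∣

  sinSum-lipschitz′ : ∀ {x y} → ∣ x ∣ ≤ B → ∣ y ∣ ≤ B → ∀ n →
    ∣ sinSum x n - sinSum y n ∣ ≤ M * ∣ x - y ∣ * (ι 2 - ι 2 * ½ ^ n)
  sinSum-lipschitz′ {x} {y} x≤B y≤B zero =
    ≤-reflexive (sym (*-zeroʳ (M * ∣ x - y ∣)))
  sinSum-lipschitz′ {x} {y} x≤B y≤B (suc n) = begin
    ∣ (S + s) - (T + t) ∣
      ≡⟨ cong ∣_∣ (solve 4 (λ S s T t → (S :+ s) :- (T :+ t) := (S :- T) :+ (s :- t)) refl S s T t) ⟩
    ∣ (S - T) + (s - t) ∣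
      ≤⟨ ∣p+q∣≤ (sinSum-lipschitz′ x≤B y≤B n) (sinTerm-lipschitz x≤B y≤B n) ⟩
    M * d * (ι 2 - ι 2 * h) + M * h * d
      ≡⟨ solve 3 (λ m d h → m :* d :* (con (ι 2) :- con (ι 2) :* h) :+ m :* h :* d
                         := m :* d :* (con (ι 2) :- con (ι 2) :* (con ½ :* h))) refl M d h ⟩
    M * d * (ι 2 - ι 2 * ½ ^ suc n) ∎
    where
    S = sinSum x n
    s = sinTerm x n
    T = sinSum y n
    t = sinTerm y n
    d = ∣ x - y ∣
    h = ½ ^ n

  sinSum-lipschitz : ∀ {x y} → ∣ x ∣ ≤ B → ∣ y ∣ ≤ B → ∀ n →
    ∣ sinSum x n - sinSum y n ∣ ≤ ι 2 * M * ∣ x - y ∣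
  sinSum-lipschitz {x} {y} x≤B y≤B n = begin
    ∣ sinSum x n - sinSum y n ∣         ≤⟨ sinSum-lipschitz′ x≤B y≤B n ⟩
    M * d * (ι 2 - ι 2 * ½ ^ n)         ≤⟨ *-monoʳ-≤′ (*-mono-0≤ 0≤M (0≤∣p∣ (x - y)))
                                            (+-monoʳ-≤ (ι 2) (neg-antimono-≤ (*-mono-0≤ (0≤ι 2) (0≤½^n n)))) ⟩
    M * d * (ι 2 - 0ℚ)                  ≡⟨ solve 2 (λ m d → m :* d :* (con (ι 2) :- con 0ℚ) := con (ι 2) :* m :* d) refl M d ⟩
    ι 2 * M * d                         ∎
    where d = ∣ x - y ∣

  sinSum-tail′ : ∀ {x} → ∣ x ∣ ≤ B → ∀ n j →
    ∣ sinSum x (j ℕ.+ n) - sinSum x n ∣ ≤ B * M * (ι 2 * ½ ^ n - ι 2 * ½ ^ (j ℕ.+ n))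
  sinSum-tail′ {x} x≤B n zero = ≤-reflexive (trans
    (cong ∣_∣ (+-inverseʳ (sinSum x n)))
    (solve 2 (λ k h → con 0ℚ := k :* (h :- h)) refl (B * M) (ι 2 * ½ ^ n)))
  sinSum-tail′ {x} x≤B n (suc j) = begin
    ∣ (S + s) - T ∣
      ≡⟨ cong ∣_∣ (solve 3 (λ S s T → (S :+ s) :- T := (S :- T) :+ s) refl S s T) ⟩
    ∣ (S - T) + s ∣
      ≤⟨ ∣p+q∣≤ (sinSum-tail′ x≤B n j) (∣sinTerm∣≤ x≤B (j ℕ.+ n)) ⟩
    B * M * (g - ι 2 * h) + B * M * h
      ≡⟨ solve 3 (λ k g h → k :* (g :- con (ι 2) :* h) :+ k :* h
                         := k :* (g :- con (ι 2) :* (con ½ :* h))) refl (B * M) g h ⟩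
    B * M * (g - ι 2 * ½ ^ suc (j ℕ.+ n)) ∎
    where
    S = sinSum x (j ℕ.+ n)
    s = sinTerm x (j ℕ.+ n)
    T = sinSum x n
    g = ι 2 * ½ ^ n
    h = ½ ^ (j ℕ.+ n)

  sinSum-tail : ∀ {x} → ∣ x ∣ ≤ B → ∀ {m n} → n ℕ.≤ m →
    ∣ sinSum x m - sinSum x n ∣ ≤ ι 2 * B * M * ½ ^ n
  sinSum-tail {x} x≤B {m} {n} n≤m = begin
    ∣ sinSum x m - sinSum x n ∣
      ≡⟨ cong (λ i → ∣ sinSum x i - sinSum x n ∣) (ℕₚ.m∸n+n≡m n≤m) ⟨
    ∣ sinSum x ((m ℕ.∸ n) ℕ.+ n) - sinSum x n ∣
      ≤⟨ sinSum-tail′ x≤B n (m ℕ.∸ n) ⟩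
    B * M * (ι 2 * ½ ^ n - ι 2 * ½ ^ ((m ℕ.∸ n) ℕ.+ n))
      ≤⟨ *-monoʳ-≤′ (*-mono-0≤ (0≤ι b) 0≤M) (+-monoʳ-≤ (ι 2 * ½ ^ n)
           (neg-antimono-≤ (*-mono-0≤ (0≤ι 2) (0≤½^n ((m ℕ.∸ n) ℕ.+ n))))) ⟩
    B * M * (ι 2 * ½ ^ n - 0ℚ)
      ≡⟨ solve 3 (λ b m h → b :* m :* (con (ι 2) :* h :- con 0ℚ) := con (ι 2) :* b :* m :* h) refl B M (½ ^ n) ⟩
    ι 2 * B * M * ½ ^ n ∎

-- sin x = Σ (-1)ᵏ x²ᵏ⁺¹ / (2k+1)!, computed along the diagonal: the nth
-- partial sum of the series is evaluated at the nth approximation of x.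
sin : ℝ → ℝ
sin x = mkℝ diag (cauchy-scaled diag K 0≤K λ ε 0<ε →
  let N₂ , close = cauchy x ε 0<ε
      N₃ = ↧ₙ ε
      N₂₃ = N₂ ℕ.⊔ N₃
      ordered : ∀ m n → N₁ ℕ.⊔ N₂₃ ℕ.≤ m → N₁ ℕ.⊔ N₂₃ ℕ.≤ n → n ℕ.≤ m → ∣ diag m - diag n ∣ ≤ K * ε
      ordered m n N≤m N≤n n≤m =
        let N₂₃≤m = ℕₚ.m⊔n≤o⇒n≤o N₁ N₂₃ N≤m
            N₂₃≤n = ℕₚ.m⊔n≤o⇒n≤o N₁ N₂₃ N≤n
            xm≤B = bound m (ℕₚ.m⊔n≤o⇒m≤o N₁ N₂₃ N≤m)
            xn≤B = bound n (ℕₚ.m⊔n≤o⇒m≤o N₁ N₂₃ N≤n)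
            a = sinSum (seq x m) n
        in begin
        ∣ diag m - diag n ∣
          ≡⟨ cong ∣_∣ (solve 3 (λ p q r → p :- r := (p :- q) :+ (q :- r)) refl (diag m) a (diag n)) ⟩
        ∣ (diag m - a) + (a - diag n) ∣
          ≤⟨ ∣p+q∣≤ (≤-trans (sinSum-tail xm≤B n≤m)
                       (*-monoʳ-≤′ 0≤K₁ (½^n≤ 0<ε n (ℕₚ.m⊔n≤o⇒n≤o N₂ N₃ N₂₃≤n))))
                    (≤-trans (sinSum-lipschitz xm≤B xn≤B n)
                       (*-monoʳ-≤′ 0≤K₂ (<⇒≤ (close m n (ℕₚ.m⊔n≤o⇒m≤o N₂ N₃ N₂₃≤m)
                                                         (ℕₚ.m⊔n≤o⇒m≤o N₂ N₃ N₂₃≤n))))) ⟩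
        K₁ * ε + K₂ * ε
          ≡⟨ *-distribʳ-+ ε K₁ K₂ ⟨
        K * ε ∎
  in N₁ ℕ.⊔ N₂₃ , λ m n N≤m N≤n → either m n (ordered m n N≤m N≤n) (ordered n m N≤n N≤m))
  where
  open ≤-Reasoning
  b = proj₁ (eventually-bounded x)
  N₁ = proj₁ (proj₂ (eventually-bounded x))
  bound = proj₂ (proj₂ (eventually-bounded x))
  open SinBounds b
  diag : ℕ → ℚ
  diag n = sinSum (seq x n) n
  K₁ = ι 2 * B * M
  K₂ = ι 2 * M
  K = K₁ + K₂
  0≤K₁ : 0ℚ ≤ K₁
  0≤K₁ = *-mono-0≤ (*-mono-0≤ (0≤ι 2) (0≤ι b)) 0≤M
  0≤K₂ : 0ℚ ≤ K₂
  0≤K₂ = *-mono-0≤ (0≤ι 2) 0≤M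
  0≤K : 0ℚ ≤ K
  0≤K = +-mono-0≤ 0≤K₁ 0≤K₂
  either : ∀ m n {E} → (n ℕ.≤ m → ∣ diag m - diag n ∣ ≤ E) → (m ℕ.≤ n → ∣ diag n - diag m ∣ ≤ E) →
    ∣ diag m - diag n ∣ ≤ E
  either m n f g with ℕₚ.≤-total n m
  ... | inj₁ n≤m = f n≤m
  ... | inj₂ m≤n = subst (_≤ _) (∣p-q∣≡∣q-p∣ (diag n) (diag m)) (g m≤n)

0<2x : ∀ {x} → 0ᵣ <ᵣ x → 0ᵣ <ᵣ 2ᵣ *ᵣ x
0<2x {x} (ε , 0<ε , N , h) = ι 2 * ε , subst (_< ι 2 * ε) (*-zeroʳ (ι 2)) (*-monoʳ-<-pos (ι 2) 0<ε) , N ,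
  λ n N≤n → subst (_< ι 2 * seq x n)
    (solve 1 (λ e → con (ι 2) :* (con 0ℚ :+ e) := con 0ℚ :+ con (ι 2) :* e) refl ε)
    (*-monoʳ-<-pos (ι 2) (h n N≤n))

-- π is the least positive zero of sin.  That there is no zero in between is
-- stated constructively: sin is positive on (0 , π).
record IsPi (π : ℝ) : Set where
  field
    π-pos   : 0ᵣ <ᵣ π
    sin-π   : sin π ≈ᵣ 0ᵣ
    sin-pos : ∀ x → 0ᵣ <ᵣ x → x <ᵣ π → 0ᵣ <ᵣ sin x

  2π-pos : 0ᵣ <ᵣ 2ᵣ *ᵣ π
  2π-pos = 0<2x {π} π-pos

-- In place of “every upper bound is ≥ s”, the second component says that no
-- y < s is an upper bound, with an explicit witness; likewise for IsInf.
IsSup : (ℕ → ℝ) → ℝ → Set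
IsSup a s = (∀ n → a n ≤ᵣ s) × (∀ y → y <ᵣ s → ∃ λ n → y <ᵣ a n)

IsInf : (ℕ → ℝ) → ℝ → Set
IsInf a s = (∀ n → s ≤ᵣ a n) × (∀ y → s <ᵣ y → ∃ λ n → a n <ᵣ y)

-- lim sup a = infₙ supₖ aₙ₊ₖ, and dually for lim inf.
IsLimsup : (ℕ → ℝ) → ℝ → Set
IsLimsup a L = Σ (ℕ → ℝ) λ s → (∀ n → IsSup (λ k → a (n ℕ.+ k)) (s n)) × IsInf s L

IsLiminf : (ℕ → ℝ) → ℝ → Set
IsLiminf a L = Σ (ℕ → ℝ) λ s → (∀ n → IsInf (λ k → a (n ℕ.+ k)) (s n)) × IsSup s L

-- Write S(q) = sin (π q) and let q(Q) be the product of the 2 S(xₙ) over 1 ≤ n < Q.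
-- As x₂ₙ = xₙ / 2 and x₂ₙ₊₁ = 1/2 + xₙ / 2, the double-angle formula gives
--   q(2Q) = 2 q(Q)   and   q(2Q + 1) = 4 S(x_Q / 2) q(Q).
-- Limes superior: q(Q) / Q² is halved when a binary digit 0 is appended to Q and
-- does not grow when a digit 1 is.  Starting from small Q this keeps it below
-- 5/32 ≤ 1 / 2π unless Q = 2ⁿ − 1, in which case q(Q) = 2ⁿ⁻¹ / S(2⁻ⁿ) ~ 4ⁿ / 2π.
-- Limes inferior: by Jordan's inequality S(x_Q / 2) ≥ x_Q, the quantity 2 x_Q q(Q)
-- is at least doubled by each further digit 1, so that q(Q) ≥ 4 > π for Q > 2
-- unless Q = 2ᵏ + 1, in which case q(Q) = 2ᵏ⁺¹ S(2⁻ᵏ⁻¹) → π from below.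
-- The addition formulas come from Cauchy products of rational partial sums.

module Submission where

open import Defs
open import Algebra.Bundles using (CommutativeRing)
import Algebra.Consequences.Setoid as Consequences
import Algebra.Solver.Ring as RingSolver
open import Algebra.Solver.Ring.AlmostCommutativeRing
  using (fromCommutativeRing; _-Raw-AlmostCommutative⟶_; Induced-equivalence)
open import Data.Integer using (+_)
open import Data.Nat as ℕ using (ℕ; zero; suc; _!; _^_)
open import Data.Nat.Divisibility using (divides)
import Data.Nat.DivMod as DivMod
import Data.Nat.Properties as ℕₚ
open import Data.Product using (∃; _×_; _,_; proj₁; proj₂)
open import Data.Rational
  using (ℚ; 0ℚ; 1ℚ; ½; _+_; _-_; _*_; -_; ∣_∣; _⊔_; _/_; 1/_; _≤_; _<_; Positive; positive; ↧ₙ_)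
open import Data.Rational.Properties hiding (≃-sym)
open import Data.Rational.Solver using (module +-*-Solver)
open import Data.Sum as Sum using (_⊎_; inj₁; inj₂)
open import Function using (_∘_)
open import Relation.Binary.Bundles using (Poset; Setoid)
open import Relation.Binary.Definitions using (WeaklyDecidable)
open import Relation.Binary.PropositionalEquality
  using (_≡_; refl; sym; trans; cong; cong₂; subst; subst₂; module ≡-Reasoning)
import Relation.Binary.Reasoning.PartialOrder as PosetReasoning
open import Relation.Nullary using (¬_; yes; no; contradiction)
import Relation.Nullary.Decidable.Core as Dec

open import Algebra.Properties.Semiring.Exp (CommutativeRing.semiring +-*-commutativeRing)
  using () renaming (_^_ to _^ℚ_)
open +-*-Solver using (solve; _:=_; _:+_; _:*_; _:-_; :-_; con)

-- Real arithmetic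

-- π is known only through `IsPi`, so every numerical fact about it has to be derived. The one upper
-- bound used is π ≤ 16/5, from sin (16/5) ≤ 0, and it fixes the constants: 5/32 is 1 / (2 · 16/5),
-- 4 exceeds 16/5, and angles up to π/4 are at most 4/5, within the range of the cubic bounds x - x³
-- ≤ sin x ≤ x. Suprema of tails have to be constructed as Cauchy sequences, and boundedness does
-- not provide a modulus. Each limit is therefore reduced to two effective estimates: an explicit
-- rate on one side for all late terms, and arbitrarily late terms on the far side of the limit
-- itself. The second estimate holds without any error because sin x ≤ x is applied to both
-- exceptional families: the products at N = 2ᵏ are at most π, and those at N = 2ⁿ - 2 are at least
-- (N + 2)² / 2π. With Q = N + 1 = 2ⁿ - 1 the natural comparison is with (Q + 1)² = 4ⁿ, not with N²;
-- the quotient (1 + 2/N)² is absorbed at the very end.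

Eventually : (ℕ → Set) → Set
Eventually A = ∃ λ N → ∀ n → N ℕ.≤ n → A n

always : ∀ {A} → (∀ n → A n) → Eventually A
always h = 0 , λ n _ → h n

Ev-map : ∀ {A B} → (∀ n → A n → B n) → Eventually A → Eventually B
Ev-map f (N , h) = N , λ n N≤n → f n (h n N≤n)

Ev-zip : ∀ {A B C} → (∀ n → A n → B n → C n) → Eventually A → Eventually B → Eventually C
Ev-zip f (M , g) (N , h) = M ℕ.⊔ N , λ n le →
  f n (g n (ℕₚ.m⊔n≤o⇒m≤o M N le)) (h n (ℕₚ.m⊔n≤o⇒n≤o M N le))

0<½*_ : ∀ {ε} → 0ℚ < ε → 0ℚ < ½ * ε
0<½* 0<ε = *-monoʳ-<-pos ½ 0<ε

½+½ : ∀ ε → ½ * ε + ½ * ε ≡ ε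
½+½ = solve 1 (λ e → con ½ :* e :+ con ½ :* e := e) refl

½*<_ : ∀ {ε} → 0ℚ < ε → ½ * ε < ε
½*<_ {ε} 0<ε = subst₂ _<_ (+-identityʳ (½ * ε)) (½+½ ε) (+-monoʳ-< (½ * ε) (0<½* 0<ε))

p<p+ε : ∀ p {ε} → 0ℚ < ε → p < p + ε
p<p+ε p {ε} 0<ε = subst (_< p + ε) (+-identityʳ p) (+-monoʳ-< p 0<ε)

p≤q⇒0≤q-p : ∀ {p q} → p ≤ q → 0ℚ ≤ q - p
p≤q⇒0≤q-p {p} {q} p≤q = subst (_≤ q - p) (+-inverseʳ p) (+-monoˡ-≤ (- p) p≤q)

0≤p*p : ∀ p → 0ℚ ≤ p * p
0≤p*p p with ≤-total 0ℚ p
... | inj₁ 0≤p = *-mono-0≤ 0≤p 0≤p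
... | inj₂ p≤0 = subst (0ℚ ≤_) (solve 1 (λ p → :- p :* :- p := p :* p) refl p)
  (*-mono-0≤ (neg-antimono-≤ p≤0) (neg-antimono-≤ p≤0))

∣p-q∣<⇒ : ∀ {p q ε} → ∣ p - q ∣ < ε → p < q + ε
∣p-q∣<⇒ {p} {q} {ε} h = subst (_< q + ε) (solve 2 (λ p q → q :+ (p :- q) := p) refl p q)
  (+-monoʳ-< q (≤-<-trans (p≤∣p∣ (p - q)) h))

⇒∣p-q∣≤ : ∀ {p q ε} → p ≤ q + ε → q ≤ p + ε → ∣ p - q ∣ ≤ ε
⇒∣p-q∣≤ {p} {q} {ε} a b = ∣p∣≤
  (subst (p - q ≤_) (solve 2 (λ q e → q :+ e :- q := e) refl q ε) (+-monoˡ-≤ (- q) a))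
  (subst₂ _≤_ (solve 2 (λ p q → q :- p := :- (p :- q)) refl p q)
    (solve 2 (λ p e → p :+ e :- p := e) refl p ε) (+-monoˡ-≤ (- p) b))

shrink : ∀ K → 0ℚ ≤ K → ∀ {ε} → 0ℚ < ε → ∃ λ δ → 0ℚ < δ × K * δ < ε
shrink K 0≤K {ε} 0<ε = δ , positive⁻¹ δ , (begin-strict
  K * δ                  <⟨ *-monoˡ-<-pos δ (p<p+1 K) ⟩
  (K + 1ℚ) * δ           ≡⟨ solve 3 (λ k e r → k :* (e :* r) := e :* (r :* k)) refl (K + 1ℚ) ε r ⟩
  ε * (r * (K + 1ℚ))     ≡⟨ cong (ε *_) (*-inverseˡ (K + 1ℚ)) ⟩
  ε * 1ℚ                 ≡⟨ *-identityʳ ε ⟩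
  ε                      ∎)
  where
  open ≤-Reasoning
  instance
    K+1-pos : Positive (K + 1ℚ)
    K+1-pos = positive (≤-<-trans 0≤K (p<p+1 K))
    K+1≢0 = pos⇒nonZero (K + 1ℚ)
    ε-pos : Positive ε
    ε-pos = positive 0<ε
  r = 1/ (K + 1ℚ)
  instance
    r-pos : Positive r
    r-pos = 1/pos⇒pos (K + 1ℚ)
  δ = ε * r
  instance
    δ-pos : Positive δ
    δ-pos = pos*pos⇒pos ε r

infix 4 _≃_ _≼_ _≺_

-- The relations and operations of Defs unfold, so arguments could not be
-- inferred from them; hence these wrappers and the opaque copies below.
record _≃_ (x y : ℝ) : Set where
  constructor ⟪_⟫
  field ≃⇒≈ : x ≈ᵣ y
open _≃_ public

record _≼_ (x y : ℝ) : Set where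
  constructor ⟪_⟫
  field ≼⇒≤ : x ≤ᵣ y
open _≼_ public

record _≺_ (x y : ℝ) : Set where
  constructor ⟪_⟫
  field ≺⇒< : x <ᵣ y
open _≺_ public

infixl 6 _+ᵣ_ _-ᵣ_
infixl 6 _⊔ᵣ_
infixl 7 _·_
infix  8 -ᵣ_

⊔-≤+ : ∀ {p p′ q q′ ε} → p ≤ p′ + ε → q ≤ q′ + ε → p ⊔ q ≤ (p′ ⊔ q′) + ε
⊔-≤+ {p} {p′} {q} {q′} {ε} a b = ⊔-lub
  (≤-trans a (+-monoˡ-≤ ε (p≤p⊔q p′ q′))) (≤-trans b (+-monoˡ-≤ ε (p≤q⊔p p′ q′)))

∣⊔-⊔∣≤ : ∀ {p p′ q q′ ε} → ∣ p - p′ ∣ < ε → ∣ q - q′ ∣ < ε → ∣ (p ⊔ q) - (p′ ⊔ q′) ∣ ≤ ε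
∣⊔-⊔∣≤ {p} {p′} {q} {q′} {ε} a b = ⇒∣p-q∣≤
  (⊔-≤+ {p} {p′} {q} {q′} (<⇒≤ (∣p-q∣<⇒ a)) (<⇒≤ (∣p-q∣<⇒ b)))
  (⊔-≤+ {p′} {p} {q′} {q} (<⇒≤ (∣p-q∣<⇒ (subst (_< ε) (∣p-q∣≡∣q-p∣ p p′) a)))
        (<⇒≤ (∣p-q∣<⇒ (subst (_< ε) (∣p-q∣≡∣q-p∣ q q′) b))))

opaque
  _+ᵣ_ : ℝ → ℝ → ℝ
  x +ᵣ y = mkℝ (λ n → seq x n + seq y n) λ ε 0<ε →
    let M , f = cauchy x (½ * ε) (0<½* 0<ε)
        N , g = cauchy y (½ * ε) (0<½* 0<ε)
    in M ℕ.⊔ N , λ m n ≤m ≤n → subst₂ _<_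
         (cong ∣_∣ (solve 4 (λ a b c d → (a :- c) :+ (b :- d) := (a :+ b) :- (c :+ d)) refl
           (seq x m) (seq y m) (seq x n) (seq y n)))
         (½+½ ε)
         (≤-<-trans (∣p+q∣≤∣p∣+∣q∣ (seq x m - seq x n) (seq y m - seq y n)) (+-mono-<
           (f m n (ℕₚ.m⊔n≤o⇒m≤o M N ≤m) (ℕₚ.m⊔n≤o⇒m≤o M N ≤n))
           (g m n (ℕₚ.m⊔n≤o⇒n≤o M N ≤m) (ℕₚ.m⊔n≤o⇒n≤o M N ≤n))))

  -ᵣ_ : ℝ → ℝ
  -ᵣ x = mkℝ (λ n → - seq x n) λ ε 0<ε → let N , h = cauchy x ε 0<ε in
    N , λ m n ≤m ≤n → subst (_< ε)
      (cong ∣_∣ (solve 2 (λ a b → b :- a := :- a :- :- b) refl (seq x m) (seq x n))) (h n m ≤n ≤m)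

  _·_ : ℝ → ℝ → ℝ
  _·_ = _*ᵣ_

  _⊔ᵣ_ : ℝ → ℝ → ℝ
  x ⊔ᵣ y = mkℝ (λ n → seq x n ⊔ seq y n) λ ε 0<ε →
    let M , f = cauchy x (½ * ε) (0<½* 0<ε)
        N , g = cauchy y (½ * ε) (0<½* 0<ε)
    in M ℕ.⊔ N , λ m n ≤m ≤n → ≤-<-trans
         (∣⊔-⊔∣≤ {seq x m} {seq x n} {seq y m} {seq y n}
           (f m n (ℕₚ.m⊔n≤o⇒m≤o M N ≤m) (ℕₚ.m⊔n≤o⇒m≤o M N ≤n))
           (g m n (ℕₚ.m⊔n≤o⇒n≤o M N ≤m) (ℕₚ.m⊔n≤o⇒n≤o M N ≤n)))
         (½*< 0<ε)

  absᵣ : ℝ → ℝ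
  absᵣ = ∣_∣ᵣ

  𝕢 : ℚ → ℝ
  𝕢 = fromℚ

_-ᵣ_ : ℝ → ℝ → ℝ
x -ᵣ y = x +ᵣ -ᵣ y

0# 1# : ℝ
0# = 𝕢 0ℚ
1# = 𝕢 1ℚ

pointwise : ∀ {x y} → (∀ n → seq x n ≡ seq y n) → x ≃ y
pointwise {x} {y} h = ⟪ (λ ε 0<ε → always λ n → subst (_< ε)
  (sym (cong ∣_∣ (trans (cong (_- seq y n) (h n)) (+-inverseʳ (seq y n))))) 0<ε) ⟫

≃-scaled : ∀ {x y} K → 0ℚ ≤ K →
  (∀ ε → 0ℚ < ε → Eventually λ n → ∣ seq x n - seq y n ∣ ≤ K * ε) → x ≃ y
≃-scaled K 0≤K h = ⟪ (λ ε 0<ε → let δ , 0<δ , Kδ<ε = shrink K 0≤K 0<ε in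
  Ev-map (λ n le → ≤-<-trans le Kδ<ε) (h δ 0<δ)) ⟫

≃-refl : ∀ {x} → x ≃ x
≃-refl = pointwise λ _ → refl

≃-sym : ∀ {x y} → x ≃ y → y ≃ x
≃-sym {x} {y} ⟪ h ⟫ = ⟪ (λ ε 0<ε → Ev-map (λ n → subst (_< ε) (∣p-q∣≡∣q-p∣ (seq x n) (seq y n))) (h ε 0<ε)) ⟫

≼-intro : ∀ {x y} → (∀ ε → 0ℚ < ε → Eventually λ n → seq x n ≤ seq y n + ε) → x ≼ y
≼-intro {x} {y} h = ⟪ (λ ε 0<ε → Ev-map (λ n le → ≤-<-trans le (+-monoʳ-< (seq y n) (½*< 0<ε)))
  (h (½ * ε) (0<½* 0<ε))) ⟫

≼-pointwise : ∀ {x y} → (∀ n → seq x n ≤ seq y n) → x ≼ y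
≼-pointwise {x} {y} h = ⟪ (λ ε 0<ε → always λ n → ≤-<-trans (h n) (p<p+ε (seq y n) 0<ε)) ⟫

≃⇒≼ : ∀ {x y} → x ≃ y → x ≼ y
≃⇒≼ ⟪ h ⟫ = ⟪ (λ ε 0<ε → Ev-map (λ n → ∣p-q∣<⇒) (h ε 0<ε)) ⟫

≼-refl : ∀ {x} → x ≼ x
≼-refl = ≼-pointwise λ _ → ≤-refl

≼-trans : ∀ {x y z} → x ≼ y → y ≼ z → x ≼ z
≼-trans {x} {y} {z} ⟪ g ⟫ ⟪ h ⟫ = ⟪ (λ ε 0<ε → Ev-zip
  (λ n a b → <-trans a (subst (seq y n + ½ * ε <_)
    (trans (+-assoc (seq z n) (½ * ε) (½ * ε)) (cong (λ t → seq z n + t) (½+½ ε))) (+-monoˡ-< (½ * ε) b)))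
  (g (½ * ε) (0<½* 0<ε)) (h (½ * ε) (0<½* 0<ε))) ⟫

≼-antisym : ∀ {x y} → x ≼ y → y ≼ x → x ≃ y
≼-antisym {x} {y} ⟪ g ⟫ ⟪ h ⟫ = ⟪ (λ ε 0<ε → Ev-zip
  (λ n a b → ≤-<-trans (⇒∣p-q∣≤ (<⇒≤ a) (<⇒≤ b)) (½*< 0<ε))
  (g (½ * ε) (0<½* 0<ε)) (h (½ * ε) (0<½* 0<ε))) ⟫

≃-trans : ∀ {x y z} → x ≃ y → y ≃ z → x ≃ z
≃-trans g h = ≼-antisym (≼-trans (≃⇒≼ g) (≃⇒≼ h)) (≼-trans (≃⇒≼ (≃-sym h)) (≃⇒≼ (≃-sym g)))

≼-poset : Poset _ _ _
≼-poset = record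
  { Carrier = ℝ ; _≈_ = _≃_ ; _≤_ = _≼_
  ; isPartialOrder = record
    { isPreorder = record
      { isEquivalence = record { refl = ≃-refl ; sym = ≃-sym ; trans = ≃-trans }
      ; reflexive = ≃⇒≼ ; trans = ≼-trans }
    ; antisym = ≼-antisym } }

module ≼-Reasoning = PosetReasoning ≼-poset

opaque
  unfolding _+ᵣ_ -ᵣ_

  +-mono-≼ : ∀ {x y z w} → x ≼ y → z ≼ w → x +ᵣ z ≼ y +ᵣ w
  +-mono-≼ {x} {y} {z} {w} ⟪ g ⟫ ⟪ h ⟫ = ⟪ (λ ε 0<ε → Ev-zip
    (λ n a b → subst (seq x n + seq z n <_)
      (trans (solve 3 (λ y w e → (y :+ e) :+ (w :+ e) := (y :+ w) :+ (e :+ e)) refl (seq y n) (seq w n) (½ * ε))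
        (cong (λ t → seq y n + seq w n + t) (½+½ ε))) (+-mono-< a b))
    (g (½ * ε) (0<½* 0<ε)) (h (½ * ε) (0<½* 0<ε))) ⟫

  neg-mono-≼ : ∀ {x y} → x ≼ y → -ᵣ y ≼ -ᵣ x
  neg-mono-≼ {x} {y} ⟪ h ⟫ = ⟪ (λ ε 0<ε → Ev-map (λ n a → subst₂ _<_
      (solve 3 (λ x y e → x :+ (:- x :- y) := :- y) refl (seq x n) (seq y n) ε)
      (solve 3 (λ x y e → (y :+ e) :+ (:- x :- y) := :- x :+ e) refl (seq x n) (seq y n) ε)
      (+-monoˡ-< (- seq x n - seq y n) a))
    (h ε 0<ε)) ⟫

+-cong : ∀ {x y z w} → x ≃ y → z ≃ w → x +ᵣ z ≃ y +ᵣ w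
+-cong g h = ≼-antisym (+-mono-≼ (≃⇒≼ g) (≃⇒≼ h)) (+-mono-≼ (≃⇒≼ (≃-sym g)) (≃⇒≼ (≃-sym h)))

neg-cong : ∀ {x y} → x ≃ y → -ᵣ x ≃ -ᵣ y
neg-cong h = ≼-antisym (neg-mono-≼ (≃⇒≼ (≃-sym h))) (neg-mono-≼ (≃⇒≼ h))

opaque
  unfolding _·_

  *-cong : ∀ {x y z w} → x ≃ y → z ≃ w → x · z ≃ y · w
  *-cong {x} {y} {z} {w} ⟪ g ⟫ ⟪ h ⟫ =
    let a , A , ha = eventually-bounded x
        b , B , hb = eventually-bounded w
    in ≃-scaled (ι a + ι b) (+-mono-0≤ (0≤ι a) (0≤ι b)) λ ε 0<ε → Ev-zip
      (λ n (α , β) (γ , δ) → subst₂ _≤_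
        (cong ∣_∣ (solve 4 (λ x y z w → x :* (z :- w) :+ (x :- y) :* w := x :* z :- y :* w) refl
          (seq x n) (seq y n) (seq z n) (seq w n)))
        (solve 3 (λ a b e → a :* e :+ e :* b := (a :+ b) :* e) refl (ι a) (ι b) ε)
        (∣p+q∣≤ (∣p*q∣≤ {seq x n} α (<⇒≤ δ)) (∣p*q∣≤ {seq x n - seq y n} (<⇒≤ γ) β)))
      (Ev-zip (λ _ → _,_) (A , ha) (B , hb)) (Ev-zip (λ _ → _,_) (g ε 0<ε) (h ε 0<ε))

opaque
  unfolding absᵣ 𝕢

  -- `0# ≼ x` still allows each approximant to be slightly negative. Passing to `absᵣ x` gives an
  -- equal real whose approximants are nonnegative termwise, so that facts about rationals apply to
  -- them.
  0≼⇒≃∣∣ : ∀ {x} → 0# ≼ x → x ≃ absᵣ x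
  0≼⇒≃∣∣ {x} ⟪ h ⟫ = ⟪ (λ ε 0<ε → Ev-map (λ n → near (seq x n) ε 0<ε) (h (½ * ε) (0<½* 0<ε))) ⟫
    where
    near : ∀ p ε → 0ℚ < ε → 0ℚ < p + ½ * ε → ∣ p - ∣ p ∣ ∣ < ε
    near p ε 0<ε a with ≤-total 0ℚ p
    ... | inj₁ 0≤p = subst (_< ε) (sym (cong ∣_∣ (trans (cong (λ t → p - t) (0≤p⇒∣p∣≡p 0≤p)) (+-inverseʳ p)))) 0<ε
    ... | inj₂ p≤0 = subst₂ _<_
      (sym (trans (cong (λ t → ∣ p - t ∣) (trans (sym (∣-p∣≡∣p∣ p)) (0≤p⇒∣p∣≡p (neg-antimono-≤ p≤0))))
        (trans (sym (∣-p∣≡∣p∣ (p - - p))) (0≤p⇒∣p∣≡p (subst (0ℚ ≤_) (solve 1 (λ p → :- p :+ :- p := :- (p :- :- p)) refl p)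
          (+-mono-0≤ (neg-antimono-≤ p≤0) (neg-antimono-≤ p≤0)))))))
      (½+½ ε)
      (subst (_< ½ * ε + ½ * ε) (solve 1 (λ p → :- p :+ :- p := :- (p :- :- p)) refl p) (+-mono-< b b))
      where
      b : - p < ½ * ε
      b = subst₂ _<_ (+-identityˡ (- p)) (solve 2 (λ p e → p :+ e :- p := e) refl p (½ * ε)) (+-monoˡ-< (- p) a)

opaque
  unfolding _+ᵣ_ -ᵣ_ _·_ absᵣ 𝕢

  0≼∣x∣·∣y∣ : ∀ x y → 0# ≼ absᵣ x · absᵣ y
  0≼∣x∣·∣y∣ x y = ≼-pointwise λ n → *-mono-0≤ (0≤∣p∣ (seq x n)) (0≤∣p∣ (seq y n))

  0≼x·x : ∀ x → 0# ≼ x · x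
  0≼x·x x = ≼-pointwise λ n → 0≤p*p (seq x n)

  +ᵣ-assoc : ∀ x y z → (x +ᵣ y) +ᵣ z ≃ x +ᵣ (y +ᵣ z)
  +ᵣ-assoc x y z = pointwise λ n → +-assoc (seq x n) (seq y n) (seq z n)

  +ᵣ-comm : ∀ x y → x +ᵣ y ≃ y +ᵣ x
  +ᵣ-comm x y = pointwise λ n → +-comm (seq x n) (seq y n)

  +ᵣ-identityˡ : ∀ x → 0# +ᵣ x ≃ x
  +ᵣ-identityˡ x = pointwise λ n → +-identityˡ (seq x n)

  +ᵣ-inverseˡ : ∀ x → -ᵣ x +ᵣ x ≃ 0#
  +ᵣ-inverseˡ x = pointwise λ n → +-inverseˡ (seq x n)

  ·-assoc : ∀ x y z → (x · y) · z ≃ x · (y · z)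
  ·-assoc x y z = pointwise λ n → *-assoc (seq x n) (seq y n) (seq z n)

  ·-comm : ∀ x y → x · y ≃ y · x
  ·-comm x y = pointwise λ n → *-comm (seq x n) (seq y n)

  ·-identityˡ : ∀ x → 1# · x ≃ x
  ·-identityˡ x = pointwise λ n → *-identityˡ (seq x n)

  ·-distribˡ-+ : ∀ x y z → x · (y +ᵣ z) ≃ x · y +ᵣ x · z
  ·-distribˡ-+ x y z = pointwise λ n → *-distribˡ-+ (seq x n) (seq y n) (seq z n)

  𝕢-+ : ∀ p q → 𝕢 (p + q) ≃ 𝕢 p +ᵣ 𝕢 q
  𝕢-+ p q = pointwise λ _ → refl

  𝕢-· : ∀ p q → 𝕢 (p * q) ≃ 𝕢 p · 𝕢 q
  𝕢-· p q = pointwise λ _ → refl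

  𝕢-neg : ∀ p → 𝕢 (- p) ≃ -ᵣ 𝕢 p
  𝕢-neg p = pointwise λ _ → refl

  𝕢-mono : ∀ {p q} → p ≤ q → 𝕢 p ≼ 𝕢 q
  𝕢-mono p≤q = ≼-pointwise λ _ → p≤q

  𝕢-cancel : ∀ {p q} → 𝕢 p ≼ 𝕢 q → p ≤ q
  𝕢-cancel {p} {q} ⟪ h ⟫ = ≮⇒≥ λ q<p → let
      0<d = subst (_< p - q) (+-inverseʳ q) (+-monoˡ-< (- q) q<p)
      N , f = h (p - q) 0<d
    in <-irrefl refl (subst (p <_) (solve 2 (λ p q → q :+ (p :- q) := p) refl p q) (f N ℕₚ.≤-refl))

  ≺⇒gap : ∀ {x y} → x ≺ y → ∃ λ ε → 0ℚ < ε × x +ᵣ 𝕢 ε ≼ y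
  ≺⇒gap {x} {y} ⟪ ε , 0<ε , h ⟫ = ε , 0<ε , ≼-intro λ η 0<η →
    Ev-map (λ n a → <⇒≤ (<-trans a (p<p+ε (seq y n) 0<η))) h

  x≺x+ε : ∀ {x ε} → 0ℚ < ε → x ≺ x +ᵣ 𝕢 ε
  x≺x+ε {x} {ε} 0<ε = ⟪ ½ * ε , 0<½* 0<ε , always (λ n → +-monoʳ-< (seq x n) (½*< 0<ε)) ⟫

≃-setoid : Setoid _ _
≃-setoid = record { isEquivalence = Poset.isEquivalence ≼-poset }

ℝ-commutativeRing : CommutativeRing _ _
ℝ-commutativeRing = record
  { Carrier = ℝ ; _≈_ = _≃_ ; _+_ = _+ᵣ_ ; _*_ = _·_ ; -_ = -ᵣ_ ; 0# = 0# ; 1# = 1#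
  ; isCommutativeRing = record
    { isRing = record
      { +-isAbelianGroup = record
        { isGroup = record
          { isMonoid = record
            { isSemigroup = record
              { isMagma = record
                { isEquivalence = Poset.isEquivalence ≼-poset ; ∙-cong = +-cong }
              ; assoc = +ᵣ-assoc }
            ; identity = comm∧idˡ⇒id +ᵣ-comm +ᵣ-identityˡ }
          ; inverse = comm∧invˡ⇒inv +ᵣ-comm +ᵣ-inverseˡ
          ; ⁻¹-cong = neg-cong }
        ; comm = +ᵣ-comm }
      ; *-cong = *-cong
      ; *-assoc = ·-assoc
      ; *-identity = comm∧idˡ⇒id ·-comm ·-identityˡ
      ; distrib = comm∧distrˡ⇒distr +-cong ·-comm ·-distribˡ-+ }
    ; *-comm = ·-comm } }
  where
  open Consequences ≃-setoid

-- With the rationals as coefficients, the solver for real identities can calculate with constants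
-- such as ½ and 16/5.
𝕢-homomorphism : CommutativeRing.rawRing +-*-commutativeRing
  -Raw-AlmostCommutative⟶ fromCommutativeRing ℝ-commutativeRing
𝕢-homomorphism = record
  { ⟦_⟧ = 𝕢 ; +-homo = 𝕢-+ ; *-homo = 𝕢-· ; -‿homo = 𝕢-neg
  ; 0-homo = ≃-refl ; 1-homo = ≃-refl }

_𝕢≟_ : WeaklyDecidable (Induced-equivalence 𝕢-homomorphism)
p 𝕢≟ q = Dec.dec⇒maybe (Dec.map′ (λ { refl → ≃-refl })
  (λ h → ≤-antisym (𝕢-cancel (≃⇒≼ h)) (𝕢-cancel (≃⇒≼ (≃-sym h)))) (p ≟ q))

module ℝ-Solver = RingSolver (CommutativeRing.rawRing +-*-commutativeRing)
  (fromCommutativeRing ℝ-commutativeRing) 𝕢-homomorphism _𝕢≟_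

*-mono-0≼ : ∀ {x y} → 0# ≼ x → 0# ≼ y → 0# ≼ x · y
*-mono-0≼ {x} {y} 0≼x 0≼y = ≼-trans (0≼∣x∣·∣y∣ x y)
  (≃⇒≼ (≃-sym (*-cong (0≼⇒≃∣∣ 0≼x) (0≼⇒≃∣∣ 0≼y))))

open ℝ-Solver
  renaming (solve to ring; _:=_ to _⊜_; _:+_ to _⊕_; _:*_ to _⊗_; _:-_ to _⊖_; :-_ to ⊝_; con to κ)
  using ()

+-mono-0≼ : ∀ {x y} → 0# ≼ x → 0# ≼ y → 0# ≼ x +ᵣ y
+-mono-0≼ a b = ≼-trans (≃⇒≼ (≃-sym (+ᵣ-identityˡ 0#))) (+-mono-≼ a b)

≼⇒0≼- : ∀ {x y} → x ≼ y → 0# ≼ y -ᵣ x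
≼⇒0≼- {x} {y} h = ≼-trans (≃⇒≼ (ring 1 (λ x → κ 0ℚ ⊜ x ⊖ x) ≃-refl x)) (+-mono-≼ h ≼-refl)

≼-by : ∀ {x y e} → 0# ≼ e → e ≃ y -ᵣ x → x ≼ y
≼-by {x} {y} {e} 0≼e h = begin
  x             ≈⟨ +ᵣ-identityˡ x ⟨
  0# +ᵣ x       ≤⟨ +-mono-≼ (≼-trans 0≼e (≃⇒≼ h)) ≼-refl ⟩
  y -ᵣ x +ᵣ x   ≈⟨ ring 2 (λ x y → y ⊖ x ⊕ x ⊜ y) ≃-refl x y ⟩
  y             ∎
  where open ≼-Reasoning

*-monoʳ-≼ : ∀ {x y z} → 0# ≼ z → x ≼ y → z · x ≼ z · y
*-monoʳ-≼ {x} {y} {z} 0≼z x≼y = ≼-by (*-mono-0≼ 0≼z (≼⇒0≼- x≼y))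
  (ring 3 (λ x y z → z ⊗ (y ⊖ x) ⊜ z ⊗ y ⊖ z ⊗ x) ≃-refl x y z)

*-monoˡ-≼ : ∀ {x y z} → 0# ≼ z → x ≼ y → x · z ≼ y · z
*-monoˡ-≼ {x} {y} {z} 0≼z x≼y = ≼-by (*-mono-0≼ 0≼z (≼⇒0≼- x≼y))
  (ring 3 (λ x y z → z ⊗ (y ⊖ x) ⊜ y ⊗ z ⊖ x ⊗ z) ≃-refl x y z)

*-mono-≼ : ∀ {x y z w} → 0# ≼ z → 0# ≼ y → x ≼ y → z ≼ w → x · z ≼ y · w
*-mono-≼ 0≼z 0≼y x≼y z≼w = ≼-trans (*-monoˡ-≼ 0≼z x≼y) (*-monoʳ-≼ 0≼y z≼w)

≺⇒≼ : ∀ {x y} → x ≺ y → x ≼ y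
≺⇒≼ {x} {y} ⟪ ε , 0<ε , h ⟫ = ≼-intro λ η 0<η → Ev-map
  (λ n a → <⇒≤ (<-trans (<-trans (p<p+ε (seq x n) 0<ε) a) (p<p+ε (seq y n) 0<η))) h

≺-≼-trans : ∀ {x y z} → x ≺ y → y ≼ z → x ≺ z
≺-≼-trans {x} {y} {z} ⟪ ε , 0<ε , g ⟫ ⟪ h ⟫ = ⟪ ½ * ε , 0<½* 0<ε , Ev-zip
  (λ n a b → subst₂ _<_
    (trans (cong (λ t → seq x n + t - ½ * ε) (sym (½+½ ε)))
      (solve 2 (λ x e → x :+ (e :+ e) :- e := x :+ e) refl (seq x n) (½ * ε)))
    (solve 2 (λ z e → z :+ e :- e := z) refl (seq z n) (½ * ε))
    (+-monoˡ-< (- (½ * ε)) (<-trans a b)))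
  g (h (½ * ε) (0<½* 0<ε)) ⟫

≼-≺-trans : ∀ {x y z} → x ≼ y → y ≺ z → x ≺ z
≼-≺-trans {x} {y} {z} ⟪ g ⟫ ⟪ ε , 0<ε , h ⟫ = ⟪ ½ * ε , 0<½* 0<ε , Ev-zip
  (λ n a b → <-trans (+-monoˡ-< (½ * ε) a) (subst (_< seq z n)
    (trans (cong (λ t → seq y n + t) (sym (½+½ ε))) (sym (+-assoc (seq y n) (½ * ε) (½ * ε)))) b))
  (g (½ * ε) (0<½* 0<ε)) h ⟫

gap⇒≺ : ∀ {x y ε} → 0ℚ < ε → x +ᵣ 𝕢 ε ≼ y → x ≺ y
gap⇒≺ 0<ε h = ≺-≼-trans (x≺x+ε 0<ε) h

0≺𝕢 : ∀ {q} → 0ℚ < q → 0# ≺ 𝕢 q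
0≺𝕢 {q} 0<q = gap⇒≺ 0<q (≃⇒≼ (+ᵣ-identityˡ (𝕢 q)))

-- Beyond the moduli for ε/4 neither sequence moves by as much as ε/4, so a gap of ε at one index
-- persists at all later ones. Thus a single comparison of rationals, which is decidable, yields a
-- strict inequality of reals; `⊀⇒≽` and `≺⊔⇒` rest on this.
≺-at : ∀ x y {ε} → 0ℚ < ε → ∃ λ L → ∀ n → L ℕ.≤ n → seq x n + ε < seq y n → x ≺ y
≺-at x y {ε} 0<ε =
  let ε/4 = ½ * (½ * ε)
      0<ε/4 = 0<½* (0<½* 0<ε)
      M , f = cauchy x ε/4 0<ε/4
      N , g = cauchy y ε/4 0<ε/4
      L = M ℕ.⊔ N
  in L , λ n L≤n x+ε<y → ⟪ ε/4 , 0<ε/4 , L , (λ m L≤m →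
       let a = f m n (ℕₚ.m⊔n≤o⇒m≤o M N L≤m) (ℕₚ.m⊔n≤o⇒m≤o M N L≤n)
           b = g n m (ℕₚ.m⊔n≤o⇒n≤o M N L≤n) (ℕₚ.m⊔n≤o⇒n≤o M N L≤m)
           open ≤-Reasoning
       in begin-strict
         seq x m + ε/4               <⟨ +-monoˡ-< ε/4 (∣p-q∣<⇒ {seq x m} a) ⟩
         seq x n + ε/4 + ε/4         ≡⟨ solve 2 (λ x e → let q = con ½ :* (con ½ :* e) in x :+ q :+ q := x :+ e :- (q :+ q)) refl (seq x n) ε ⟩
         seq x n + ε - (ε/4 + ε/4)   <⟨ +-monoˡ-< (- (ε/4 + ε/4)) x+ε<y ⟩
         seq y n - (ε/4 + ε/4)       <⟨ +-monoˡ-< (- (ε/4 + ε/4)) (∣p-q∣<⇒ {seq y n} b) ⟩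
         seq y m + ε/4 - (ε/4 + ε/4) ≡⟨ solve 2 (λ y q → y :+ q :- (q :+ q) := y :- q) refl (seq y m) ε/4 ⟩
         seq y m - ε/4               <⟨ +-monoʳ-< (seq y m) (neg-antimono-< 0<ε/4) ⟩
         seq y m + 0ℚ                ≡⟨ +-identityʳ (seq y m) ⟩
         seq y m                     ∎) ⟫

⊀⇒≽ : ∀ {x y} → ¬ (x ≺ y) → y ≼ x
⊀⇒≽ {x} {y} x⊀y = ≼-intro λ ε 0<ε → let L , f = ≺-at x y 0<ε in
  L , λ n L≤n → ≮⇒≥ λ x+ε<y → x⊀y (f n L≤n x+ε<y)

opaque
  unfolding _·_ 𝕢

  0≺⇒ : ∀ {x} → 0# ≺ x → 0ᵣ <ᵣ x
  0≺⇒ ⟪ h ⟫ = h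

  0≼recip : ∀ x p → 0# ≼ recip x p
  0≼recip x (ε , 0<ε , N , h) = ≼-pointwise λ n → let pos = positive (<-≤-trans 0<ε (p≤p⊔q ε (seq x n))) in
    <⇒≤ (positive⁻¹ _ {{1/pos⇒pos (ε ⊔ seq x n) {{pos}}}})

  recip-inverse : ∀ x p → recip x p · x ≃ 1#
  recip-inverse x (ε , 0<ε , N , h) = ⟪ (λ η 0<η → N , λ n N≤n → subst (_< η)
    (sym (cong ∣_∣ (trans (cong (_- 1ℚ) (inv n N≤n)) (+-inverseʳ 1ℚ)))) 0<η) ⟫
    where
    inv : ∀ n → N ℕ.≤ n → seq (recip x (ε , 0<ε , N , h)) n * seq x n ≡ 1ℚ
    inv n N≤n = trans (cong (seq (recip x (ε , 0<ε , N , h)) n *_)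
      (sym (p≤q⇒p⊔q≡q (<⇒≤ (subst (_< seq x n) (+-identityˡ ε) (h n N≤n))))))
      (*-inverseˡ (ε ⊔ seq x n) {{pos⇒nonZero (ε ⊔ seq x n) {{positive (<-≤-trans 0<ε (p≤p⊔q ε (seq x n)))}}}})

*-cancelˡ-≼ : ∀ {x y z} → 0# ≺ z → z · x ≼ z · y → x ≼ y
*-cancelˡ-≼ {x} {y} {z} 0≺z h = begin
  x                ≈⟨ undo x ⟩
  r · (z · x)      ≤⟨ *-monoʳ-≼ (0≼recip z (0≺⇒ 0≺z)) h ⟩
  r · (z · y)      ≈⟨ undo y ⟨
  y                ∎
  where
  open ≼-Reasoning
  r = recip z (0≺⇒ 0≺z)
  undo : ∀ x → x ≃ r · (z · x)
  undo x = ≃-trans (≃-sym (·-identityˡ x)) (≃-trans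
    (*-cong (≃-sym (recip-inverse z (0≺⇒ 0≺z))) ≃-refl) (·-assoc r z x))

*-cancelˡ-≃ : ∀ {x y z} → 0# ≺ z → z · x ≃ z · y → x ≃ y
*-cancelˡ-≃ 0≺z h = ≼-antisym (*-cancelˡ-≼ 0≺z (≃⇒≼ h)) (*-cancelˡ-≼ 0≺z (≃⇒≼ (≃-sym h)))

*-mono-0≺ : ∀ {x y} → 0# ≺ x → 0# ≺ y → 0# ≺ x · y
*-mono-0≺ {x} {y} 0≺x 0≺y =
  let ε , 0<ε , f = ≺⇒gap 0≺x
      δ , 0<δ , g = ≺⇒gap 0≺y
      instance
        pε = positive 0<ε
        pδ = positive 0<δ
      ε≼x = ≼-trans (≃⇒≼ (≃-sym (+ᵣ-identityˡ (𝕢 ε)))) f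
      δ≼y = ≼-trans (≃⇒≼ (≃-sym (+ᵣ-identityˡ (𝕢 δ)))) g
  in ≺-≼-trans (0≺𝕢 (positive⁻¹ (ε * δ) {{pos*pos⇒pos ε δ}}))
       (≼-trans (≃⇒≼ (𝕢-· ε δ)) (*-mono-≼ (𝕢-mono (<⇒≤ 0<δ)) (≺⇒≼ 0≺x) ε≼x δ≼y))

0≺-⇒≺ : ∀ {x y} → 0# ≺ y -ᵣ x → x ≺ y
0≺-⇒≺ {x} {y} h = let ε , 0<ε , f = ≺⇒gap h in gap⇒≺ 0<ε (begin
  x +ᵣ 𝕢 ε             ≈⟨ +-cong (≃-refl {x}) (+ᵣ-identityˡ (𝕢 ε)) ⟨
  x +ᵣ (0# +ᵣ 𝕢 ε)     ≤⟨ +-mono-≼ ≼-refl f ⟩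
  x +ᵣ (y -ᵣ x)        ≈⟨ ring 2 (λ x y → x ⊕ (y ⊖ x) ⊜ y) ≃-refl x y ⟩
  y                    ∎)
  where open ≼-Reasoning

-- Cauchy products of the sine and cosine series

¼ : ℚ
¼ = ½ * ½

∑<-cong : ∀ n {f g} → (∀ k → f k ≡ g k) → ∑< n f ≡ ∑< n g
∑<-cong zero    h = refl
∑<-cong (suc n) h = cong₂ _+_ (∑<-cong n h) (h n)

∑<-suc : ∀ n f → ∑< (suc n) f ≡ f 0 + ∑< n (f ∘ suc)
∑<-suc zero    f = +-comm 0ℚ (f 0)
∑<-suc (suc n) f = trans (cong (_+ f (suc n)) (∑<-suc n f)) (+-assoc (f 0) _ (f (suc n)))

∑<-+ : ∀ n f g → ∑< n (λ k → f k + g k) ≡ ∑< n f + ∑< n g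
∑<-+ zero    f g = refl
∑<-+ (suc n) f g = trans (cong (_+ (f n + g n)) (∑<-+ n f g))
  (solve 4 (λ a b c d → a :+ b :+ (c :+ d) := a :+ c :+ (b :+ d)) refl (∑< n f) (∑< n g) (f n) (g n))

∑<-* : ∀ n t f → ∑< n (λ k → t * f k) ≡ t * ∑< n f
∑<-* zero    t f = sym (*-zeroʳ t)
∑<-* (suc n) t f = trans (cong (_+ t * f n) (∑<-* n t f)) (sym (*-distribˡ-+ t (∑< n f) (f n)))

∑<-neg : ∀ n f → ∑< n (λ k → - f k) ≡ - ∑< n f
∑<-neg zero    f = refl
∑<-neg (suc n) f = trans (cong (_- f n) (∑<-neg n f)) (sym (neg-distrib-+ (∑< n f) (f n)))

conv : (ℕ → ℚ) → (ℕ → ℚ) → ℕ → ℚ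
conv a b zero    = a 0 * b 0
conv a b (suc n) = a 0 * b (suc n) + conv (a ∘ suc) b n

conv-cong : ∀ {a a′ b b′} → (∀ k → a k ≡ a′ k) → (∀ k → b k ≡ b′ k) → ∀ n → conv a b n ≡ conv a′ b′ n
conv-cong f g zero    = cong₂ _*_ (f 0) (g 0)
conv-cong f g (suc n) = cong₂ _+_ (cong₂ _*_ (f 0) (g (suc n))) (conv-cong (f ∘ suc) g n)

conv-+ˡ : ∀ a a′ b n → conv (λ k → a k + a′ k) b n ≡ conv a b n + conv a′ b n
conv-+ˡ a a′ b zero    = *-distribʳ-+ (b 0) (a 0) (a′ 0)
conv-+ˡ a a′ b (suc n) = trans (cong (λ z → (a 0 + a′ 0) * b (suc n) + z) (conv-+ˡ (a ∘ suc) (a′ ∘ suc) b n))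
  (solve 5 (λ a a′ b c c′ → (a :+ a′) :* b :+ (c :+ c′) := (a :* b :+ c) :+ (a′ :* b :+ c′)) refl
    (a 0) (a′ 0) (b (suc n)) (conv (a ∘ suc) b n) (conv (a′ ∘ suc) b n))

conv-*ˡ : ∀ t a b n → conv (λ k → t * a k) b n ≡ t * conv a b n
conv-*ˡ t a b zero    = *-assoc t (a 0) (b 0)
conv-*ˡ t a b (suc n) = trans (cong (λ z → t * a 0 * b (suc n) + z) (conv-*ˡ t (a ∘ suc) b n))
  (solve 4 (λ t a b c → t :* a :* b :+ t :* c := t :* (a :* b :+ c)) refl
    t (a 0) (b (suc n)) (conv (a ∘ suc) b n))

conv-*ʳ : ∀ t a b n → conv a (λ k → t * b k) n ≡ t * conv a b n
conv-*ʳ t a b zero    = solve 3 (λ t a b → a :* (t :* b) := t :* (a :* b)) refl t (a 0) (b 0)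
conv-*ʳ t a b (suc n) = trans (cong (λ z → a 0 * (t * b (suc n)) + z) (conv-*ʳ t (a ∘ suc) b n))
  (solve 4 (λ t a b c → a :* (t :* b) :+ t :* c := t :* (a :* b :+ c)) refl
    t (a 0) (b (suc n)) (conv (a ∘ suc) b n))

-- With D the formal derivative, the addition formulas below express that the
-- system s′ = (x + y) c, c′ = − (x + y) s has a unique solution.
D : (ℕ → ℚ) → ℕ → ℚ
D a k = ι (suc k) * a (suc k)

D-suc : ∀ a k → D a (suc k) ≡ D (a ∘ suc) k + a (suc (suc k))
D-suc a k = trans (cong (_* a (suc (suc k))) (ι-homo-+1 (suc k)))
  (solve 2 (λ i a → (i :+ con 1ℚ) :* a := i :* a :+ a) refl (ι (suc k)) (a (suc (suc k))))

-- Induction by splitting off the term with `a 0`. `D` does not commute with the shift: by `D-suc`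
-- the doubly shifted sequence is left over. It is supplied by the extra copy of `p` that appears
-- when the factor n + 2 is written as (n + 1) + 1.
leibniz : ∀ a b n → D (conv a b) n ≡ conv (D a) b n + conv a (D b) n
leibniz a b zero = solve 4 (λ a₀ a₁ b₀ b₁ →
  con (ι 1) :* (a₀ :* b₁ :+ a₁ :* b₀) := con (ι 1) :* a₁ :* b₀ :+ a₀ :* (con (ι 1) :* b₁)) refl (a 0) (a 1) (b 0) (b 1)
leibniz a b (suc n) = begin
  i * (a₀ * b₂ + p)
    ≡⟨ cong (λ i → i * (a₀ * b₂ + p)) (ι-homo-+1 (suc n)) ⟩
  (j + 1ℚ) * (a₀ * b₂ + p)
    ≡⟨ solve 4 (λ j a b p → (j :+ con 1ℚ) :* (a :* b :+ p) := (j :+ con 1ℚ) :* (a :* b) :+ (p :+ j :* p)) refl j a₀ b₂ p ⟩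
  (j + 1ℚ) * (a₀ * b₂) + (p + j * p)
    ≡⟨ cong (λ z → (j + 1ℚ) * (a₀ * b₂) + (p + z)) (leibniz (a ∘ suc) b n) ⟩
  (j + 1ℚ) * (a₀ * b₂) + ((a 1 * b (suc n) + q) + (r + s))
    ≡⟨ solve 8 (λ j a₀ b₂ a₁ b₁ q r s → (j :+ con 1ℚ) :* (a₀ :* b₂) :+ ((a₁ :* b₁ :+ q) :+ (r :+ s))
         := (con (ι 1) :* a₁ :* b₁ :+ (r :+ q)) :+ (a₀ :* ((j :+ con 1ℚ) :* b₂) :+ s)) refl
         j a₀ b₂ (a 1) (b (suc n)) q r s ⟩
  (ι 1 * a 1 * b (suc n) + (r + q)) + (a₀ * ((j + 1ℚ) * b₂) + s)
    ≡⟨ cong₂ (λ t i → (ι 1 * a 1 * b (suc n) + t) + (a₀ * (i * b₂) + s))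
         (trans (sym (conv-+ˡ (D (a ∘ suc)) (a ∘ suc ∘ suc) b n)) (conv-cong (λ k → sym (D-suc a k)) (λ _ → refl) n))
         (sym (ι-homo-+1 (suc n))) ⟩
  conv (D a) b (suc n) + conv a (D b) (suc n) ∎
  where
  open ≡-Reasoning
  i = ι (suc (suc n))
  j = ι (suc n)
  a₀ = a 0
  b₂ = b (suc (suc n))
  p = conv (a ∘ suc) b (suc n)
  q = conv (a ∘ suc ∘ suc) b n
  r = conv (D (a ∘ suc)) b n
  s = conv (a ∘ suc) (D b) n

-- The coefficients of sin (x T) and cos (x T) as power series in T.
mutual
  sinC : ℚ → ℕ → ℚ
  sinC x zero    = 0ℚ
  sinC x (suc k) = x * cosC x k * (+ 1 / suc k)

  cosC : ℚ → ℕ → ℚ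
  cosC x zero    = 1ℚ
  cosC x (suc k) = - (x * sinC x k) * (+ 1 / suc k)

ι*[p*1/n] : ∀ k p → ι (suc k) * (p * (+ 1 / suc k)) ≡ p
ι*[p*1/n] k p = trans (solve 3 (λ i p r → i :* (p :* r) := p :* (r :* i)) refl (ι (suc k)) p (+ 1 / suc k))
  (trans (cong (p *_) (1/n*n≡1 (suc k))) (*-identityʳ p))

D-sinC : ∀ x k → D (sinC x) k ≡ x * cosC x k
D-sinC x k = ι*[p*1/n] k (x * cosC x k)

D-cosC : ∀ x k → D (cosC x) k ≡ - x * sinC x k
D-cosC x k = trans (ι*[p*1/n] k (- (x * sinC x k))) (neg-distribˡ-* x (sinC x k))

ι-cancel : ∀ k {p q} → ι (suc k) * p ≡ ι (suc k) * q → p ≡ q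
ι-cancel k {p} {q} h = trans (sym (inv p)) (trans (cong ((+ 1 / suc k) *_) h) (inv q))
  where
  inv : ∀ p → (+ 1 / suc k) * (ι (suc k) * p) ≡ p
  inv p = trans (sym (*-assoc (+ 1 / suc k) (ι (suc k)) p))
    (trans (cong (_* p) (1/n*n≡1 (suc k))) (*-identityˡ p))

module _ (x y : ℚ) where
  sinC-+′ cosC-+′ : ℕ → ℚ
  sinC-+′ n = conv (sinC x) (cosC y) n + conv (cosC x) (sinC y) n
  cosC-+′ n = conv (cosC x) (cosC y) n - conv (sinC x) (sinC y) n

  D-sinC-+′ : ∀ n → D sinC-+′ n ≡ (x + y) * cosC-+′ n
  D-sinC-+′ n = begin
    ι (suc n) * (conv (sinC x) (cosC y) (suc n) + conv (cosC x) (sinC y) (suc n))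
      ≡⟨ *-distribˡ-+ (ι (suc n)) (conv (sinC x) (cosC y) (suc n)) (conv (cosC x) (sinC y) (suc n)) ⟩
    D (conv (sinC x) (cosC y)) n + D (conv (cosC x) (sinC y)) n
      ≡⟨ cong₂ _+_ (leibniz (sinC x) (cosC y) n) (leibniz (cosC x) (sinC y) n) ⟩
    (conv (D (sinC x)) (cosC y) n + conv (sinC x) (D (cosC y)) n) +
    (conv (D (cosC x)) (sinC y) n + conv (cosC x) (D (sinC y)) n)
      ≡⟨ cong₂ _+_
        (cong₂ _+_ (trans (conv-cong (D-sinC x) (λ _ → refl) n) (conv-*ˡ x (cosC x) (cosC y) n))
                   (trans (conv-cong (λ _ → refl) (D-cosC y) n) (conv-*ʳ (- y) (sinC x) (sinC y) n)))
        (cong₂ _+_ (trans (conv-cong (D-cosC x) (λ _ → refl) n) (conv-*ˡ (- x) (sinC x) (sinC y) n))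
                   (trans (conv-cong (λ _ → refl) (D-sinC y) n) (conv-*ʳ y (cosC x) (cosC y) n))) ⟩
    (x * cc + - y * ss) + (- x * ss + y * cc)
      ≡⟨ solve 4 (λ x y c s → (x :* c :+ :- y :* s) :+ (:- x :* s :+ y :* c) := (x :+ y) :* (c :- s)) refl x y cc ss ⟩
    (x + y) * cosC-+′ n ∎
    where
    open ≡-Reasoning
    cc = conv (cosC x) (cosC y) n
    ss = conv (sinC x) (sinC y) n

  D-cosC-+′ : ∀ n → D cosC-+′ n ≡ - (x + y) * sinC-+′ n
  D-cosC-+′ n = begin
    ι (suc n) * (conv (cosC x) (cosC y) (suc n) - conv (sinC x) (sinC y) (suc n))
      ≡⟨ solve 3 (λ i p q → i :* (p :- q) := i :* p :- i :* q) refl (ι (suc n))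
           (conv (cosC x) (cosC y) (suc n)) (conv (sinC x) (sinC y) (suc n)) ⟩
    D (conv (cosC x) (cosC y)) n - D (conv (sinC x) (sinC y)) n
      ≡⟨ cong₂ _-_ (leibniz (cosC x) (cosC y) n) (leibniz (sinC x) (sinC y) n) ⟩
    (conv (D (cosC x)) (cosC y) n + conv (cosC x) (D (cosC y)) n) -
    (conv (D (sinC x)) (sinC y) n + conv (sinC x) (D (sinC y)) n)
      ≡⟨ cong₂ _-_
        (cong₂ _+_ (trans (conv-cong (D-cosC x) (λ _ → refl) n) (conv-*ˡ (- x) (sinC x) (cosC y) n))
                   (trans (conv-cong (λ _ → refl) (D-cosC y) n) (conv-*ʳ (- y) (cosC x) (sinC y) n)))
        (cong₂ _+_ (trans (conv-cong (D-sinC x) (λ _ → refl) n) (conv-*ˡ x (cosC x) (sinC y) n))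
                   (trans (conv-cong (λ _ → refl) (D-sinC y) n) (conv-*ʳ y (sinC x) (cosC y) n))) ⟩
    (- x * sc + - y * cs) - (x * cs + y * sc)
      ≡⟨ solve 4 (λ x y p q → (:- x :* p :+ :- y :* q) :- (x :* q :+ y :* p) := :- (x :+ y) :* (p :+ q)) refl x y sc cs ⟩
    - (x + y) * sinC-+′ n ∎
    where
    open ≡-Reasoning
    sc = conv (sinC x) (cosC y) n
    cs = conv (cosC x) (sinC y) n

  sincosC-+ : ∀ n → sinC (x + y) n ≡ sinC-+′ n × cosC (x + y) n ≡ cosC-+′ n
  sincosC-+ zero    = refl , refl
  sincosC-+ (suc n) = let p , q = sincosC-+ n in
    ι-cancel n (trans (D-sinC (x + y) n) (trans (cong ((x + y) *_) q) (sym (D-sinC-+′ n)))) ,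
    ι-cancel n (trans (D-cosC (x + y) n) (trans (cong (- (x + y) *_) p) (sym (D-cosC-+′ n))))

sincosC-neg : ∀ x n → sinC (- x) n ≡ - sinC x n × cosC (- x) n ≡ cosC x n
sincosC-neg x zero    = refl , refl
sincosC-neg x (suc n) = let p , q = sincosC-neg x n in
  trans (cong (λ t → - x * t * (+ 1 / suc n)) q)
    (solve 3 (λ x c r → :- x :* c :* r := :- (x :* c :* r)) refl x (cosC x n) (+ 1 / suc n)) ,
  trans (cong (λ t → - (- x * t) * (+ 1 / suc n)) p)
    (solve 3 (λ x c r → :- (:- x :* :- c) :* r := :- (x :* c) :* r) refl x (sinC x n) (+ 1 / suc n))

cosC-0 : ∀ n → cosC 0ℚ (suc n) ≡ 0ℚ
cosC-0 n = solve 2 (λ s r → :- (con 0ℚ :* s) :* r := con 0ℚ) refl (sinC 0ℚ n) (+ 1 / suc n)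

-- Geometric majorants and the truncation error of Cauchy products

^-mono-0≤ : ∀ {p} → 0ℚ ≤ p → ∀ n → 0ℚ ≤ p ^ℚ n
^-mono-0≤ 0≤p zero    = nonNegative⁻¹ 1ℚ
^-mono-0≤ 0≤p (suc n) = *-mono-0≤ 0≤p (^-mono-0≤ 0≤p n)

¼^n≤½^n : ∀ n → ¼ ^ℚ n ≤ ½ ^ℚ n
¼^n≤½^n zero    = ≤-refl
¼^n≤½^n (suc n) = *-mono-≤′ {¼} {½} (^-mono-0≤ (nonNegative⁻¹ ¼) n) (nonNegative⁻¹ ½) (≤ᵇ⇒≤ _) (¼^n≤½^n n)

Geometric : ℚ → (ℕ → ℚ) → Set
Geometric K a = ∀ k → ∣ a k ∣ ≤ K * ¼ ^ℚ k

geometric⇒0≤ : ∀ {K a} → Geometric K a → 0ℚ ≤ K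
geometric⇒0≤ {K} {a} h = subst (0ℚ ≤_) (*-identityʳ K) (≤-trans (0≤∣p∣ (a 0)) (h 0))

geometric-suc : ∀ {K a} → Geometric K a → Geometric (¼ * K) (a ∘ suc)
geometric-suc {K} {a} h k = subst (_ ≤_) (solve 3 (λ q K p → K :* (q :* p) := q :* K :* p) refl ¼ K (¼ ^ℚ k)) (h (suc k))

geometric-∑ : ∀ {K a} → Geometric K a → ∀ n → ∣ ∑< n a ∣ ≤ K * (ι 2 - ι 2 * ½ ^ℚ n)
geometric-∑ {K} {a} h zero    = ≤-reflexive (sym (*-zeroʳ K))
geometric-∑ {K} {a} h (suc n) = ≤-trans
  (∣p+q∣≤ {∑< n a} (geometric-∑ {K} {a} h n) (≤-trans (h n) (*-monoʳ-≤′ (geometric⇒0≤ {K} {a} h) (¼^n≤½^n n))))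
  (≤-reflexive (solve 2 (λ K h → K :* (con (ι 2) :- con (ι 2) :* h) :+ K :* h
    := K :* (con (ι 2) :- con (ι 2) :* (con ½ :* h))) refl K (½ ^ℚ n)))

geometric-∑′ : ∀ {K a} → Geometric K a → ∀ n → ∣ ∑< n a ∣ ≤ K * ι 2
geometric-∑′ {K} {a} h n = ≤-trans (geometric-∑ {K} {a} h n) (*-monoʳ-≤′ (geometric⇒0≤ {K} {a} h)
  (subst (ι 2 - ι 2 * ½ ^ℚ n ≤_) (+-identityʳ (ι 2))
    (+-monoʳ-≤ (ι 2) (neg-antimono-≤ (*-mono-0≤ (0≤ι 2) (0≤½^n n))))))

-- Splitting off `a 0` leaves the error for the shifted sequence, whose constant is K/4, and one
-- extra term `A * b n`. Each is at most K L ½ⁿ / 2, which together is exactly 2 K L ½ⁿ⁺¹: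
-- coefficients decaying like 4⁻ⁿ leave room for an error decaying like 2⁻ⁿ.
cauchy-product : ∀ {K L a b} → Geometric K a → Geometric L b → ∀ n →
  ∣ ∑< n a * ∑< n b - ∑< n (conv a b) ∣ ≤ ι 2 * K * L * ½ ^ℚ n
cauchy-product {K} {L} {a} {b} g h zero = *-mono-0≤
  (*-mono-0≤ (*-mono-0≤ (0≤ι 2) (geometric⇒0≤ {K} {a} g)) (geometric⇒0≤ {L} {b} h)) (0≤½^n 0)
cauchy-product {K} {L} {a} {b} g h (suc n) = begin
  ∣ ∑< (suc n) a * B₊ - ∑< (suc n) (conv a b) ∣
    ≡⟨ cong₂ (λ p q → ∣ p * B₊ - q ∣) (∑<-suc n a) sums ⟩
  ∣ (a 0 + A) * B₊ - (a 0 * B₊ + S) ∣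
    ≡⟨ cong ∣_∣ (solve 5 (λ a₀ A B b S → (a₀ :+ A) :* (B :+ b) :- (a₀ :* (B :+ b) :+ S) := (A :* B :- S) :+ A :* b) refl (a 0) A B (b n) S) ⟩
  ∣ (A * B - S) + A * b n ∣
    ≤⟨ ∣p+q∣≤ {A * B - S} (cauchy-product {¼ * K} {L} {a ∘ suc} {b} (geometric-suc {K} {a} g) h n)
         (∣p*q∣≤ {A} (geometric-∑′ {¼ * K} {a ∘ suc} (geometric-suc {K} {a} g) n)
           (≤-trans (h n) (*-monoʳ-≤′ (geometric⇒0≤ {L} {b} h) (¼^n≤½^n n)))) ⟩
  ι 2 * (¼ * K) * L * ½ ^ℚ n + ¼ * K * ι 2 * (L * ½ ^ℚ n)
    ≡⟨ solve 3 (λ K L h → con (ι 2) :* (con ¼ :* K) :* L :* h :+ con ¼ :* K :* con (ι 2) :* (L :* h)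
         := con (ι 2) :* K :* L :* (con ½ :* h)) refl K L (½ ^ℚ n) ⟩
  ι 2 * K * L * ½ ^ℚ suc n ∎
  where
  open ≤-Reasoning
  A = ∑< n (a ∘ suc)
  B = ∑< n b
  B₊ = ∑< (suc n) b
  S = ∑< n (conv (a ∘ suc) b)
  sums : ∑< (suc n) (conv a b) ≡ a 0 * B₊ + S
  sums = trans (∑<-suc n (conv a b))
    (trans (cong (λ z → a 0 * b 0 + z) (∑<-+ n (λ k → a 0 * b (suc k)) (conv (a ∘ suc) b)))
    (trans (sym (+-assoc (a 0 * b 0) _ S))
    (cong (_+ S) (trans (cong (λ z → a 0 * b 0 + z) (∑<-* n (a 0) (b ∘ suc)))
      (trans (sym (*-distribˡ-+ (a 0) (b 0) _)) (cong (a 0 *_) (sym (∑<-suc n b))))))))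

module _ (b : ℕ) where
  private
    B = ι b

  ∣p*1/n∣*ι[n!]≤ : ∀ n {x s} → ∣ x ∣ ≤ B → ∣ s ∣ * ι (n !) ≤ B ^ℚ n →
    ∣ x * s * (+ 1 / suc n) ∣ * ι (suc n !) ≤ B ^ℚ suc n
  ∣p*1/n∣*ι[n!]≤ n {x} {s} x≤B h = begin
    ∣ x * s * r ∣ * ι (suc n !)
      ≡⟨ cong₂ _*_ (trans (∣p*q∣≡∣p∣*∣q∣ (x * s) r) (cong₂ _*_ (∣p*q∣≡∣p∣*∣q∣ x s) (0≤p⇒∣p∣≡p (0≤1/n (suc n))))) (ι-homo-* (suc n) (n !)) ⟩
    ∣ x ∣ * ∣ s ∣ * r * (ι (suc n) * ι (n !))
      ≡⟨ solve 5 (λ x s r i f → x :* s :* r :* (i :* f) := x :* (s :* f) :* (r :* i)) refl (∣ x ∣) (∣ s ∣) r (ι (suc n)) (ι (n !)) ⟩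
    ∣ x ∣ * (∣ s ∣ * ι (n !)) * (r * ι (suc n))
      ≡⟨ trans (cong (∣ x ∣ * (∣ s ∣ * ι (n !)) *_) (1/n*n≡1 (suc n))) (*-identityʳ _) ⟩
    ∣ x ∣ * (∣ s ∣ * ι (n !))
      ≤⟨ *-mono-≤′ (*-mono-0≤ (0≤∣p∣ s) (0≤ι (n !))) (0≤ι b) x≤B h ⟩
    B ^ℚ suc n ∎
    where
    open ≤-Reasoning
    r = + 1 / suc n

  ∣sincosC∣*ι[n!]≤ : ∀ {x} → ∣ x ∣ ≤ B → ∀ n →
    ∣ sinC x n ∣ * ι (n !) ≤ B ^ℚ n × ∣ cosC x n ∣ * ι (n !) ≤ B ^ℚ n
  ∣sincosC∣*ι[n!]≤ x≤B zero = ≤ᵇ⇒≤ _ , ≤-refl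
  ∣sincosC∣*ι[n!]≤ {x} x≤B (suc n) = let p , q = ∣sincosC∣*ι[n!]≤ x≤B n in
    ∣p*1/n∣*ι[n!]≤ n {x} {cosC x n} x≤B q ,
    subst (λ t → t * ι (suc n !) ≤ B ^ℚ suc n)
      (trans (sym (∣-p∣≡∣p∣ (x * sinC x n * (+ 1 / suc n)))) (cong ∣_∣ (neg-distribˡ-* (x * sinC x n) (+ 1 / suc n))))
      (∣p*1/n∣*ι[n!]≤ n {x} {sinC x n} x≤B p)

  private
    c = 4 ℕ.* b

  G : ℚ
  G = ι (suc c ℕ.^ suc c)

  -- `c^k≤M*k!` for the base 4b bounds (4b)ⁿ by G n!, which trades the factorial for the ratio ¼
  -- that `cauchy-product` asks for. The constant depends on `b` alone.
  decay : ∀ n {s} → ∣ s ∣ * ι (n !) ≤ B ^ℚ n → ∣ s ∣ ≤ G * ¼ ^ℚ n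
  decay n {s} h = *-cancelʳ-≤-pos F {{F-pos}} (begin
    ∣ s ∣ * F              ≤⟨ h ⟩
    B ^ℚ n                  ≡⟨ *-identityˡ (B ^ℚ n) ⟨
    1ℚ * B ^ℚ n             ≡⟨ cong (_* B ^ℚ n) (¼^n*4^n≡1 n) ⟨
    ¼ ^ℚ n * ι 4 ^ℚ n * B ^ℚ n ≡⟨ *-assoc (¼ ^ℚ n) (ι 4 ^ℚ n) (B ^ℚ n) ⟩
    ¼ ^ℚ n * (ι 4 ^ℚ n * B ^ℚ n) ≤⟨ *-monoʳ-≤′ (^-mono-0≤ (nonNegative⁻¹ ¼) n) (subst₂ _≤_ [4b]^n (ι-homo-* (suc c ℕ.^ suc c) (n !))
                                   (ι-mono-≤ (ℕₚ.≤-trans (ℕₚ.^-monoˡ-≤ n (ℕₚ.n≤1+n c)) (c^k≤M*k! c n)))) ⟩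
    ¼ ^ℚ n * (G * F)        ≡⟨ solve 3 (λ q g f → q :* (g :* f) := g :* q :* f) refl (¼ ^ℚ n) G F ⟩
    G * ¼ ^ℚ n * F          ∎)
    where
    open ≤-Reasoning
    F = ι (n !)
    F-pos : Positive F
    F-pos = positive (<-≤-trans (positive⁻¹ 1ℚ) (ι-mono-≤ (ℕₚ.n≢0⇒n>0 (ℕ.≢-nonZero⁻¹ (n !) {{n ℕₚ.!≢0}}))))
    [4b]^n : ι (c ℕ.^ n) ≡ ι 4 ^ℚ n * B ^ℚ n
    [4b]^n = trans (cong ι ([m*n]^k 4 b n)) (trans (ι-homo-* (4 ℕ.^ n) (b ℕ.^ n)) (cong₂ _*_ (ι-homo-^ 4 n) (ι-homo-^ b n)))
    ¼^n*4^n≡1 : ∀ n → ¼ ^ℚ n * ι 4 ^ℚ n ≡ 1ℚ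
    ¼^n*4^n≡1 zero    = refl
    ¼^n*4^n≡1 (suc n) = trans
      (solve 2 (λ h t → (con ¼ :* h) :* (con (ι 4) :* t) := h :* t) refl (¼ ^ℚ n) (ι 4 ^ℚ n)) (¼^n*4^n≡1 n)

  sinC-geometric : ∀ {x} → ∣ x ∣ ≤ B → Geometric G (sinC x)
  sinC-geometric x≤B n = decay n (proj₁ (∣sincosC∣*ι[n!]≤ x≤B n))

  cosC-geometric : ∀ {x} → ∣ x ∣ ≤ B → Geometric G (cosC x)
  cosC-geometric x≤B n = decay n (proj₂ (∣sincosC∣*ι[n!]≤ x≤B n))

-- Unlike `2 ℕ.* suc n`, this reduces to two successors, so sums lose two terms at a time and binary
-- digits can be matched on.
double : ℕ → ℕ
double zero    = zero
double (suc n) = suc (suc (double n))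

double≡2* : ∀ n → double n ≡ 2 ℕ.* n
double≡2* zero    = refl
double≡2* (suc n) = trans (cong (suc ∘ suc) (double≡2* n)) (sym (ℕₚ.*-suc 2 n))

n≤double : ∀ n → n ℕ.≤ double n
n≤double zero    = ℕ.z≤n
n≤double (suc n) = ℕ.s≤s (ℕₚ.m≤n⇒m≤1+n (n≤double n))

sinC-even : ∀ x k → sinC x (double k) ≡ 0ℚ
cosC-odd  : ∀ x k → cosC x (suc (double k)) ≡ 0ℚ
sinC-even x zero    = refl
sinC-even x (suc k) = trans (cong (λ t → x * t * (+ 1 / suc (suc (double k)))) (cosC-odd x k))
  (solve 2 (λ x r → x :* con 0ℚ :* r := con 0ℚ) refl x (+ 1 / suc (suc (double k))))
cosC-odd x k = trans (cong (λ t → - (x * t) * (+ 1 / suc (double k))) (sinC-even x k))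
  (solve 2 (λ x r → :- (x :* con 0ℚ) :* r := con 0ℚ) refl x (+ 1 / suc (double k)))

inverse-unique : ∀ n .{{_ : ℕ.NonZero n}} {p} → p * ι n ≡ 1ℚ → p ≡ + 1 / n
inverse-unique n {p} h = begin
  p                         ≡⟨ *-identityʳ p ⟨
  p * 1ℚ                    ≡⟨ cong (p *_) (1/n*n≡1 n) ⟨
  p * ((+ 1 / n) * ι n)     ≡⟨ solve 3 (λ p r i → p :* (r :* i) := p :* i :* r) refl p (+ 1 / n) (ι n) ⟩
  p * ι n * (+ 1 / n)       ≡⟨ cong (_* (+ 1 / n)) h ⟩
  1ℚ * (+ 1 / n)            ≡⟨ *-identityˡ (+ 1 / n) ⟩
  + 1 / n                   ∎
  where open ≡-Reasoning

1/n! : ℕ → ℚ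
1/n! n = (+ 1 / (n !)) {{n ℕₚ.!≢0}}

1/[1+n]! : ∀ n → 1/n! (suc n) ≡ 1/n! n * (+ 1 / suc n)
1/[1+n]! n = sym (inverse-unique (suc n !) {{suc n ℕₚ.!≢0}} (trans (cong (1/n! n * (+ 1 / suc n) *_) (ι-homo-* (suc n) (n !)))
  (trans (solve 4 (λ f r i j → f :* r :* (i :* j) := (f :* j) :* (r :* i)) refl (1/n! n) (+ 1 / suc n) (ι (suc n)) (ι (n !)))
    (cong₂ _*_ (1/n*n≡1 (n !) {{n ℕₚ.!≢0}}) (1/n*n≡1 (suc n))))))

-- Two steps of the coefficient recursion multiply by -x² / ((2k + 2)(2k + 3)), which is also the
-- quotient of consecutive terms of the sine series.
sinC-odd : ∀ x k → sinC x (suc (double k)) ≡ sinTerm x k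
sinC-odd x zero = solve 1 (λ x → x :* con 1ℚ :* con 1ℚ := con 1ℚ :* con 1ℚ :* (x :* con 1ℚ)) refl x
sinC-odd x (suc k) = begin
  x * (- (x * sinC x (suc (double k))) * r) * r′
    ≡⟨ cong (λ t → x * (- (x * t) * r) * r′) (sinC-odd x k) ⟩
  x * (- (x * (e * f * p)) * r) * r′
    ≡⟨ solve 6 (λ x e f p r r′ → x :* (:- (x :* (e :* f :* p)) :* r) :* r′
         := (:- con 1ℚ :* e) :* (f :* r :* r′) :* (x :* (x :* p))) refl x e f p r r′ ⟩
  ((- 1ℚ) * e) * (f * r * r′) * (x * (x * p))
    ≡⟨ cong₂ (λ f p → (- 1ℚ) * e * f * p) (sym fact) (cong (x ^ℚ_) (sym (cong suc (ℕₚ.*-suc 2 k)))) ⟩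
  sinTerm x (suc k) ∎
  where
  open ≡-Reasoning
  e = (- 1ℚ) ^ℚ k
  f = 1/n! (suc (2 ℕ.* k))
  p = x ^ℚ suc (2 ℕ.* k)
  r = + 1 / suc (suc (double k))
  r′ = + 1 / suc (suc (suc (double k)))
  fact : 1/n! (suc (2 ℕ.* suc k)) ≡ f * r * r′
  fact = trans (cong (1/n! ∘ suc) (trans (sym (double≡2* (suc k))) refl)) (trans (1/[1+n]! (suc (suc (double k))))
    (cong (_* r′) (trans (1/[1+n]! (suc (double k))) (cong (λ n → 1/n! (suc n) * r) (double≡2* k)))))

∑sinC≡sinSum : ∀ x n → ∑< (double n) (sinC x) ≡ sinSum x n
∑sinC≡sinSum x zero    = refl
∑sinC≡sinSum x (suc n) = cong₂ _+_
  (trans (cong₂ _+_ (∑sinC≡sinSum x n) (sinC-even x n)) (+-identityʳ (sinSum x n))) (sinC-odd x n)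

-- Cut at the same order as `sinSum`, because `cauchy-product` takes two sums of equal length.
cosSum : ℚ → ℕ → ℚ
cosSum x n = ∑< (double n) (cosC x)

½^double≤½^ : ∀ n → ½ ^ℚ double n ≤ ½ ^ℚ n
½^double≤½^ zero    = ≤-refl
½^double≤½^ (suc n) = *-monoʳ-≤′ (nonNegative⁻¹ ½) (≤-trans
  (subst (½ * ½ ^ℚ double n ≤_) (*-identityˡ (½ ^ℚ double n)) (*-monoˡ-≤′ {½} {1ℚ} (0≤½^n (double n)) (≤ᵇ⇒≤ _))) (½^double≤½^ n))

module _ (b : ℕ) where
  -- Each addition formula has two products, and `cauchy-product` charges 2 G² for either.
  K+ : ℚ
  K+ = ι 4 * G b * G b

  0≤K+ : 0ℚ ≤ K+
  0≤K+ = *-mono-0≤ (*-mono-0≤ (0≤ι 4) 0≤G) 0≤G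
    where
    0≤G : 0ℚ ≤ G b
    0≤G = 0≤ι (suc (4 ℕ.* b) ℕ.^ suc (4 ℕ.* b))

  error : ∀ n → ι 2 * G b * G b * ½ ^ℚ double n + ι 2 * G b * G b * ½ ^ℚ double n ≤ K+ * ½ ^ℚ n
  error n = subst (_≤ K+ * ½ ^ℚ n)
    (solve 2 (λ g h → con (ι 4) :* g :* g :* h := con (ι 2) :* g :* g :* h :+ con (ι 2) :* g :* g :* h) refl (G b) (½ ^ℚ double n))
    (*-monoʳ-≤′ 0≤K+ (½^double≤½^ n))

  sinSum-+ : ∀ {x y} → ∣ x ∣ ≤ ι b → ∣ y ∣ ≤ ι b → ∀ n →
    ∣ (sinSum x n * cosSum y n + cosSum x n * sinSum y n) - sinSum (x + y) n ∣ ≤ K+ * ½ ^ℚ n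
  sinSum-+ {x} {y} x≤b y≤b n = begin
    ∣ (sinSum x n * cosSum y n + cosSum x n * sinSum y n) - sinSum (x + y) n ∣
      ≡⟨ cong ∣_∣ (cong₂ _-_ (cong₂ _+_ (cong (_* cosSum y n) (sym (∑sinC≡sinSum x n))) (cong (cosSum x n *_) (sym (∑sinC≡sinSum y n)))) (trans (sym (∑sinC≡sinSum (x + y) n)) (trans (∑<-cong m (proj₁ ∘ sincosC-+ x y)) (∑<-+ m (conv (sinC x) (cosC y)) (conv (cosC x) (sinC y)))))) ⟩
    ∣ (p + q) - (p′ + q′) ∣
      ≡⟨ cong ∣_∣ (solve 4 (λ p q p′ q′ → (p :+ q) :- (p′ :+ q′) := (p :- p′) :+ (q :- q′)) refl p q p′ q′) ⟩
    ∣ (p - p′) + (q - q′) ∣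
      ≤⟨ ∣p+q∣≤ {p - p′} (cauchy-product {G b} {G b} {sinC x} {cosC y} (sinC-geometric b x≤b) (cosC-geometric b y≤b) m)
                (cauchy-product {G b} {G b} {cosC x} {sinC y} (cosC-geometric b x≤b) (sinC-geometric b y≤b) m) ⟩
    _ ≤⟨ error n ⟩
    K+ * ½ ^ℚ n ∎
    where
    open ≤-Reasoning
    m = double n
    p = ∑< m (sinC x) * ∑< m (cosC y)
    q = ∑< m (cosC x) * ∑< m (sinC y)
    p′ = ∑< m (conv (sinC x) (cosC y))
    q′ = ∑< m (conv (cosC x) (sinC y))

  cosSum-+ : ∀ {x y} → ∣ x ∣ ≤ ι b → ∣ y ∣ ≤ ι b → ∀ n →
    ∣ (cosSum x n * cosSum y n - sinSum x n * sinSum y n) - cosSum (x + y) n ∣ ≤ K+ * ½ ^ℚ n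
  cosSum-+ {x} {y} x≤b y≤b n = begin
    ∣ (cosSum x n * cosSum y n - sinSum x n * sinSum y n) - cosSum (x + y) n ∣
      ≡⟨ cong ∣_∣ (cong₂ _-_ (cong (λ t → cosSum x n * cosSum y n - t) (cong₂ _*_ (sym (∑sinC≡sinSum x n)) (sym (∑sinC≡sinSum y n))))
           (trans (∑<-cong m (proj₂ ∘ sincosC-+ x y)) (trans (∑<-+ m (conv (cosC x) (cosC y)) (λ k → - conv (sinC x) (sinC y) k))
             (cong (λ z → p′ + z) (∑<-neg m (conv (sinC x) (sinC y))))))) ⟩
    ∣ (p - q) - (p′ - q′) ∣
      ≡⟨ cong ∣_∣ (solve 4 (λ p q p′ q′ → (p :- q) :- (p′ :- q′) := (p :- p′) :+ :- (q :- q′)) refl p q p′ q′) ⟩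
    ∣ (p - p′) + - (q - q′) ∣
      ≤⟨ ∣p+q∣≤ {p - p′} (cauchy-product {G b} {G b} {cosC x} {cosC y} (cosC-geometric b x≤b) (cosC-geometric b y≤b) m)
                (subst (_≤ _) (sym (∣-p∣≡∣p∣ (q - q′))) (cauchy-product {G b} {G b} {sinC x} {sinC y} (sinC-geometric b x≤b) (sinC-geometric b y≤b) m)) ⟩
    _ ≤⟨ error n ⟩
    K+ * ½ ^ℚ n ∎
    where
    open ≤-Reasoning
    m = double n
    p = ∑< m (cosC x) * ∑< m (cosC y)
    q = ∑< m (sinC x) * ∑< m (sinC y)
    p′ = ∑< m (conv (cosC x) (cosC y))
    q′ = ∑< m (conv (sinC x) (sinC y))

sinSum-neg : ∀ x n → sinSum (- x) n ≡ - sinSum x n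
sinSum-neg x n = trans (sym (∑sinC≡sinSum (- x) n)) (trans (∑<-cong (double n) (proj₁ ∘ sincosC-neg x))
  (trans (∑<-neg (double n) (sinC x)) (cong -_ (∑sinC≡sinSum x n))))

cosSum-neg : ∀ x n → cosSum (- x) n ≡ cosSum x n
cosSum-neg x n = ∑<-cong (double n) (proj₂ ∘ sincosC-neg x)

cosSum-0 : ∀ {n} → 1 ℕ.≤ n → cosSum 0ℚ n ≡ 1ℚ
cosSum-0 {suc n} _ = trans (∑<-suc (suc (double n)) (cosC 0ℚ)) (trans (cong (λ z → 1ℚ + z) (zeros (suc (double n)))) (+-identityʳ 1ℚ))
  where
  zeros : ∀ n → ∑< n (cosC 0ℚ ∘ suc) ≡ 0ℚ
  zeros zero    = refl
  zeros (suc n) = trans (cong₂ _+_ (zeros n) (cosC-0 n)) (+-identityʳ 0ℚ)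

-- Alternating series

alternating : ℕ → (ℕ → ℚ) → ℚ
alternating zero    a = 0ℚ
alternating (suc n) a = a 0 - alternating n (a ∘ suc)

∑-signs≡alternating : ∀ n a → ∑< n (λ k → (- 1ℚ) ^ℚ k * a k) ≡ alternating n a
∑-signs≡alternating zero    a = refl
∑-signs≡alternating (suc n) a = trans (∑<-suc n (λ k → (- 1ℚ) ^ℚ k * a k)) (cong₂ _+_ (*-identityˡ (a 0))
  (trans (∑<-cong n (λ k → solve 2 (λ s a → :- con 1ℚ :* s :* a := :- (s :* a)) refl ((- 1ℚ) ^ℚ k) (a (suc k))))
    (trans (∑<-neg n (λ k → (- 1ℚ) ^ℚ k * a (suc k))) (cong -_ (∑-signs≡alternating n (a ∘ suc))))))

-- The tail lies between 0 and `a 1`, hence between 0 and `a 0`; subtracting it from `a 0` exchanges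
-- the two bounds.
alternating-bounds : ∀ {a} → (∀ k → 0ℚ ≤ a k) → (∀ k → a (suc k) ≤ a k) → ∀ n →
  0ℚ ≤ alternating n a × alternating n a ≤ a 0
alternating-bounds 0≤a anti zero    = ≤-refl , 0≤a 0
alternating-bounds {a} 0≤a anti (suc n) = let p , q = alternating-bounds (0≤a ∘ suc) (anti ∘ suc) n in
  p≤q⇒0≤q-p (≤-trans q (anti 0)) ,
  subst (a 0 - alternating n (a ∘ suc) ≤_) (+-identityʳ (a 0)) (+-monoʳ-≤ (a 0) (neg-antimono-≤ p))

∣sinTerm∣ : ℚ → ℕ → ℚ
∣sinTerm∣ x k = 1/n! (suc (double k)) * x ^ℚ suc (double k)

sinSum≡alternating : ∀ x n → sinSum x n ≡ alternating n (∣sinTerm∣ x)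
sinSum≡alternating x n = trans (∑<-cong n λ k → trans (*-assoc ((- 1ℚ) ^ℚ k) _ _)
  (cong (λ m → (- 1ℚ) ^ℚ k * (1/n! (suc m) * x ^ℚ suc m)) (sym (double≡2* k)))) (∑-signs≡alternating n (∣sinTerm∣ x))

module _ {x} (0≤x : 0ℚ ≤ x) where
  0≤∣sinTerm∣ : ∀ k → 0ℚ ≤ ∣sinTerm∣ x k
  0≤∣sinTerm∣ k = *-mono-0≤ (0≤1/n (suc (double k) !) {{suc (double k) ℕₚ.!≢0}}) (^-mono-0≤ 0≤x (suc (double k)))

  -- The quotient of the two terms is the product of x / (2k + 2) and x / (2k + 3), neither of which
  -- exceeds 1.
  ∣sinTerm∣-anti : ∀ k → x ≤ ι (suc (suc (double k))) → ∣sinTerm∣ x (suc k) ≤ ∣sinTerm∣ x k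
  ∣sinTerm∣-anti k x≤ = begin
    1/n! (suc (suc (suc d))) * (x * (x * p))
      ≡⟨ cong (_* (x * (x * p))) (trans (1/[1+n]! (suc (suc d))) (cong (_* r′) (1/[1+n]! (suc d)))) ⟩
    f * r * r′ * (x * (x * p))
      ≡⟨ solve 5 (λ f r r′ x p → f :* r :* r′ :* (x :* (x :* p)) := (r :* x) :* (r′ :* x) :* (f :* p)) refl f r r′ x p ⟩
    (r * x) * (r′ * x) * (f * p)
      ≤⟨ *-monoˡ-≤′ (0≤∣sinTerm∣ k) (*-mono-≤′ {q = 1ℚ} (*-mono-0≤ (0≤1/n (suc (suc (suc d)))) 0≤x) (nonNegative⁻¹ 1ℚ)
           (ratio (suc d) x≤) (ratio (suc (suc d)) (≤-trans x≤ (ι-mono-≤ (ℕₚ.n≤1+n (suc (suc d))))))) ⟩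
    1ℚ * (f * p)
      ≡⟨ *-identityˡ (f * p) ⟩
    ∣sinTerm∣ x k ∎
    where
    open ≤-Reasoning
    d = double k
    f = 1/n! (suc d)
    p = x ^ℚ suc d
    r = + 1 / suc (suc d)
    r′ = + 1 / suc (suc (suc d))
    ratio : ∀ m → x ≤ ι (suc m) → (+ 1 / suc m) * x ≤ 1ℚ
    ratio m x≤m = subst ((+ 1 / suc m) * x ≤_) (1/n*n≡1 (suc m)) (*-monoʳ-≤′ (0≤1/n (suc m)) x≤m)

  -- The sum is x minus an alternating tail between 0 and its first term x³/6, rounded up to x³
  -- since only the order of the error matters. The empty sum is excluded because 0 can violate the
  -- lower bound.
  sinSum-bounds : x ≤ ι 2 → ∀ n → x - x * x * x ≤ sinSum x (suc n) × sinSum x (suc n) ≤ x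
  sinSum-bounds x≤2 n =
    subst (x - x * x * x ≤_) (sym (sinSum≡alternating x (suc n)))
      (+-mono-≤ (≤-reflexive (sym a₀≡x)) (neg-antimono-≤ (≤-trans (proj₂ (tail n)) a₁≤x³))) ,
    subst₂ _≤_ (sym (sinSum≡alternating x (suc n))) a₀≡x (proj₂ (alternating-bounds 0≤∣sinTerm∣ anti (suc n)))
    where
    anti : ∀ k → ∣sinTerm∣ x (suc k) ≤ ∣sinTerm∣ x k
    anti k = ∣sinTerm∣-anti k (≤-trans x≤2 (ι-mono-≤ (ℕ.s≤s (ℕ.s≤s ℕ.z≤n))))
    tail = alternating-bounds (0≤∣sinTerm∣ ∘ suc) (anti ∘ suc)
    a₀≡x : ∣sinTerm∣ x 0 ≡ x
    a₀≡x = trans (*-identityˡ (x * 1ℚ)) (*-identityʳ x)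
    a₁≤x³ : ∣sinTerm∣ x 1 ≤ x * x * x
    a₁≤x³ = subst (∣sinTerm∣ x 1 ≤_) (solve 1 (λ x → con 1ℚ :* (x :* (x :* (x :* con 1ℚ))) := x :* x :* x) refl x)
      (*-monoˡ-≤′ {1/n! 3} {1ℚ} (^-mono-0≤ 0≤x 3) (≤ᵇ⇒≤ _))

16/5 : ℚ
16/5 = + 16 / 5

-- Cutting the series after a positive term bounds it from above. At 16/5 this bound is still
-- positive after x⁵/5! and is about -0.05 after x⁹/9!; hence four terms are split off and the rest
-- is bounded by the fifth.
sinSum-16/5≤0 : ∀ n → sinSum 16/5 (4 ℕ.+ n) ≤ 0ℚ
sinSum-16/5≤0 n = subst (_≤ 0ℚ) (sym (sinSum≡alternating 16/5 (4 ℕ.+ n))) (≤-trans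
  (+-monoʳ-≤ (a 0) (neg-antimono-≤ (+-monoʳ-≤ (a 1) (neg-antimono-≤ (+-monoʳ-≤ (a 2) (neg-antimono-≤ (+-monoʳ-≤ (a 3)
    (neg-antimono-≤ (proj₂ (alternating-bounds (λ k → 0≤∣sinTerm∣ 0≤16/5 (4 ℕ.+ k)) anti n)))))))))) (≤ᵇ⇒≤ _))
  where
  a = ∣sinTerm∣ 16/5
  0≤16/5 : 0ℚ ≤ 16/5
  0≤16/5 = ≤ᵇ⇒≤ _
  anti : ∀ k → a (5 ℕ.+ k) ≤ a (4 ℕ.+ k)
  anti k = ∣sinTerm∣-anti 0≤16/5 (4 ℕ.+ k) (≤-trans {j = ι 4} (≤ᵇ⇒≤ _) (ι-mono-≤ (ℕ.s≤s (ℕ.s≤s (ℕ.s≤s (ℕ.s≤s ℕ.z≤n))))))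

-- Sine and cosine

½^n-small : ∀ ε → 0ℚ < ε → Eventually λ n → ½ ^ℚ n ≤ ε
½^n-small ε 0<ε = ↧ₙ ε , ½^n≤ 0<ε

common-bound : ∀ x y → ∃ λ b → Eventually λ n → ∣ seq x n ∣ ≤ ι b × ∣ seq y n ∣ ≤ ι b
common-bound x y =
  let a , ha = eventually-bounded x
      b , hb = eventually-bounded y
  in a ℕ.⊔ b , Ev-zip (λ n p q → ≤-trans p (ι-mono-≤ (ℕₚ.m≤m⊔n a b)) , ≤-trans q (ι-mono-≤ (ℕₚ.m≤n⊔m a b))) ha hb

≃-geometric : ∀ {x y} K → 0ℚ ≤ K → (Eventually λ n → ∣ seq x n - seq y n ∣ ≤ K * ½ ^ℚ n) → x ≃ y
≃-geometric K 0≤K h = ≃-scaled K 0≤K λ ε 0<ε →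
  Ev-zip (λ n p q → ≤-trans p (*-monoʳ-≤′ 0≤K q)) h (½^n-small ε 0<ε)

cauchy-resp : ∀ {f g} → (∀ ε → 0ℚ < ε → Eventually λ n → ∣ f n - g n ∣ ≤ ε) → IsCauchy g → IsCauchy f
cauchy-resp {f} {g} h c = cauchy-scaled f (ι 3) (0≤ι 3) λ ε 0<ε →
  let M , p = h ε 0<ε
      N , q = c ε 0<ε
  in M ℕ.⊔ N , λ m n ≤m ≤n → subst₂ _≤_
       (cong ∣_∣ (solve 4 (λ a b c d → (a :- b) :+ (b :- c) :+ (c :- d) := a :- d) refl (f m) (g m) (g n) (f n)))
       (solve 1 (λ e → e :+ e :+ e := con (ι 3) :* e) refl ε)
       (∣p+q∣≤ {f m - g m + (g m - g n)} (∣p+q∣≤ {f m - g m} (p m (ℕₚ.m⊔n≤o⇒m≤o M N ≤m))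
         (<⇒≤ (q m n (ℕₚ.m⊔n≤o⇒n≤o M N ≤m) (ℕₚ.m⊔n≤o⇒n≤o M N ≤n))))
         (subst (_≤ ε) (∣p-q∣≡∣q-p∣ (f n) (g n)) (p n (ℕₚ.m⊔n≤o⇒m≤o M N ≤n))))

-- The addition formula is used twice: at (h, h) for cos x = cos² h - sin² h, and at (h, -h) for
-- cos² h + sin² h = cos 0 = 1. Each use costs one `K+ b`; `1 ≤ n` makes the partial sum of cos 0
-- equal to 1.
cosSum-half : ∀ b {x} → ∣ ½ * x ∣ ≤ ι b → ∀ {n} → 1 ℕ.≤ n →
  ∣ cosSum x (n) - (1ℚ - ι 2 * (sinSum (½ * x) (n) * sinSum (½ * x) (n))) ∣ ≤ (K+ b + K+ b) * ½ ^ℚ n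
cosSum-half b {x} h≤b {n} 1≤n = begin
  ∣ cosSum x m - (1ℚ - ι 2 * (S * S)) ∣
    ≡⟨ cong ∣_∣ (solve 3 (λ c C S → c :- (con 1ℚ :- con (ι 2) :* (S :* S))
         := :- ((C :* C :- S :* S) :- c) :+ ((C :* C :- S :* :- S) :- con 1ℚ)) refl (cosSum x m) C S) ⟩
  ∣ - ((C * C - S * S) - cosSum x m) + ((C * C - S * - S) - 1ℚ) ∣
    ≤⟨ ∣p+q∣≤ { - ((C * C - S * S) - cosSum x m) }
         (subst (_≤ K+ b * ½ ^ℚ m) (trans (cong (λ t → ∣ (C * C - S * S) - cosSum t m ∣) (½+½ x))
           (sym (∣-p∣≡∣p∣ ((C * C - S * S) - cosSum x m)))) (cosSum-+ b h≤b h≤b m))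
         (subst₂ (λ p q → ∣ p - q ∣ ≤ K+ b * ½ ^ℚ m)
           (cong₂ (λ p q → C * p - S * q) (cosSum-neg h m) (sinSum-neg h m))
           (trans (cong (λ t → cosSum t m) (+-inverseʳ h)) (cosSum-0 1≤n))
           (cosSum-+ b h≤b (subst (_≤ ι b) (sym (∣-p∣≡∣p∣ h)) h≤b) m)) ⟩
  K+ b * ½ ^ℚ m + K+ b * ½ ^ℚ m
    ≡⟨ *-distribʳ-+ (½ ^ℚ m) (K+ b) (K+ b) ⟨
  (K+ b + K+ b) * ½ ^ℚ m ∎
  where
  open ≤-Reasoning
  m = n
  h = ½ * x
  S = sinSum h m
  C = cosSum h m

≼-eventually : ∀ {x y} → Eventually (λ n → seq x n ≤ seq y n) → x ≼ y
≼-eventually {x} {y} h = ≼-intro λ ε 0<ε → Ev-map (λ n a → ≤-trans a (<⇒≤ (p<p+ε (seq y n) 0<ε))) h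

opaque
  unfolding _+ᵣ_ -ᵣ_ _·_ absᵣ 𝕢

  sinᵣ : ℝ → ℝ
  sinᵣ = sin

  -- Convergence is inherited from 1 − 2 sin² (x / 2).
  cosᵣ : ℝ → ℝ
  cosᵣ x = mkℝ (λ n → cosSum (seq x n) n) (cauchy-resp {λ n → cosSum (seq x n) n} {seq g} (let b , hb = eventually-bounded (𝕢 ½ · x) in near b hb) (cauchy g))
    where
    g : ℝ
    g = 1# -ᵣ 𝕢 (ι 2) · (sin (𝕢 ½ · x) · sin (𝕢 ½ · x))
    near : ∀ b → Eventually (λ n → ∣ seq (𝕢 ½ · x) n ∣ ≤ ι b) →
      ∀ ε → 0ℚ < ε → Eventually λ n → ∣ cosSum (seq x n) n - seq g n ∣ ≤ ε
    near b hb ε 0<ε =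
      let K = K+ b + K+ b
          0≤K = +-mono-0≤ (0≤K+ b) (0≤K+ b)
          δ , 0<δ , Kδ<ε = shrink K 0≤K 0<ε
          M , f = Ev-zip (λ _ → _,_) hb (½^n-small δ 0<δ)
      in 1 ℕ.⊔ M , λ n le → let p , q = f n (ℕₚ.m⊔n≤o⇒n≤o 1 M le) in
           ≤-trans (cosSum-half b {seq x n} p (ℕₚ.m⊔n≤o⇒m≤o 1 M le)) (≤-trans (*-monoʳ-≤′ 0≤K q) (<⇒≤ Kδ<ε))

  sinᵣ-cong : ∀ {x y} → x ≃ y → sinᵣ x ≃ sinᵣ y
  sinᵣ-cong {x} {y} ⟪ h ⟫ = let b , hb = common-bound x y in within b hb
    where
    within : ∀ b → Eventually (λ n → ∣ seq x n ∣ ≤ ι b × ∣ seq y n ∣ ≤ ι b) → sinᵣ x ≃ sinᵣ y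
    within b hb = ≃-scaled (ι 2 * M) (*-mono-0≤ (0≤ι 2) 0≤M) λ ε 0<ε →
      Ev-zip (λ n (p , q) r → ≤-trans (sinSum-lipschitz p q n) (*-monoʳ-≤′ (*-mono-0≤ (0≤ι 2) 0≤M) (<⇒≤ r))) hb (h ε 0<ε)
      where open SinBounds b

  sinᵣ-+ : ∀ x y → sinᵣ x · cosᵣ y +ᵣ cosᵣ x · sinᵣ y ≃ sinᵣ (x +ᵣ y)
  sinᵣ-+ x y = let b , hb = common-bound x y in
    ≃-geometric (K+ b) (0≤K+ b) (Ev-map (λ n (p , q) → sinSum-+ b p q n) hb)

  cosᵣ-+ : ∀ x y → cosᵣ x · cosᵣ y -ᵣ sinᵣ x · sinᵣ y ≃ cosᵣ (x +ᵣ y)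
  cosᵣ-+ x y = let b , hb = common-bound x y in
    ≃-geometric (K+ b) (0≤K+ b) (Ev-map (λ n (p , q) → cosSum-+ b p q n) hb)

  cosᵣ-half : ∀ x → cosᵣ x ≃ 1# -ᵣ 𝕢 (ι 2) · (sinᵣ (𝕢 ½ · x) · sinᵣ (𝕢 ½ · x))
  cosᵣ-half x = let b , hb = eventually-bounded (𝕢 ½ · x) in within b hb
    where
    within : ∀ b → Eventually (λ n → ∣ seq (𝕢 ½ · x) n ∣ ≤ ι b) → cosᵣ x ≃ 1# -ᵣ 𝕢 (ι 2) · (sinᵣ (𝕢 ½ · x) · sinᵣ (𝕢 ½ · x))
    within b (N , hb) = ≃-geometric (K+ b + K+ b) (+-mono-0≤ (0≤K+ b) (0≤K+ b))
      (1 ℕ.⊔ N , λ n le → cosSum-half b {seq x n} (hb n (ℕₚ.m⊔n≤o⇒n≤o 1 N le)) (ℕₚ.m⊔n≤o⇒m≤o 1 N le))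

  sinᵣ-neg : ∀ x → sinᵣ (-ᵣ x) ≃ -ᵣ sinᵣ x
  sinᵣ-neg x = pointwise λ n → sinSum-neg (seq x n) n

  cosᵣ-neg : ∀ x → cosᵣ (-ᵣ x) ≃ cosᵣ x
  cosᵣ-neg x = pointwise λ n → cosSum-neg (seq x n) n

  cosᵣ-0 : cosᵣ 0# ≃ 1#
  cosᵣ-0 = ⟪ (λ ε 0<ε → 1 , λ n 1≤n → subst (_< ε)
    (sym (cong ∣_∣ (trans (cong (_- 1ℚ) (cosSum-0 1≤n)) (+-inverseʳ 1ℚ)))) 0<ε) ⟫

  -- `sinSum-bounds` needs nonnegative arguments, which the approximants of `absᵣ x` are at every
  -- index; `sinᵣ-bounds` then transfers the result along `0≼⇒≃∣∣`.
  sinᵣ-∣x∣-bounds : ∀ x → absᵣ x ≼ 1# →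
    absᵣ x -ᵣ absᵣ x · absᵣ x · absᵣ x ≼ sinᵣ (absᵣ x) × sinᵣ (absᵣ x) ≼ absᵣ x
  sinᵣ-∣x∣-bounds x ⟪ h ⟫ = ≼-eventually (Ev-map (λ _ → proj₁) bounds) , ≼-eventually (Ev-map (λ _ → proj₂) bounds)
    where
    bounds : Eventually λ n → let p = ∣ seq x n ∣ in (p - p * p * p ≤ sinSum p n) × (sinSum p n ≤ p)
    -- A tolerance of 1 in `absᵣ x ≼ 1#` places the approximants below 2, the range of
    -- `sinSum-bounds`.
    bounds = let N , f = h 1ℚ (positive⁻¹ 1ℚ) in
      suc N , λ { (suc n) (ℕ.s≤s N≤n) → sinSum-bounds (0≤∣p∣ (seq x (suc n))) (<⇒≤ (f (suc n) (ℕₚ.m≤n⇒m≤1+n N≤n))) n }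

  sinᵣ-16/5≼0 : sinᵣ (𝕢 16/5) ≼ 0#
  sinᵣ-16/5≼0 = ≼-intro λ ε 0<ε → 4 , λ n 4≤n → ≤-trans (subst (λ n → sinSum 16/5 n ≤ 0ℚ)
    (ℕₚ.m+[n∸m]≡n 4≤n) (sinSum-16/5≤0 (n ℕ.∸ 4))) (<⇒≤ (subst (0ℚ <_) (sym (+-identityˡ ε)) 0<ε))

sinᵣ-bounds : ∀ {x} → 0# ≼ x → x ≼ 1# → x -ᵣ x · x · x ≼ sinᵣ x × sinᵣ x ≼ x
sinᵣ-bounds {x} 0≼x x≼1 =
  let x≃∣x∣ = 0≼⇒≃∣∣ 0≼x
      lower , upper = sinᵣ-∣x∣-bounds x (≼-trans (≃⇒≼ (≃-sym x≃∣x∣)) x≼1)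
  in (begin
       x -ᵣ x · x · x                                ≈⟨ +-cong x≃∣x∣ (neg-cong (*-cong (*-cong x≃∣x∣ x≃∣x∣) x≃∣x∣)) ⟩
       absᵣ x -ᵣ absᵣ x · absᵣ x · absᵣ x            ≤⟨ lower ⟩
       sinᵣ (absᵣ x)                                 ≈⟨ sinᵣ-cong x≃∣x∣ ⟨
       sinᵣ x                                        ∎) ,
     (begin
       sinᵣ x            ≈⟨ sinᵣ-cong x≃∣x∣ ⟩
       sinᵣ (absᵣ x)     ≤⟨ upper ⟩
       absᵣ x            ≈⟨ x≃∣x∣ ⟨
       x                 ∎)
  where open ≼-Reasoning

-- The half-angle formula reduces this to the sine, for whose partial sums a Lipschitz bound is at
-- hand.
cosᵣ-cong : ∀ {x y} → x ≃ y → cosᵣ x ≃ cosᵣ y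
cosᵣ-cong {x} {y} h = begin-equality
  cosᵣ x                                                       ≈⟨ cosᵣ-half x ⟩
  1# -ᵣ 𝕢 (ι 2) · (sinᵣ (𝕢 ½ · x) · sinᵣ (𝕢 ½ · x))            ≈⟨ +-cong ≃-refl (neg-cong (*-cong ≃-refl (*-cong half half))) ⟩
  1# -ᵣ 𝕢 (ι 2) · (sinᵣ (𝕢 ½ · y) · sinᵣ (𝕢 ½ · y))            ≈⟨ cosᵣ-half y ⟨
  cosᵣ y                                                       ∎
  where
  open ≼-Reasoning
  half : sinᵣ (𝕢 ½ · x) ≃ sinᵣ (𝕢 ½ · y)
  half = sinᵣ-cong (*-cong ≃-refl h)

sin²+cos² : ∀ x → sinᵣ x · sinᵣ x +ᵣ cosᵣ x · cosᵣ x ≃ 1#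
sin²+cos² x = begin-equality
  sinᵣ x · sinᵣ x +ᵣ cosᵣ x · cosᵣ x
    ≈⟨ ring 2 (λ s c → s ⊗ s ⊕ c ⊗ c ⊜ c ⊗ c ⊖ s ⊗ (⊝ s)) ≃-refl (sinᵣ x) (cosᵣ x) ⟩
  cosᵣ x · cosᵣ x -ᵣ sinᵣ x · (-ᵣ sinᵣ x)
    ≈⟨ +-cong (*-cong ≃-refl (cosᵣ-neg x)) (neg-cong (*-cong ≃-refl (sinᵣ-neg x))) ⟨
  cosᵣ x · cosᵣ (-ᵣ x) -ᵣ sinᵣ x · sinᵣ (-ᵣ x)
    ≈⟨ cosᵣ-+ x (-ᵣ x) ⟩
  cosᵣ (x -ᵣ x)
    ≈⟨ cosᵣ-cong (ring 1 (λ x → x ⊖ x ⊜ κ 0ℚ) ≃-refl x) ⟩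
  cosᵣ 0#
    ≈⟨ cosᵣ-0 ⟩
  1# ∎
  where open ≼-Reasoning

1-cos-double : ∀ x → 1# -ᵣ cosᵣ (x +ᵣ x) ≃ 𝕢 (ι 2) · (sinᵣ x · sinᵣ x)
1-cos-double x = begin-equality
  1# -ᵣ cosᵣ (x +ᵣ x)                       ≈⟨ +-cong (≃-sym (sin²+cos² x)) (neg-cong (≃-sym (cosᵣ-+ x x))) ⟩
  s · s +ᵣ c · c -ᵣ (c · c -ᵣ s · s)        ≈⟨ ring 2 (λ s c → s ⊗ s ⊕ c ⊗ c ⊖ (c ⊗ c ⊖ s ⊗ s) ⊜ κ (ι 2) ⊗ (s ⊗ s)) ≃-refl s c ⟩
  𝕢 (ι 2) · (s · s)                         ∎
  where
  open ≼-Reasoning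
  s = sinᵣ x
  c = cosᵣ x

1+cos-double : ∀ x → 1# +ᵣ cosᵣ (x +ᵣ x) ≃ 𝕢 (ι 2) · (cosᵣ x · cosᵣ x)
1+cos-double x = begin-equality
  1# +ᵣ cosᵣ (x +ᵣ x)                       ≈⟨ +-cong (≃-sym (sin²+cos² x)) (≃-sym (cosᵣ-+ x x)) ⟩
  s · s +ᵣ c · c +ᵣ (c · c -ᵣ s · s)        ≈⟨ ring 2 (λ s c → s ⊗ s ⊕ c ⊗ c ⊕ (c ⊗ c ⊖ s ⊗ s) ⊜ κ (ι 2) ⊗ (c ⊗ c)) ≃-refl s c ⟩
  𝕢 (ι 2) · (c · c)                         ∎
  where
  open ≼-Reasoning
  s = sinᵣ x
  c = cosᵣ x

-- By sin² + cos² = 1, the nonnegative expression ((1 - s)² + c²) / 2 equals 1 - s.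
sin≼1 : ∀ x → sinᵣ x ≼ 1#
sin≼1 x = ≼-by (*-mono-0≼ (𝕢-mono {0ℚ} {½} (≤ᵇ⇒≤ _)) (+-mono-0≼ (0≼x·x (1# -ᵣ s)) (0≼x·x c))) (begin-equality
  𝕢 ½ · ((1# -ᵣ s) · (1# -ᵣ s) +ᵣ c · c)
    ≈⟨ ring 2 (λ s c → κ ½ ⊗ ((κ 1ℚ ⊖ s) ⊗ (κ 1ℚ ⊖ s) ⊕ c ⊗ c) ⊜ κ ½ ⊗ (κ 1ℚ ⊖ κ (ι 2) ⊗ s ⊕ (s ⊗ s ⊕ c ⊗ c))) ≃-refl s c ⟩
  𝕢 ½ · (1# -ᵣ 𝕢 (ι 2) · s +ᵣ (s · s +ᵣ c · c))
    ≈⟨ *-cong ≃-refl (+-cong ≃-refl (sin²+cos² x)) ⟩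
  𝕢 ½ · (1# -ᵣ 𝕢 (ι 2) · s +ᵣ 1#)
    ≈⟨ ring 1 (λ s → κ ½ ⊗ (κ 1ℚ ⊖ κ (ι 2) ⊗ s ⊕ κ 1ℚ) ⊜ κ 1ℚ ⊖ s) ≃-refl s ⟩
  1# -ᵣ s ∎)
  where
  open ≼-Reasoning
  s = sinᵣ x
  c = cosᵣ x

-- Trigonometry at rational multiples of π

0≺1 : 0# ≺ 1#
0≺1 = 0≺𝕢 (positive⁻¹ 1ℚ)

0≺𝕢2 : 0# ≺ 𝕢 (ι 2)
0≺𝕢2 = 0≺𝕢 (positive⁻¹ (ι 2))

0≼𝕢 : ∀ {q} → 0ℚ ≤ q → 0# ≼ 𝕢 q
0≼𝕢 = 𝕢-mono

≃-reflexive : ∀ {x y} → x ≡ y → x ≃ y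
≃-reflexive refl = ≃-refl

≺-respʳ-≃ : ∀ {x y z} → x ≺ y → y ≃ z → x ≺ z
≺-respʳ-≃ h e = ≺-≼-trans h (≃⇒≼ e)

module Trigonometry (π : ℝ) (isPi : IsPi π) where
  opaque
    unfolding 𝕢 sinᵣ

    0≺π : 0# ≺ π
    0≺π = ⟪ IsPi.π-pos isPi ⟫

    sin-π≃0 : sinᵣ π ≃ 0#
    sin-π≃0 = ⟪ IsPi.sin-π isPi ⟫

    0≺sin : ∀ {x} → 0# ≺ x → x ≺ π → 0# ≺ sinᵣ x
    0≺sin {x} ⟪ 0<x ⟫ ⟪ x<π ⟫ = ⟪ IsPi.sin-pos isPi x 0<x x<π ⟫

  S C : ℚ → ℝ
  S q = sinᵣ (π · 𝕢 q)
  C q = cosᵣ (π · 𝕢 q)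

  angle-+ : ∀ p q → π · 𝕢 p +ᵣ π · 𝕢 q ≃ π · 𝕢 (p + q)
  angle-+ p q = ≃-trans (≃-sym (·-distribˡ-+ π (𝕢 p) (𝕢 q))) (*-cong ≃-refl (≃-sym (𝕢-+ p q)))

  angle-neg : ∀ q → π · 𝕢 (- q) ≃ -ᵣ (π · 𝕢 q)
  angle-neg q = ≃-trans (*-cong ≃-refl (𝕢-neg q))
    (ring 2 (λ p q → p ⊗ (⊝ q) ⊜ ⊝ (p ⊗ q)) ≃-refl π (𝕢 q))

  S-+ : ∀ p q → S (p + q) ≃ S p · C q +ᵣ C p · S q
  S-+ p q = ≃-trans (sinᵣ-cong (≃-sym (angle-+ p q))) (≃-sym (sinᵣ-+ (π · 𝕢 p) (π · 𝕢 q)))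

  C-+ : ∀ p q → C (p + q) ≃ C p · C q -ᵣ S p · S q
  C-+ p q = ≃-trans (cosᵣ-cong (≃-sym (angle-+ p q))) (≃-sym (cosᵣ-+ (π · 𝕢 p) (π · 𝕢 q)))

  S-neg : ∀ q → S (- q) ≃ -ᵣ S q
  S-neg q = ≃-trans (sinᵣ-cong (angle-neg q)) (sinᵣ-neg (π · 𝕢 q))

  0≺S : ∀ {q} → 0ℚ < q → q < 1ℚ → 0# ≺ S q
  0≺S {q} 0<q q<1 = 0≺sin (*-mono-0≺ 0≺π (0≺𝕢 0<q)) (0≺-⇒≺ (≺-respʳ-≃
    (*-mono-0≺ 0≺π (0≺𝕢 (subst (_< 1ℚ - q) (+-inverseʳ q) (+-monoˡ-< (- q) q<1))))
    (≃-trans (*-cong ≃-refl (≃-trans (𝕢-+ 1ℚ (- q)) (+-cong ≃-refl (𝕢-neg q))))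
      (ring 2 (λ p q → p ⊗ (κ 1ℚ ⊖ q) ⊜ p ⊖ p ⊗ q) ≃-refl π (𝕢 q)))))

  S0≃0 : S 0ℚ ≃ 0#
  S0≃0 = *-cancelˡ-≃ 0≺𝕢2 (begin-equality
    𝕢 (ι 2) · S 0ℚ           ≈⟨ ring 1 (λ s → κ (ι 2) ⊗ s ⊜ s ⊕ s) ≃-refl (S 0ℚ) ⟩
    S (- 0ℚ) +ᵣ S 0ℚ         ≈⟨ +-cong (S-neg 0ℚ) ≃-refl ⟩
    -ᵣ S 0ℚ +ᵣ S 0ℚ          ≈⟨ ring 1 (λ s → ⊝ s ⊕ s ⊜ κ (ι 2) ⊗ κ 0ℚ) ≃-refl (S 0ℚ) ⟩
    𝕢 (ι 2) · 0#             ∎)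
    where open ≼-Reasoning

  0≼S : ∀ {q} → 0ℚ ≤ q → q < 1ℚ → 0# ≼ S q
  0≼S {q} 0≤q q<1 with 0ℚ <? q
  ... | yes 0<q = ≺⇒≼ (0≺S 0<q q<1)
  ... | no  0≮q = ≃⇒≼ (≃-trans (≃-sym S0≃0) (≃-reflexive (cong S (≤-antisym 0≤q (≮⇒≥ 0≮q)))))

  S²+C² : ∀ q → S q · S q +ᵣ C q · C q ≃ 1#
  S²+C² q = sin²+cos² (π · 𝕢 q)

  0≺S½ : 0# ≺ S ½
  0≺S½ = 0≺S (positive⁻¹ ½) (½*< positive⁻¹ 1ℚ)

  C½≃0 : C ½ ≃ 0#
  C½≃0 = *-cancelˡ-≃ (*-mono-0≺ 0≺𝕢2 0≺S½) (begin-equality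
    𝕢 (ι 2) · S ½ · C ½             ≈⟨ ring 2 (λ s c → κ (ι 2) ⊗ s ⊗ c ⊜ s ⊗ c ⊕ c ⊗ s) ≃-refl (S ½) (C ½) ⟩
    S ½ · C ½ +ᵣ C ½ · S ½          ≈⟨ S-+ ½ ½ ⟨
    S 1ℚ                            ≈⟨ sinᵣ-cong (ring 1 (λ p → p ⊗ κ 1ℚ ⊜ p) ≃-refl π) ⟩
    sinᵣ π                          ≈⟨ sin-π≃0 ⟩
    0#                              ≈⟨ ring 1 (λ s → κ 0ℚ ⊜ κ (ι 2) ⊗ s ⊗ κ 0ℚ) ≃-refl (S ½) ⟩
    𝕢 (ι 2) · S ½ · 0#              ∎)
    where open ≼-Reasoning

  -- `C½≃0` makes the square of `S ½` equal to 1. Positivity selects the root: (1 + s) s = 1 + s,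
  -- and 1 + s can be cancelled.
  S½≃1 : S ½ ≃ 1#
  S½≃1 = *-cancelˡ-≃ (≺-≼-trans 0≺1 (≼-by (≺⇒≼ 0≺S½) (ring 1 (λ s → s ⊜ κ 1ℚ ⊕ s ⊖ κ 1ℚ) ≃-refl (S ½)))) (begin-equality
    (1# +ᵣ s) · s
      ≈⟨ ring 2 (λ s c → (κ 1ℚ ⊕ s) ⊗ s ⊜ s ⊕ (s ⊗ s ⊕ c ⊗ c) ⊖ c ⊗ c) ≃-refl s (C ½) ⟩
    s +ᵣ (s · s +ᵣ C ½ · C ½) -ᵣ C ½ · C ½
      ≈⟨ +-cong (+-cong ≃-refl (S²+C² ½)) (neg-cong (*-cong C½≃0 C½≃0)) ⟩
    s +ᵣ 1# -ᵣ 0# · 0#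
      ≈⟨ ring 1 (λ s → s ⊕ κ 1ℚ ⊖ κ 0ℚ ⊗ κ 0ℚ ⊜ (κ 1ℚ ⊕ s) ⊗ κ 1ℚ) ≃-refl s ⟩
    (1# +ᵣ s) · 1# ∎)
    where
    open ≼-Reasoning
    s = S ½

  S[½+] : ∀ q → S (½ + q) ≃ C q
  S[½+] q = ≃-trans (S-+ ½ q) (≃-trans (+-cong (*-cong S½≃1 ≃-refl) (*-cong C½≃0 ≃-refl))
    (ring 2 (λ s c → κ 1ℚ ⊗ c ⊕ κ 0ℚ ⊗ s ⊜ c) ≃-refl (S q) (C q)))

  C[½+] : ∀ q → C (½ + q) ≃ -ᵣ S q
  C[½+] q = ≃-trans (C-+ ½ q) (≃-trans (+-cong (*-cong C½≃0 ≃-refl) (neg-cong (*-cong S½≃1 ≃-refl)))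
    (ring 2 (λ s c → κ 0ℚ ⊗ c ⊖ κ 1ℚ ⊗ s ⊜ ⊝ s) ≃-refl (S q) (C q)))

  S-reflect : ∀ q → S (1ℚ - q) ≃ S q
  S-reflect q = begin-equality
    S (1ℚ - q)              ≡⟨ cong S (+-assoc ½ ½ (- q)) ⟩
    S (½ + (½ + - q))       ≈⟨ S[½+] (½ + - q) ⟩
    C (½ + - q)             ≈⟨ C[½+] (- q) ⟩
    -ᵣ S (- q)              ≈⟨ neg-cong (S-neg q) ⟩
    -ᵣ (-ᵣ S q)             ≈⟨ ring 1 (λ s → ⊝ (⊝ s) ⊜ s) ≃-refl (S q) ⟩
    S q                     ∎
    where open ≼-Reasoning

  0≼C : ∀ {q} → 0ℚ ≤ q → q < ½ → 0# ≼ C q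
  0≼C {q} 0≤q q<½ = ≼-trans (0≼S (+-mono-0≤ (nonNegative⁻¹ ½) 0≤q) (+-monoʳ-< ½ q<½)) (≃⇒≼ (S[½+] q))

  S≼1 : ∀ q → S q ≼ 1#
  S≼1 q = sin≼1 (π · 𝕢 q)

  C≼1 : ∀ q → C q ≼ 1#
  C≼1 q = ≼-trans (≃⇒≼ (≃-sym (S[½+] q))) (S≼1 (½ + q))

  S-double : ∀ q → S q ≃ 𝕢 (ι 2) · (S (½ * q) · C (½ * q))
  S-double q = ≃-trans (≃-reflexive (cong S (sym (½+½ q)))) (≃-trans (S-+ (½ * q) (½ * q))
    (ring 2 (λ s c → s ⊗ c ⊕ c ⊗ s ⊜ κ (ι 2) ⊗ (s ⊗ c)) ≃-refl (S (½ * q)) (C (½ * q))))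

  1-C : ∀ q → 1# -ᵣ C q ≃ 𝕢 (ι 2) · (S (½ * q) · S (½ * q))
  1-C q = ≃-trans (+-cong ≃-refl (neg-cong (cosᵣ-cong (≃-trans (*-cong ≃-refl (≃-reflexive (cong 𝕢 (sym (½+½ q)))))
    (≃-sym (angle-+ (½ * q) (½ * q))))))) (1-cos-double (π · 𝕢 (½ * q)))

  1+C : ∀ q → 1# +ᵣ C q ≃ 𝕢 (ι 2) · (C (½ * q) · C (½ * q))
  1+C q = ≃-trans (+-cong ≃-refl (cosᵣ-cong (≃-trans (*-cong ≃-refl (≃-reflexive (cong 𝕢 (sym (½+½ q)))))
    (≃-sym (angle-+ (½ * q) (½ * q)))))) (1+cos-double (π · 𝕢 (½ * q)))

  -- `IsPi` makes the sine positive on (0, π), so a positive point with sine at most 0 cannot lie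
  -- below π.
  π≼16/5 : π ≼ 𝕢 16/5
  π≼16/5 = ⊀⇒≽ λ 16/5≺π → <-irrefl refl (0≺0 (≺-≼-trans
    (0≺sin (0≺𝕢 (positive⁻¹ 16/5)) 16/5≺π) sinᵣ-16/5≼0))
    where
    0≺0 : 0# ≺ 0# → 0ℚ < 0ℚ
    0≺0 h = let ε , 0<ε , le = ≺⇒gap h in <-≤-trans 0<ε (𝕢-cancel (≼-trans (≃⇒≼ (≃-sym (+ᵣ-identityˡ (𝕢 ε)))) le))

  module _ {q} (0≤q : 0ℚ ≤ q) (q≤¼ : q ≤ ¼) where
    private
      0≼πq : 0# ≼ π · 𝕢 q
      0≼πq = *-mono-0≼ (≺⇒≼ 0≺π) (0≼𝕢 0≤q)

      -- 16/5 · ¼ = 4/5, within the range of `sinᵣ-bounds`.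
      πq≼1 : π · 𝕢 q ≼ 1#
      πq≼1 = ≼-trans (*-mono-≼ (0≼𝕢 0≤q) (0≼𝕢 {16/5} (≤ᵇ⇒≤ _)) π≼16/5 (𝕢-mono q≤¼))
        (≼-trans (≃⇒≼ (≃-sym (𝕢-· 16/5 ¼))) (𝕢-mono {16/5 * ¼} (≤ᵇ⇒≤ _)))

    S≼π· : S q ≼ π · 𝕢 q
    S≼π· = proj₂ (sinᵣ-bounds 0≼πq πq≼1)

    S≽π·- : π · 𝕢 q -ᵣ π · 𝕢 q · (π · 𝕢 q) · (π · 𝕢 q) ≼ S q
    S≽π·- = proj₁ (sinᵣ-bounds 0≼πq πq≼1)

  -- Jordan's inequality sin (π q / 2) ≥ q, in a form that is preserved by the
  -- digit maps q ↦ q / 2 and q ↦ (1 + q) / 2 of the van der Corput sequence.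
  record Jordan (q : ℚ) : Set where
    field
      0≤q   : 0ℚ ≤ q
      q<1   : q < 1ℚ
      sin≽  : 𝕢 q ≼ S (½ * q)
      cos≽  : 𝕢 (1ℚ - q) ≼ C (½ * q)

  𝕢2x≼𝕢2y : ∀ {x y} → 𝕢 (ι 2) · x ≼ 𝕢 (ι 2) · y → x ≼ y
  𝕢2x≼𝕢2y = *-cancelˡ-≼ 0≺𝕢2

  x·y≼x : ∀ {x y} → 0# ≼ x → y ≼ 1# → x · y ≼ x
  x·y≼x {x} 0≼x y≼1 = ≼-trans (*-monoʳ-≼ 0≼x y≼1) (≃⇒≼ (ring 1 (λ x → x ⊗ κ 1ℚ ⊜ x) ≃-refl x))

  jordan-0 : Jordan 0ℚ
  jordan-0 = record
    { 0≤q = ≤-refl ; q<1 = positive⁻¹ 1ℚ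
    ; sin≽ = ≃⇒≼ (≃-sym S0≃0)
    ; cos≽ = ≃⇒≼ (≃-trans (≃-sym S½≃1) (≃-trans (≃-reflexive (cong S (sym (+-identityʳ ½)))) (S[½+] 0ℚ))) }

  module _ {q} (J : Jordan q) where
    open Jordan J
    open ≼-Reasoning
    private
      h : ℚ
      h = ½ * q

      0≤½ : 0ℚ ≤ ½
      0≤½ = nonNegative⁻¹ ½

      h<½ : h < ½
      h<½ = *-monoʳ-<-pos ½ q<1


      0≤h : 0ℚ ≤ h
      0≤h = *-mono-0≤ 0≤½ 0≤q

      h≤q : h ≤ q
      h≤q = subst (h ≤_) (*-identityˡ q) (*-monoˡ-≤′ {½} {1ℚ} 0≤q (≤ᵇ⇒≤ _))

      a : ℚ
      a = ½ * h

      a<½ : a < ½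
      a<½ = *-monoʳ-<-pos ½ (≤-<-trans h≤q q<1)

      0≤a : 0ℚ ≤ a
      0≤a = *-mono-0≤ 0≤½ 0≤h

      0≼Sa : 0# ≼ S a
      0≼Sa = 0≼S 0≤a (<-trans a<½ (½*< positive⁻¹ 1ℚ))

      0≼Ca : 0# ≼ C a
      0≼Ca = 0≼C 0≤a a<½

      k : ℚ
      k = ½ + h

      k<1 : k < 1ℚ
      k<1 = +-monoʳ-< ½ h<½

      0≤k : 0ℚ ≤ k
      0≤k = +-mono-0≤ 0≤½ 0≤h

      b : ℚ
      b = ½ * k

      b<½ : b < ½
      b<½ = *-monoʳ-<-pos ½ k<1

      0≤b : 0ℚ ≤ b
      0≤b = *-mono-0≤ 0≤½ 0≤k

      0≼Sb : 0# ≼ S b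
      0≼Sb = 0≼S 0≤b (<-trans b<½ (½*< positive⁻¹ 1ℚ))

      0≼Cb : 0# ≼ C b
      0≼Cb = 0≼C 0≤b b<½

    -- `S h` is 2 S(a) C(a) and 1 + `C h` is 2 C(a)². In each product one factor C(a) is dropped as
    -- being at most 1.
    jordan-half : Jordan h
    jordan-half = record
      { 0≤q = 0≤h ; q<1 = ≤-<-trans h≤q q<1
      ; sin≽ = 𝕢2x≼𝕢2y (begin
          𝕢 (ι 2) · 𝕢 h              ≈⟨ 𝕢-· (ι 2) h ⟨
          𝕢 (ι 2 * h)                ≡⟨ cong 𝕢 (solve 1 (λ q → con (ι 2) :* (con ½ :* q) := q) refl q) ⟩
          𝕢 q                        ≤⟨ sin≽ ⟩
          S h                        ≈⟨ S-double h ⟩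
          𝕢 (ι 2) · (S a · C a)      ≤⟨ *-monoʳ-≼ (≺⇒≼ 0≺𝕢2) (x·y≼x 0≼Sa (C≼1 a)) ⟩
          𝕢 (ι 2) · S a              ∎)
      ; cos≽ = 𝕢2x≼𝕢2y (begin
          𝕢 (ι 2) · 𝕢 (1ℚ - h)       ≈⟨ 𝕢-· (ι 2) (1ℚ - h) ⟨
          𝕢 (ι 2 * (1ℚ - h))         ≡⟨ cong 𝕢 (solve 1 (λ q → con (ι 2) :* (con 1ℚ :- con ½ :* q) := con 1ℚ :+ (con 1ℚ :- q)) refl q) ⟩
          𝕢 (1ℚ + (1ℚ - q))          ≈⟨ 𝕢-+ 1ℚ (1ℚ - q) ⟩
          1# +ᵣ 𝕢 (1ℚ - q)           ≤⟨ +-mono-≼ ≼-refl cos≽ ⟩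
          1# +ᵣ C h                  ≈⟨ 1+C h ⟩
          𝕢 (ι 2) · (C a · C a)      ≤⟨ *-monoʳ-≼ (≺⇒≼ 0≺𝕢2) (x·y≼x 0≼Ca (C≼1 a)) ⟩
          𝕢 (ι 2) · C a              ∎) }

    -- The shift by ½ exchanges sine and cosine, which is why the two bounds are carried together: 1
    -- + `S h` = 1 - `C k` = 2 S(b)², and `C h` = `S k` = 2 S(b) C(b). A factor S(b), at most 1, is
    -- dropped from each.
    jordan-half+½ : Jordan k
    jordan-half+½ = record
      { 0≤q = 0≤k ; q<1 = k<1
      ; sin≽ = 𝕢2x≼𝕢2y (begin
          𝕢 (ι 2) · 𝕢 k              ≈⟨ 𝕢-· (ι 2) k ⟨
          𝕢 (ι 2 * k)                ≡⟨ cong 𝕢 (solve 1 (λ q → con (ι 2) :* (con ½ :+ con ½ :* q) := con 1ℚ :+ q) refl q) ⟩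
          𝕢 (1ℚ + q)                 ≈⟨ 𝕢-+ 1ℚ q ⟩
          1# +ᵣ 𝕢 q                  ≤⟨ +-mono-≼ ≼-refl sin≽ ⟩
          1# +ᵣ S h                  ≈⟨ ring 1 (λ s → κ 1ℚ ⊕ s ⊜ κ 1ℚ ⊖ (⊝ s)) ≃-refl (S h) ⟩
          1# -ᵣ (-ᵣ S h)             ≈⟨ +-cong ≃-refl (neg-cong (C[½+] h)) ⟨
          1# -ᵣ C k                  ≈⟨ 1-C k ⟩
          𝕢 (ι 2) · (S b · S b)      ≤⟨ *-monoʳ-≼ (≺⇒≼ 0≺𝕢2) (x·y≼x 0≼Sb (S≼1 b)) ⟩
          𝕢 (ι 2) · S b              ∎)
      ; cos≽ = 𝕢2x≼𝕢2y (begin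
          𝕢 (ι 2) · 𝕢 (1ℚ - k)       ≈⟨ 𝕢-· (ι 2) (1ℚ - k) ⟨
          𝕢 (ι 2 * (1ℚ - k))         ≡⟨ cong 𝕢 (solve 1 (λ q → con (ι 2) :* (con 1ℚ :- (con ½ :+ con ½ :* q)) := con 1ℚ :- q) refl q) ⟩
          𝕢 (1ℚ - q)                 ≤⟨ cos≽ ⟩
          C h                        ≈⟨ S[½+] h ⟨
          S k                        ≈⟨ S-double k ⟩
          𝕢 (ι 2) · (S b · C b)      ≈⟨ *-cong ≃-refl (·-comm (S b) (C b)) ⟩
          𝕢 (ι 2) · (C b · S b)      ≤⟨ *-monoʳ-≼ (≺⇒≼ 0≺𝕢2) (x·y≼x 0≼Cb (S≼1 b)) ⟩
          𝕢 (ι 2) · C b              ∎) }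

-- The van der Corput sequence in binary

2^≢0 : ∀ i → ℕ.NonZero (2 ℕ.^ i)
2^≢0 i = ℕₚ.m^n≢0 2 i

double≡*2 : ∀ m → double m ≡ m ℕ.* 2
double≡*2 zero    = refl
double≡*2 (suc m) = cong (suc ∘ suc) (double≡*2 m)

module _ (m : ℕ) where
  digit-even-0 : digit (double m) 0 ≡ 0
  digit-even-0 = trans (cong (DivMod._% 2) (trans (DivMod.n/1≡n (double m)) (double≡*2 m))) (DivMod.m*n%n≡0 m 2)

  digit-odd-0 : digit (suc (double m)) 0 ≡ 1
  digit-odd-0 = trans (cong (DivMod._% 2) (trans (DivMod.n/1≡n (suc (double m))) (cong suc (double≡*2 m)))) (DivMod.[m+kn]%n≡m%n 1 m 2)

  private
    digit-suc : ∀ {n} → n DivMod./ 2 ≡ m → ∀ i → digit n (suc i) ≡ digit m i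
    digit-suc {n} h i = cong (DivMod._% 2)
      (trans (sym (DivMod.m/n/o≡m/[n*o] n 2 (2 ℕ.^ i) {{_}} {{2^≢0 i}} {{2^≢0 (suc i)}}))
        (DivMod./-congˡ {o = 2 ℕ.^ i} {{2^≢0 i}} h))

  digit-even-suc : ∀ i → digit (double m) (suc i) ≡ digit m i
  digit-even-suc = digit-suc (trans (cong (DivMod._/ 2) (double≡*2 m)) (DivMod.m*n/n≡m m 2))

  digit-odd-suc : ∀ i → digit (suc (double m)) (suc i) ≡ digit m i
  digit-odd-suc = digit-suc (trans (cong (λ t → suc t DivMod./ 2) (double≡*2 m))
    (trans (DivMod.+-distrib-/-∣ʳ 1 {m ℕ.* 2} {2} (divides m refl)) (DivMod.m*n/n≡m m 2)))

term : ℕ → ℕ → ℚ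
term n i = (+ digit n i / (2 ℕ.^ suc i)) {{2^≢0 (suc i)}}

1/2^n≡½^n : ∀ n → (+ 1 / (2 ℕ.^ n)) {{2^≢0 n}} ≡ ½ ^ℚ n
1/2^n≡½^n n = sym (inverse-unique (2 ℕ.^ n) {{2^≢0 n}} (trans (cong (½ ^ℚ n *_) (ι-homo-^ 2 n)) (½^n*2^n≡1 n)))

digit/2^n≡ : ∀ d → d ℕ.< 2 → ∀ n → (+ d / (2 ℕ.^ n)) {{2^≢0 n}} ≡ ι d * ½ ^ℚ n
digit/2^n≡ 0 _ n = trans (0/n≡0 (2 ℕ.^ n) {{2^≢0 n}}) (sym (*-zeroˡ (½ ^ℚ n)))
digit/2^n≡ 1 _ n = trans (1/2^n≡½^n n) (sym (*-identityˡ (½ ^ℚ n)))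
digit/2^n≡ (suc (suc _)) (ℕ.s≤s (ℕ.s≤s ())) n

term≡ : ∀ n i → term n i ≡ ι (digit n i) * ½ ^ℚ suc i
term≡ n i = digit/2^n≡ (digit n i) (DivMod.m%n<n ((n DivMod./ (2 ℕ.^ i)) {{2^≢0 i}}) 2) (suc i)

term-zero : ∀ {n i} → n ℕ.≤ i → term n i ≡ 0ℚ
term-zero {n} {i} n≤i = trans (term≡ n i) (trans
  (cong (λ d → ι (d DivMod.% 2) * ½ ^ℚ suc i)
    (DivMod.m<n⇒m/n≡0 {{2^≢0 i}} (ℕₚ.<-≤-trans (n<2^n n) (ℕₚ.^-monoʳ-≤ 2 n≤i))))
  (*-zeroˡ (½ ^ℚ suc i)))

-- Digits of n from position n on vanish because n < 2ⁿ. This reconciles the different cut-offs for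
-- a number and for its half in `step`.
∑-term : ∀ {n k} → n ℕ.≤ k → ∑< k (term n) ≡ vanDerCorput n
∑-term {n} {k} n≤k = trans (cong (λ k → ∑< k (term n)) (sym (ℕₚ.m∸n+n≡m n≤k))) (stable (k ℕ.∸ n))
  where
  stable : ∀ j → ∑< (j ℕ.+ n) (term n) ≡ vanDerCorput n
  stable zero    = refl
  stable (suc j) = trans (cong₂ _+_ (stable j) (term-zero (ℕₚ.m≤n+m n j))) (+-identityʳ (vanDerCorput n))

module _ (m : ℕ) where
  private
    step : ∀ n {d} → m ℕ.≤ n → digit n 0 ≡ d → (∀ i → digit n (suc i) ≡ digit m i) →
      vanDerCorput n ≡ ι d * ½ + ½ * vanDerCorput m
    step n {d} m≤n h₀ h = begin
      vanDerCorput n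
        ≡⟨ ∑-term (ℕₚ.n≤1+n n) ⟨
      ∑< (suc n) (term n)
        ≡⟨ ∑<-suc n (term n) ⟩
      term n 0 + ∑< n (term n ∘ suc)
        ≡⟨ cong₂ _+_ (trans (term≡ n 0) (cong (λ d → ι d * ½) h₀)) (∑<-cong n λ i →
             trans (term≡ n (suc i)) (trans (cong (λ d → ι d * ½ ^ℚ suc (suc i)) (h i))
               (trans (solve 3 (λ d h p → d :* (h :* p) := h :* (d :* p)) refl (ι (digit m i)) ½ (½ ^ℚ suc i))
                 (cong (½ *_) (sym (term≡ m i)))))) ⟩
      ι d * ½ + ∑< n (λ i → ½ * term m i)
        ≡⟨ cong (λ z → ι d * ½ + z) (trans (∑<-* n ½ (term m)) (cong (½ *_) (∑-term m≤n))) ⟩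
      ι d * ½ + ½ * vanDerCorput m ∎
      where open ≡-Reasoning

  vdc-even : vanDerCorput (double m) ≡ ½ * vanDerCorput m
  vdc-even = trans (step (double m) (n≤double m) (digit-even-0 m) (digit-even-suc m))
    (+-identityˡ (½ * vanDerCorput m))

  vdc-odd : vanDerCorput (suc (double m)) ≡ ½ + ½ * vanDerCorput m
  vdc-odd = step (suc (double m)) (ℕₚ.m≤n⇒m≤1+n (n≤double m)) (digit-odd-0 m) (digit-odd-suc m)

-- The products

-- The base case is the leading digit 1. With `suc n` as the index, `double (suc n)` reduces to a
-- successor, as the recursions for `q` need.
data Binary : ℕ → Set where
  1ᵇ   : Binary 1
  2ᵇ_  : ∀ {n} → Binary (suc n) → Binary (double (suc n))
  2ᵇ+1 : ∀ {n} → Binary (suc n) → Binary (suc (double (suc n)))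

binary-suc : ∀ {n} → Binary n → Binary (suc n)
binary-suc 1ᵇ       = 2ᵇ 1ᵇ
binary-suc (2ᵇ b)   = 2ᵇ+1 b
binary-suc (2ᵇ+1 b) = 2ᵇ (binary-suc b)

binary : ∀ n → Binary (suc n)
binary zero    = 1ᵇ
binary (suc n) = binary-suc (binary n)

-- ones n = 2ⁿ − 1, so that suc (ones n) is 2ⁿ in a form compatible with double.
ones : ℕ → ℕ
ones zero    = zero
ones (suc n) = suc (double (ones n))

ι-double : ∀ n → ι (double n) ≡ ι 2 * ι n
ι-double n = trans (cong ι (double≡2* n)) (ι-homo-* 2 n)

½^n*ι[2^n]≡1 : ∀ n → ½ ^ℚ n * ι (suc (ones n)) ≡ 1ℚ
½^n*ι[2^n]≡1 zero    = refl
½^n*ι[2^n]≡1 (suc n) = trans (cong (½ * ½ ^ℚ n *_) (ι-double (suc (ones n))))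
  (trans (solve 2 (λ h t → (con ½ :* h) :* (con (ι 2) :* t) := h :* t) refl (½ ^ℚ n) (ι (suc (ones n)))) (½^n*ι[2^n]≡1 n))

vdc-ones : ∀ n → vanDerCorput (ones n) ≡ 1ℚ - ½ ^ℚ n
vdc-ones zero    = refl
vdc-ones (suc n) = trans (vdc-odd (ones n)) (trans (cong (λ t → ½ + ½ * t) (vdc-ones n))
  (solve 1 (λ h → con ½ :+ con ½ :* (con 1ℚ :- h) := con 1ℚ :- con ½ :* h) refl (½ ^ℚ n)))

vdc-2^ : ∀ n → vanDerCorput (suc (ones n)) ≡ ½ ^ℚ suc n
vdc-2^ zero    = refl
vdc-2^ (suc n) = trans (vdc-even (suc (ones n))) (cong (½ *_) (vdc-2^ n))

∏-suc : ∀ N f → ∏ (suc N) f ≡ ∏ N f *ᵣ f (suc N)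
∏-suc N f = refl

opaque
  unfolding _·_ absᵣ 𝕢 sinᵣ

  ·-def : ∀ x y → x *ᵣ y ≡ x · y
  ·-def x y = refl

  absᵣ-def : ∀ x → ∣ x ∣ᵣ ≡ absᵣ x
  absᵣ-def x = refl

  𝕢-def : ∀ r → fromℚ r ≡ 𝕢 r
  𝕢-def r = refl

  sinᵣ-def : ∀ x → sin x ≡ sinᵣ x
  sinᵣ-def x = refl

2/1≡ι2 : + 2 / 1 ≡ ι 2
2/1≡ι2 = refl

2ᵣ-def : 2ᵣ ≡ 𝕢 (ι 2)
2ᵣ-def = trans (cong fromℚ 2/1≡ι2) (𝕢-def (ι 2))

module Products (π : ℝ) (isPi : IsPi π) where
  open Trigonometry π isPi public

  jordan-vdc : ∀ {n} → Binary n → Jordan (vanDerCorput n)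
  jordan-vdc 1ᵇ           = jordan-half+½ jordan-0
  jordan-vdc (2ᵇ_ {n} b)  = subst Jordan (sym (vdc-even (suc n))) (jordan-half (jordan-vdc b))
  jordan-vdc (2ᵇ+1 {n} b) = subst Jordan (sym (vdc-odd (suc n))) (jordan-half+½ (jordan-vdc b))

  x : ℕ → ℚ
  x n = vanDerCorput n

  module _ (n : ℕ) where
    open Jordan (jordan-vdc (binary n)) public
      using () renaming (0≤q to 0≤x; q<1 to x<1; sin≽ to S[½x]≽x)

  ∣2sin∣-def : ∀ r → ∣ 2ᵣ *ᵣ sin (π *ᵣ fromℚ r) ∣ᵣ ≡ absᵣ (𝕢 (ι 2) · S r)
  ∣2sin∣-def r = trans (absᵣ-def (2ᵣ *ᵣ sin (π *ᵣ fromℚ r))) (cong absᵣ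
    (trans (·-def 2ᵣ (sin (π *ᵣ fromℚ r))) (cong₂ _·_ 2ᵣ-def
      (trans (sinᵣ-def (π *ᵣ fromℚ r)) (cong sinᵣ (trans (·-def π (fromℚ r)) (cong (π ·_) (𝕢-def r))))))))

  factor : ℕ → ℝ
  factor n = ∣ 2ᵣ *ᵣ sin (π *ᵣ fromℚ (vanDerCorput n)) ∣ᵣ

  factor-def : ∀ n → factor n ≡ absᵣ (𝕢 (ι 2) · S (vanDerCorput n))
  factor-def n = ∣2sin∣-def (vanDerCorput n)

  opaque
    P : ℕ → ℝ
    P N = ∏ N factor

    P-def : ∀ N → ∏ N factor ≡ P N
    P-def N = refl

    P-def′ : ∀ N → ∏ N (λ n → ∣ 2ᵣ *ᵣ sin (π *ᵣ fromℚ (vanDerCorput n)) ∣ᵣ) ≡ P N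
    P-def′ N = refl

  P-0 : P 0 ≃ 1#
  P-0 = ≃-reflexive (trans (sym (P-def 0)) (𝕢-def 1ℚ))

  P-suc′ : ∀ N → P (suc N) ≡ P N · absᵣ (𝕢 (ι 2) · S (x (suc N)))
  P-suc′ N = trans (sym (P-def (suc N))) (trans (∏-suc N factor)
    (trans (·-def (∏ N factor) (factor (suc N))) (cong₂ _·_ (P-def N) (factor-def (suc N)))))

  P-suc : ∀ N → P (suc N) ≃ P N · (𝕢 (ι 2) · S (x (suc N)))
  P-suc N = ≃-trans (≃-reflexive (P-suc′ N)) (*-cong ≃-refl (≃-sym (0≼⇒≃∣∣
    (*-mono-0≼ (≺⇒≼ 0≺𝕢2) (0≼S (0≤x N) (x<1 N))))))

  0≼P : ∀ N → 0# ≼ P N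
  0≼P zero    = ≼-trans (≺⇒≼ 0≺1) (≃⇒≼ (≃-sym P-0))
  0≼P (suc N) = ≼-trans (*-mono-0≼ (0≼P N) (*-mono-0≼ (≺⇒≼ 0≺𝕢2) (0≼S (0≤x N) (x<1 N)))) (≃⇒≼ (≃-sym (P-suc N)))

  -- The factor at 1 is 2. The factors at 2n and 2n + 1 multiply to 4 S(xₙ / 2) C(xₙ / 2) = 2 S(xₙ),
  -- the factor at n.
  P-odd : ∀ N → P (suc (double N)) ≃ 𝕢 (ι 2) · P N
  P-odd zero = begin-equality
    P 1                          ≈⟨ P-suc 0 ⟩
    P 0 · (𝕢 (ι 2) · S ½)        ≈⟨ *-cong ≃-refl (*-cong ≃-refl S½≃1) ⟩
    P 0 · (𝕢 (ι 2) · 1#)         ≈⟨ ring 1 (λ p → p ⊗ (κ (ι 2) ⊗ κ 1ℚ) ⊜ κ (ι 2) ⊗ p) ≃-refl (P 0) ⟩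
    𝕢 (ι 2) · P 0                ∎
    where open ≼-Reasoning
  P-odd (suc N) = begin-equality
    P (suc (double (suc N)))
      ≈⟨ ≃-trans (P-suc (double (suc N))) (*-cong (P-suc (suc (double N))) ≃-refl) ⟩
    P (suc (double N)) · (𝕢 (ι 2) · S (x (double (suc N)))) · (𝕢 (ι 2) · S (x (suc (double (suc N)))))
      ≈⟨ *-cong (*-cong (P-odd N) (*-cong ≃-refl (≃-reflexive (cong S (vdc-even (suc N))))))
           (*-cong ≃-refl (≃-trans (≃-reflexive (cong S (vdc-odd (suc N)))) (S[½+] (½ * x (suc N))))) ⟩
    𝕢 (ι 2) · P N · (𝕢 (ι 2) · s) · (𝕢 (ι 2) · c)
      ≈⟨ ring 3 (λ p s c → κ (ι 2) ⊗ p ⊗ (κ (ι 2) ⊗ s) ⊗ (κ (ι 2) ⊗ c) ⊜ κ (ι 2) ⊗ (p ⊗ (κ (ι 2) ⊗ (κ (ι 2) ⊗ (s ⊗ c))))) ≃-refl (P N) s c ⟩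
    𝕢 (ι 2) · (P N · (𝕢 (ι 2) · (𝕢 (ι 2) · (s · c))))
      ≈⟨ *-cong ≃-refl (≃-trans (P-suc N) (*-cong ≃-refl (*-cong ≃-refl (S-double (x (suc N)))))) ⟨
    𝕢 (ι 2) · P (suc N) ∎
    where
    open ≼-Reasoning
    s = S (½ * x (suc N))
    c = C (½ * x (suc N))

  -- The product over 1 ≤ n < Q; the recursion below is in the binary digits of Q.
  q : ℕ → ℝ
  q Q = P (ℕ.pred Q)

  0≼q : ∀ Q → 0# ≼ q Q
  0≼q Q = 0≼P (ℕ.pred Q)

  q-even : ∀ N → q (double (suc N)) ≃ 𝕢 (ι 2) · q (suc N)
  q-even = P-odd

  q-odd : ∀ N → q (suc (double (suc N))) ≃ 𝕢 (ι 4) · (S (½ * x (suc N)) · q (suc N))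
  q-odd N = begin-equality
    P (double (suc N))
      ≈⟨ P-suc (suc (double N)) ⟩
    P (suc (double N)) · (𝕢 (ι 2) · S (x (double (suc N))))
      ≈⟨ *-cong (P-odd N) (*-cong ≃-refl (≃-reflexive (cong S (vdc-even (suc N))))) ⟩
    𝕢 (ι 2) · P N · (𝕢 (ι 2) · s)
      ≈⟨ ring 2 (λ p s → κ (ι 2) ⊗ p ⊗ (κ (ι 2) ⊗ s) ⊜ κ (ι 4) ⊗ (s ⊗ p)) ≃-refl (P N) s ⟩
    𝕢 (ι 4) · (s · P N) ∎
    where
    open ≼-Reasoning
    s = S (½ * x (suc N))

  q-2^ : ∀ n → q (suc (ones n)) ≃ 𝕢 (ι (suc (ones n)))
  q-2^ zero    = P-0
  q-2^ (suc n) = ≃-trans (q-even (ones n)) (≃-trans (*-cong ≃-refl (q-2^ n))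
    (≃-trans (≃-sym (𝕢-· (ι 2) (ι (suc (ones n))))) (≃-reflexive (cong 𝕢 (sym (ι-double (suc (ones n))))))))

  -- The product `q` at 2ⁿ⁺¹ has the value 2ⁿ⁺¹, and its last factor has the index 2ⁿ⁺¹ - 1, where
  -- the sequence is 1 - 2⁻ⁿ⁻¹; the sine there is reflected to 2⁻ⁿ⁻¹.
  q-ones : ∀ n → q (ones (suc n)) · (𝕢 (ι 2) · S (½ ^ℚ suc n)) ≃ 𝕢 (ι (suc (ones (suc n))))
  q-ones n = begin-equality
    q (ones (suc n)) · (𝕢 (ι 2) · S (½ ^ℚ suc n))
      ≈⟨ *-cong ≃-refl (*-cong ≃-refl (S-reflect (½ ^ℚ suc n))) ⟨
    P (double (ones n)) · (𝕢 (ι 2) · S (1ℚ - ½ ^ℚ suc n))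
      ≡⟨ cong (λ t → P (double (ones n)) · (𝕢 (ι 2) · S t)) (sym (vdc-ones (suc n))) ⟩
    P (double (ones n)) · (𝕢 (ι 2) · S (x (ones (suc n))))
      ≈⟨ P-suc (double (ones n)) ⟨
    q (suc (ones (suc n)))
      ≈⟨ q-2^ (suc n) ⟩
    𝕢 (ι (suc (ones (suc n)))) ∎
    where open ≼-Reasoning

  -- Unlike q, this is unchanged by a final binary digit 0 of Q; a final digit 1
  -- at least doubles it.
  h : ℕ → ℝ
  h Q = 𝕢 (ι 2 * x Q) · q Q

  h-even : ∀ N → h (double (suc N)) ≃ h (suc N)
  h-even N = begin-equality
    𝕢 (ι 2 * x (double (suc N))) · q (double (suc N))
      ≈⟨ *-cong (≃-trans (≃-reflexive (cong 𝕢 (trans (cong (ι 2 *_) (vdc-even (suc N)))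
           (solve 1 (λ x → con (ι 2) :* (con ½ :* x) := con ½ :* (con (ι 2) :* x)) refl (x (suc N))))))
           (𝕢-· ½ (ι 2 * x (suc N)))) (q-even N) ⟩
    𝕢 ½ · 𝕢 (ι 2 * x (suc N)) · (𝕢 (ι 2) · q (suc N))
      ≈⟨ ring 2 (λ a b → κ ½ ⊗ a ⊗ (κ (ι 2) ⊗ b) ⊜ a ⊗ b) ≃-refl (𝕢 (ι 2 * x (suc N))) (q (suc N)) ⟩
    h (suc N) ∎
    where open ≼-Reasoning

  2h≼q-odd : ∀ N → 𝕢 (ι 2) · h (suc N) ≼ q (suc (double (suc N)))
  2h≼q-odd N = begin
    𝕢 (ι 2) · (𝕢 (ι 2 * x (suc N)) · q (suc N))
      ≈⟨ *-cong ≃-refl (*-cong (𝕢-· (ι 2) (x (suc N))) ≃-refl) ⟩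
    𝕢 (ι 2) · (𝕢 (ι 2) · 𝕢 (x (suc N)) · q (suc N))
      ≈⟨ ring 2 (λ a b → κ (ι 2) ⊗ (κ (ι 2) ⊗ a ⊗ b) ⊜ κ (ι 4) ⊗ (a ⊗ b)) ≃-refl (𝕢 (x (suc N))) (q (suc N)) ⟩
    𝕢 (ι 4) · (𝕢 (x (suc N)) · q (suc N))
      ≤⟨ *-monoʳ-≼ (0≼𝕢 (0≤ι 4)) (*-monoˡ-≼ (0≼q (suc N)) (S[½x]≽x N)) ⟩
    𝕢 (ι 4) · (S (½ * x (suc N)) · q (suc N))
      ≈⟨ q-odd N ⟨
    q (suc (double (suc N))) ∎
    where open ≼-Reasoning

  2h≼h-odd : ∀ N → 𝕢 (ι 2) · h (suc N) ≼ h (suc (double (suc N)))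
  2h≼h-odd N = begin
    𝕢 (ι 2) · h (suc N)                       ≤⟨ 2h≼q-odd N ⟩
    q Q                                       ≈⟨ ring 1 (λ q → q ⊜ κ 1ℚ ⊗ q) ≃-refl (q Q) ⟩
    1# · q Q                                  ≤⟨ *-monoˡ-≼ (0≼q Q) (𝕢-mono 1≤2x) ⟩
    h Q                                       ∎
    where
    open ≼-Reasoning
    Q = suc (double (suc N))
    -- The last digit 1 of `Q` contributes ½ to `x Q`, so `h Q` is at least `q Q`.
    1≤2x : 1ℚ ≤ ι 2 * x Q
    1≤2x = subst (1ℚ ≤_) (trans (solve 1 (λ x → con 1ℚ :+ x := con (ι 2) :* (con ½ :+ con ½ :* x)) refl (x (suc N)))
      (cong (ι 2 *_) (sym (vdc-odd (suc N))))) (subst (_≤ 1ℚ + x (suc N)) (+-identityʳ 1ℚ) (+-monoʳ-≤ 1ℚ (0≤x N)))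

  2·-mono : ∀ {p y} → 𝕢 p ≼ y → 𝕢 (ι 2 * p) ≼ 𝕢 (ι 2) · y
  2·-mono {p} le = ≼-trans (≃⇒≼ (𝕢-· (ι 2) p)) (*-monoʳ-≼ (≺⇒≼ 0≺𝕢2) le)

  1≼h : ∀ {Q} → Binary Q → 1# ≼ h Q
  1≼h 1ᵇ           = ≃⇒≼ (≃-trans (≃-sym P-0) (ring 1 (λ p → p ⊜ κ 1ℚ ⊗ p) ≃-refl (P 0)))
  1≼h (2ᵇ_ {n} b)  = ≼-trans (1≼h b) (≃⇒≼ (≃-sym (h-even n)))
  1≼h (2ᵇ+1 {n} b) = ≼-trans (𝕢-mono {1ℚ} {ι 2 * 1ℚ} (≤ᵇ⇒≤ _)) (≼-trans (2·-mono (1≼h b)) (2h≼h-odd n))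

  -- `h` is at least 1 at the leading digit, and any further digit 1 doubles it; a `Q` without a
  -- further 1 is a power of two.
  2≼h : ∀ {Q} → Binary Q → (∃ λ k → Q ≡ suc (ones k)) ⊎ 𝕢 (ι 2) ≼ h Q
  2≼h 1ᵇ           = inj₁ (0 , refl)
  2≼h (2ᵇ_ {n} b)  = Sum.map (λ (k , eq) → suc k , cong double eq)
    (λ le → ≼-trans le (≃⇒≼ (≃-sym (h-even n)))) (2≼h b)
  2≼h (2ᵇ+1 {n} b) = inj₂ (≼-trans (𝕢-mono {ι 2} {ι 2 * 1ℚ} (≤ᵇ⇒≤ _)) (≼-trans (2·-mono (1≼h b)) (2h≼h-odd n)))

  2≼q : ∀ {Q} → Binary Q → Q ≡ 1 ⊎ 𝕢 (ι 2) ≼ q Q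
  2≼q 1ᵇ = inj₁ refl
  2≼q (2ᵇ_ {n} b) = inj₂ (≼-trans
    (Sum.[ (λ { refl → ≼-trans (𝕢-mono {ι 2} {ι 2 * 1ℚ} (≤ᵇ⇒≤ _)) (2·-mono (≃⇒≼ (≃-sym P-0))) })
         , (λ le → ≼-trans (𝕢-mono {ι 2} {ι 2 * ι 2} (≤ᵇ⇒≤ _)) (2·-mono le)) ]′ (2≼q b))
    (≃⇒≼ (≃-sym (q-even n))))
  2≼q (2ᵇ+1 {n} b) = inj₂ (≼-trans (≼-trans (𝕢-mono {ι 2} {ι 2 * 1ℚ} (≤ᵇ⇒≤ _)) (2·-mono (1≼h b))) (2h≼q-odd n))

  -- An even argument doubles a product that is at least 2 unless its half is 1. An odd one gives at
  -- least twice the `h` of the remaining digits, which is at least 2 unless these form a power of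
  -- two.
  4≼q : ∀ {Q} → Binary Q → Q ℕ.≤ 2 ⊎ (∃ λ k → Q ≡ suc (suc (ones (suc k)))) ⊎ 𝕢 (ι 4) ≼ q Q
  4≼q 1ᵇ           = inj₁ (ℕ.s≤s ℕ.z≤n)
  4≼q (2ᵇ_ {n} b)  = Sum.map (λ { refl → ℕₚ.≤-refl })
    (λ le → inj₂ (≼-trans (≼-trans (𝕢-mono {ι 4} {ι 2 * ι 2} (≤ᵇ⇒≤ _)) (2·-mono le)) (≃⇒≼ (≃-sym (q-even n))))) (2≼q b)
  4≼q (2ᵇ+1 {n} b) = inj₂ (Sum.map (λ (k , eq) → k , cong (suc ∘ double) eq)
    (λ le → ≼-trans (≼-trans (𝕢-mono {ι 4} {ι 2 * ι 2} (≤ᵇ⇒≤ _)) (2·-mono le)) (2h≼q-odd n)) (2≼h b))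

  -- Upper bounds for q(Q) / Q²

  q≼2· : ∀ N {v} → q (suc N) ≼ 𝕢 v → q (double (suc N)) ≼ 𝕢 (ι 2 * v)
  q≼2· N {v} le = ≼-trans (≃⇒≼ (q-even N)) (≼-trans (*-monoʳ-≼ (≺⇒≼ 0≺𝕢2) le) (≃⇒≼ (≃-sym (𝕢-· (ι 2) v))))

  q-odd≼ : ∀ N {s v} → 0ℚ ≤ s → S (½ * x (suc N)) ≼ 𝕢 s → q (suc N) ≼ 𝕢 v → q (suc (double (suc N))) ≼ 𝕢 (ι 4 * (s * v))
  q-odd≼ N {s} {v} 0≤s S≼s q≼v = ≼-trans (≃⇒≼ (q-odd N))
    (≼-trans (*-monoʳ-≼ (0≼𝕢 (0≤ι 4)) (*-mono-≼ (0≼q (suc N)) (0≼𝕢 0≤s) S≼s q≼v))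
      (≃⇒≼ (≃-sym (≃-trans (𝕢-· (ι 4) (s * v)) (*-cong ≃-refl (𝕢-· s v))))))

  q≼4· : ∀ N {v} → q (suc N) ≼ 𝕢 v → q (suc (double (suc N))) ≼ 𝕢 (ι 4 * (1ℚ * v))
  q≼4· N = q-odd≼ N (nonNegative⁻¹ 1ℚ) (S≼1 (½ * x (suc N)))

  S≼16/5· : ∀ {r} → 0ℚ ≤ r → r ≤ ¼ → S r ≼ 𝕢 (16/5 * r)
  S≼16/5· {r} 0≤r r≤¼ = ≼-trans (S≼π· 0≤r r≤¼) (≼-trans (*-monoˡ-≼ (0≼𝕢 0≤r) π≼16/5) (≃⇒≼ (≃-sym (𝕢-· 16/5 r))))

  q1≼ : q 1 ≼ 𝕢 1ℚ
  q1≼ = ≃⇒≼ P-0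

  q2≼ : q 2 ≼ 𝕢 (ι 2)
  q2≼ = q≼2· 0 q1≼

  q4≼ : q 4 ≼ 𝕢 (ι 4)
  q4≼ = q≼2· 1 q2≼

  -- 3, 5 and 9 are 2ᵏ + 1 for k = 1, 2, 3, where the bound 4 · (16/5 · 2⁻ᵏ⁻¹) · 2ᵏ⁻¹ is always
  -- 16/5.
  q3≼ : q 3 ≼ 𝕢 16/5
  q3≼ = q-odd≼ 0 {16/5 * ¼} (≤ᵇ⇒≤ _) (S≼16/5· {¼} (≤ᵇ⇒≤ _) (≤ᵇ⇒≤ _)) q1≼

  q5≼ : q 5 ≼ 𝕢 16/5
  q5≼ = q-odd≼ 1 {16/5 * (½ * ¼)} (≤ᵇ⇒≤ _) (S≼16/5· {½ * ¼} (≤ᵇ⇒≤ _) (≤ᵇ⇒≤ _)) q2≼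

  q9≼ : q 9 ≼ 𝕢 16/5
  q9≼ = q-odd≼ 3 {16/5 * (¼ * ¼)} (≤ᵇ⇒≤ _) (S≼16/5· {¼ * ¼} (≤ᵇ⇒≤ _) (≤ᵇ⇒≤ _)) q4≼

  record Bounded (c : ℚ) (Q : ℕ) : Set where
    constructor bounded
    field q≼c·Q² : q Q ≼ 𝕢 (c * (ι Q * ι Q))
  open Bounded public

  bounded-even : ∀ {c} N → Bounded c (suc N) → Bounded (½ * c) (double (suc N))
  bounded-even {c} N (bounded le) = bounded (≼-trans (q≼2· N le) (𝕢-mono (≤-reflexive
    (trans (solve 2 (λ c n → con (ι 2) :* (c :* (n :* n)) := con ½ :* c :* ((con (ι 2) :* n) :* (con (ι 2) :* n))) refl c (ι (suc N)))
      (cong (λ t → ½ * c * (t * t)) (sym (ι-double (suc N))))))))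

  bounded-odd : ∀ {c} N → 0ℚ ≤ c → Bounded c (suc N) → Bounded c (suc (double (suc N)))
  bounded-odd {c} N 0≤c (bounded le) = bounded (≼-trans (q≼4· N le) (𝕢-mono (≤-trans (≤-reflexive
    (trans (solve 2 (λ c n → con (ι 4) :* (con 1ℚ :* (c :* (n :* n))) := c :* ((con (ι 2) :* n) :* (con (ι 2) :* n))) refl c (ι (suc N)))
      (cong (λ t → c * (t * t)) (sym (ι-double (suc N))))))
    (*-monoʳ-≤′ 0≤c (*-mono-≤′ {ι (double (suc N))} (0≤ι (double (suc N))) (0≤ι (suc (double (suc N)))) up up)))))
    where
    up : ι (double (suc N)) ≤ ι (suc (double (suc N)))
    up = ι-mono-≤ (ℕₚ.n≤1+n (double (suc N)))

  bounded-weaken : ∀ {c d Q} → c ≤ d → Bounded c Q → Bounded d Q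
  bounded-weaken {Q = Q} c≤d (bounded le) = bounded (≼-trans le (𝕢-mono (*-monoˡ-≤′ (*-mono-0≤ (0≤ι Q) (0≤ι Q)) c≤d)))

  -- 5/32 is 1 / (2 · 16/5), hence at most 1 / 2π. Its double 5/16 is what a final digit 0 halves to
  -- 5/32.
  5/32 5/16 : ℚ
  5/32 = + 5 / 32
  5/16 = + 5 / 16

  -- The seeds of the induction are 7 to 13, the numbers from 7 on whose half, rounded down, is
  -- below 7. A start at 4 would fail, as q(4) / 4² = 1/4 exceeds 5/32.
  small-even : ∀ {N} → N ℕ.< 6 → 7 ℕ.≤ double (suc N) → Bounded 5/32 (double (suc N))
  small-even {0} _ (ℕ.s≤s (ℕ.s≤s ()))
  small-even {1} _ (ℕ.s≤s (ℕ.s≤s (ℕ.s≤s (ℕ.s≤s ()))))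
  small-even {2} _ (ℕ.s≤s (ℕ.s≤s (ℕ.s≤s (ℕ.s≤s (ℕ.s≤s (ℕ.s≤s ()))))))
  small-even {3} _ _ = bounded (≼-trans (q≼2· 3 q4≼) (𝕢-mono {ι 2 * ι 4} (≤ᵇ⇒≤ _)))
  small-even {4} _ _ = bounded (≼-trans (q≼2· 4 q5≼) (𝕢-mono {ι 2 * 16/5} (≤ᵇ⇒≤ _)))
  small-even {5} _ _ = bounded (≼-trans (q≼2· 5 (q≼2· 2 q3≼)) (𝕢-mono {ι 2 * (ι 2 * 16/5)} (≤ᵇ⇒≤ _)))
  small-even {suc (suc (suc (suc (suc (suc _)))))} (ℕ.s≤s (ℕ.s≤s (ℕ.s≤s (ℕ.s≤s (ℕ.s≤s (ℕ.s≤s ())))))) _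

  -- Numbers 2ⁿ - 1 cannot obey 5/32 in the long run, since their quotients tend to 1 / 2π > 5/32.
  -- Their bound 5/16 serves twice: it covers the case that a digit 0 follows, and it controls the
  -- cubic error in `q-ones≼`.
  OnesOrSmall : ℕ → Set
  OnesOrSmall Q = (∃ λ n → Q ≡ ones (suc n) × Bounded 5/16 Q) ⊎ Bounded 5/32 Q

  small-odd : ∀ {N} → N ℕ.< 6 → 7 ℕ.≤ suc (double (suc N)) → OnesOrSmall (suc (double (suc N)))
  small-odd {0} _ (ℕ.s≤s (ℕ.s≤s (ℕ.s≤s ())))
  small-odd {1} _ (ℕ.s≤s (ℕ.s≤s (ℕ.s≤s (ℕ.s≤s (ℕ.s≤s ())))))
  small-odd {2} _ _ = inj₁ (2 , refl , bounded (≼-trans (q≼4· 2 q3≼) (𝕢-mono {ι 4 * (1ℚ * 16/5)} (≤ᵇ⇒≤ _))))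
  small-odd {3} _ _ = inj₂ (bounded (≼-trans q9≼ (𝕢-mono {16/5} (≤ᵇ⇒≤ _))))
  small-odd {4} _ _ = inj₂ (bounded (≼-trans (q≼4· 4 q5≼) (𝕢-mono {ι 4 * (1ℚ * 16/5)} (≤ᵇ⇒≤ _))))
  small-odd {5} _ _ = inj₂ (bounded (≼-trans (q≼4· 5 (q≼2· 2 q3≼)) (𝕢-mono {ι 4 * (1ℚ * (ι 2 * 16/5))} (≤ᵇ⇒≤ _))))
  small-odd {suc (suc (suc (suc (suc (suc _)))))} (ℕ.s≤s (ℕ.s≤s (ℕ.s≤s (ℕ.s≤s (ℕ.s≤s (ℕ.s≤s ())))))) _

  ones-or-small : ∀ {Q} → Binary Q → 7 ℕ.≤ Q → OnesOrSmall Q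
  ones-or-small 1ᵇ (ℕ.s≤s ())
  ones-or-small (2ᵇ_ {n} b) 7≤Q with 7 ℕ.≤? suc n
  ... | no 7≰n = inj₂ (small-even (ℕ.s≤s⁻¹ (ℕₚ.≰⇒> 7≰n)) 7≤Q)
  ... | yes 7≤n with ones-or-small b 7≤n
  ...   | inj₁ (_ , _ , le) = inj₂ (bounded-even {5/16} n le)
  ...   | inj₂ le           = inj₂ (bounded-weaken {½ * 5/32} {5/32} {double (suc n)} (≤ᵇ⇒≤ _) (bounded-even {5/32} n le))
  ones-or-small (2ᵇ+1 {n} b) 7≤Q with 7 ℕ.≤? suc n
  ... | no 7≰n = small-odd (ℕ.s≤s⁻¹ (ℕₚ.≰⇒> 7≰n)) 7≤Q
  ... | yes 7≤n with ones-or-small b 7≤n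
  ...   | inj₁ (k , eq , le) = inj₁ (suc k , cong (suc ∘ double) eq , bounded-odd {5/16} n (≤ᵇ⇒≤ _) le)
  ...   | inj₂ le            = inj₂ (bounded-odd {5/32} n (≤ᵇ⇒≤ _) le)

-- Upper and lower limits

opaque
  unfolding _⊔ᵣ_ _+ᵣ_ 𝕢

  x≼x⊔y : ∀ x y → x ≼ x ⊔ᵣ y
  x≼x⊔y x y = ≼-pointwise λ n → p≤p⊔q (seq x n) (seq y n)

  y≼x⊔y : ∀ x y → y ≼ x ⊔ᵣ y
  y≼x⊔y x y = ≼-pointwise λ n → p≤q⊔p (seq x n) (seq y n)

  ⊔ᵣ-lub : ∀ {x y z} → x ≼ z → y ≼ z → x ⊔ᵣ y ≼ z
  ⊔ᵣ-lub ⟪ f ⟫ ⟪ g ⟫ = ≼-intro λ ε 0<ε → Ev-zip (λ n a b → ⊔-lub (<⇒≤ a) (<⇒≤ b)) (f ε 0<ε) (g ε 0<ε)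

  -- At one index beyond all moduli the rational maximum is one of its two arguments; `≺-at` carries
  -- the gap from there to the real.
  ≺⊔⇒ : ∀ {x y z} → z ≺ x ⊔ᵣ y → z ≺ x ⊎ z ≺ y
  ≺⊔⇒ {x} {y} {z} ⟪ ε , 0<ε , N , h ⟫ =
    let L , f = ≺-at z x 0<ε
        M , g = ≺-at z y 0<ε
    in decide (L ℕ.⊔ M) (f _ (ℕₚ.≤-trans (ℕₚ.m≤m⊔n L M) (ℕₚ.m≤n⊔m N (L ℕ.⊔ M))))
         (g _ (ℕₚ.≤-trans (ℕₚ.m≤n⊔m L M) (ℕₚ.m≤n⊔m N (L ℕ.⊔ M))))
    where
    decide : ∀ K → (seq z (N ℕ.⊔ K) + ε < seq x (N ℕ.⊔ K) → z ≺ x) → (seq z (N ℕ.⊔ K) + ε < seq y (N ℕ.⊔ K) → z ≺ y) → z ≺ x ⊎ z ≺ y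
    decide K f g with ⊔-sel (seq x (N ℕ.⊔ K)) (seq y (N ℕ.⊔ K))
    ... | inj₁ eq = inj₁ (f (subst (seq z (N ℕ.⊔ K) + ε <_) eq (h (N ℕ.⊔ K) (ℕₚ.m≤m⊔n N K))))
    ... | inj₂ eq = inj₂ (g (subst (seq z (N ℕ.⊔ K) + ε <_) eq (h (N ℕ.⊔ K) (ℕₚ.m≤m⊔n N K))))

  ≼-ε : ∀ {x y} → (∀ ε → 0ℚ < ε → x ≼ y +ᵣ 𝕢 ε) → x ≼ y
  ≼-ε {x} {y} h = ≼-intro λ ε 0<ε → Ev-map
    (λ n a → <⇒≤ (subst (seq x n <_) (trans (+-assoc (seq y n) (½ * ε) (½ * ε)) (cong (λ z → seq y n + z) (½+½ ε))) a))
    (≼⇒≤ (h (½ * ε) (0<½* 0<ε)) (½ * ε) (0<½* 0<ε))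

  approximation : ∀ x ε → 0ℚ < ε → Eventually λ i → 𝕢 (seq x i) ≼ x +ᵣ 𝕢 ε × x ≼ 𝕢 (seq x i) +ᵣ 𝕢 ε
  approximation x ε 0<ε = let N , h = cauchy x ε 0<ε in
    N , λ i N≤i → ≼-eventually (N , λ j N≤j → <⇒≤ (∣p-q∣<⇒ {seq x i} (h i j N≤i N≤j))) ,
                  ≼-eventually (N , λ j N≤j → <⇒≤ (∣p-q∣<⇒ {seq x j} (h j i N≤j N≤i)))

0<½^ : ∀ n → 0ℚ < ½ ^ℚ n
0<½^ zero    = positive⁻¹ 1ℚ
0<½^ (suc n) = 0<½* (0<½^ n)

+𝕢-assoc : ∀ x p r → x +ᵣ 𝕢 p +ᵣ 𝕢 r ≃ x +ᵣ 𝕢 (p + r)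
+𝕢-assoc x p r = ≃-trans (+ᵣ-assoc x (𝕢 p) (𝕢 r)) (+-cong ≃-refl (≃-sym (𝕢-+ p r)))

+𝕢-mono : ∀ {x y p r} → x ≼ y → p ≤ r → x +ᵣ 𝕢 p ≼ y +ᵣ 𝕢 r
+𝕢-mono x≼y p≤r = +-mono-≼ x≼y (𝕢-mono p≤r)

x+ε≼⇒ : ∀ {x y z p r} → x ≼ y +ᵣ 𝕢 p → y ≼ z +ᵣ 𝕢 r → x ≼ z +ᵣ 𝕢 (r + p)
x+ε≼⇒ {z = z} {p} {r} f g = ≼-trans f (≼-trans (+-mono-≼ g ≼-refl) (≃⇒≼ (+𝕢-assoc z r p)))

-- A monotone bounded sequence need not converge constructively, so `bounded` supplies a modulus for
-- the further rise of `X`. The limit is a diagonal sequence: its jth term is a rational within ½ʲ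
-- of `X j`.
module MonotoneLimit (X : ℕ → ℝ) (mono : ∀ {i j} → i ℕ.≤ j → X i ≼ X j)
  (bounded : ∀ ε → 0ℚ < ε → ∃ λ M → ∀ {i j} → M ℕ.≤ i → i ℕ.≤ j → X j ≼ X i +ᵣ 𝕢 ε) where

  private
    index : ℕ → ℕ
    index j = proj₁ (approximation (X j) (½ ^ℚ j) (0<½^ j))

    s : ℕ → ℚ
    s j = seq (X j) (index j)

    s≼X : ∀ j → 𝕢 (s j) ≼ X j +ᵣ 𝕢 (½ ^ℚ j)
    s≼X j = proj₁ (proj₂ (approximation (X j) (½ ^ℚ j) (0<½^ j)) (index j) ℕₚ.≤-refl)

    X≼s : ∀ j → X j ≼ 𝕢 (s j) +ᵣ 𝕢 (½ ^ℚ j)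
    X≼s j = proj₂ (proj₂ (approximation (X j) (½ ^ℚ j) (0<½^ j)) (index j) ℕₚ.≤-refl)

    s-cauchy : IsCauchy s
    -- One ε for the approximation at either index, and one for the rise of `X` between them.
    s-cauchy = cauchy-scaled s (ι 3) (0≤ι 3) λ ε 0<ε →
      let M , h = bounded ε 0<ε
          N , g = ½^n-small ε 0<ε
          close : ∀ i j → M ℕ.⊔ N ℕ.≤ i → M ℕ.⊔ N ℕ.≤ j → i ℕ.≤ j → ∣ s i - s j ∣ ≤ ι 3 * ε
          close i j ≤i ≤j i≤j =
            let ei = g i (ℕₚ.m⊔n≤o⇒n≤o M N ≤i)
                ej = g j (ℕₚ.m⊔n≤o⇒n≤o M N ≤j)
                up : 𝕢 (s j) ≼ 𝕢 (s i) +ᵣ 𝕢 (ι 3 * ε)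
                up = ≼-trans (x+ε≼⇒ (x+ε≼⇒ (s≼X j) (h (ℕₚ.m⊔n≤o⇒m≤o M N ≤i) i≤j)) (X≼s i))
                  (+𝕢-mono ≼-refl (≤-trans (+-mono-≤ ei (+-mono-≤ (≤-refl {ε}) ej))
                    (≤-reflexive (solve 1 (λ e → e :+ (e :+ e) := con (ι 3) :* e) refl ε))))
                down : 𝕢 (s i) ≼ 𝕢 (s j) +ᵣ 𝕢 (ι 3 * ε)
                down = ≼-trans (x+ε≼⇒ (≼-trans (s≼X i) (+-mono-≼ (mono i≤j) ≼-refl)) (X≼s j))
                  (+𝕢-mono ≼-refl (≤-trans (+-mono-≤ ej ei) (≤-trans
                    (subst (_≤ ε + ε + ε) (+-identityʳ (ε + ε)) (+-monoʳ-≤ (ε + ε) (<⇒≤ 0<ε)))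
                    (≤-reflexive (solve 1 (λ e → e :+ e :+ e := con (ι 3) :* e) refl ε)))))
            in ⇒∣p-q∣≤ (𝕢-cancel (≼-trans down (≃⇒≼ (≃-sym (𝕢-+ (s j) (ι 3 * ε))))))
                       (𝕢-cancel (≼-trans up (≃⇒≼ (≃-sym (𝕢-+ (s i) (ι 3 * ε))))))
      in M ℕ.⊔ N , λ i j ≤i ≤j → either i j (close i j ≤i ≤j) (close j i ≤j ≤i)
      where
      either : ∀ i j {E} → (i ℕ.≤ j → ∣ s i - s j ∣ ≤ E) → (j ℕ.≤ i → ∣ s j - s i ∣ ≤ E) → ∣ s i - s j ∣ ≤ E
      either i j f g with ℕₚ.≤-total i j
      ... | inj₁ i≤j = f i≤j
      ... | inj₂ j≤i = subst (_≤ _) (∣p-q∣≡∣q-p∣ (s j) (s i)) (g j≤i)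

  opaque
    lim : ℝ
    lim = mkℝ s s-cauchy

    private
      s≈lim : ∀ ε → 0ℚ < ε → Eventually λ i → 𝕢 (s i) ≼ lim +ᵣ 𝕢 ε × lim ≼ 𝕢 (s i) +ᵣ 𝕢 ε
      s≈lim = approximation lim

  private
    X≈lim : ∀ ε → 0ℚ < ε → Eventually λ i → X i ≼ lim +ᵣ 𝕢 (ε + ε) × lim ≼ X i +ᵣ 𝕢 (ε + ε)
    X≈lim ε 0<ε = Ev-zip
      (λ i (a , b) e → x+ε≼⇒ (≼-trans (X≼s i) (+𝕢-mono ≼-refl e)) a ,
                       x+ε≼⇒ b (≼-trans (s≼X i) (+𝕢-mono ≼-refl e)))
      (s≈lim ε 0<ε) (½^n-small ε 0<ε)

  X≼lim : ∀ j → X j ≼ lim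
  X≼lim j = ≼-ε λ ε 0<ε → let N , h = X≈lim (½ * ε) (0<½* 0<ε) in
    ≼-trans (mono (ℕₚ.m≤m⊔n j N)) (≼-trans (proj₁ (h (j ℕ.⊔ N) (ℕₚ.m≤n⊔m j N)))
      (+𝕢-mono ≼-refl (≤-reflexive (½+½ ε))))

  lim≼X+ : ∀ ε → 0ℚ < ε → ∃ λ j → lim ≼ X j +ᵣ 𝕢 ε
  lim≼X+ ε 0<ε = let N , h = X≈lim (½ * ε) (0<½* 0<ε) in
    N , ≼-trans (proj₂ (h N ℕₚ.≤-refl)) (+𝕢-mono ≼-refl (≤-reflexive (½+½ ε)))

  lim≼ : ∀ {z} → (∀ j → X j ≼ z) → lim ≼ z
  lim≼ h = ≼-ε λ ε 0<ε → let j , le = lim≼X+ ε 0<ε in ≼-trans le (+-mono-≼ (h j) ≼-refl)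

-- One half of the gap pays for an approximation error, the other half remains as the witness of
-- strictness.
≺⇒half-gap : ∀ {x y} → x ≺ y → ∃ λ ε → 0ℚ < ε × ∀ {z} → (y ≼ z +ᵣ 𝕢 ε → x ≺ z) × (z ≼ x +ᵣ 𝕢 ε → z ≺ y)
≺⇒half-gap {x} {y} x≺y = let ε , 0<ε , h = ≺⇒gap x≺y ; δ = ½ * ε ; 0<δ = 0<½* 0<ε in
  δ , 0<δ , λ {z} →
    (λ y≼z+δ → gap⇒≺ 0<δ (cancel (begin
      x +ᵣ 𝕢 δ +ᵣ 𝕢 δ      ≈⟨ +𝕢-assoc x δ δ ⟩
      x +ᵣ 𝕢 (δ + δ)       ≡⟨ cong (λ t → x +ᵣ 𝕢 t) (½+½ ε) ⟩
      x +ᵣ 𝕢 ε             ≤⟨ h ⟩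
      y                    ≤⟨ y≼z+δ ⟩
      z +ᵣ 𝕢 δ             ∎))) ,
    (λ z≼x+δ → gap⇒≺ 0<δ (begin
      z +ᵣ 𝕢 δ             ≤⟨ +-mono-≼ z≼x+δ ≼-refl ⟩
      x +ᵣ 𝕢 δ +ᵣ 𝕢 δ      ≈⟨ +𝕢-assoc x δ δ ⟩
      x +ᵣ 𝕢 (δ + δ)       ≡⟨ cong (λ t → x +ᵣ 𝕢 t) (½+½ ε) ⟩
      x +ᵣ 𝕢 ε             ≤⟨ h ⟩
      y                    ∎))
  where
  open ≼-Reasoning
  cancel : ∀ {x z δ} → x +ᵣ 𝕢 δ ≼ z +ᵣ 𝕢 δ → x ≼ z
  cancel {x} {z} {δ} le = ≼-by (≼⇒0≼- le) (ring 3 (λ x z d → z ⊕ d ⊖ (x ⊕ d) ⊜ z ⊖ x) ≃-refl x z (𝕢 δ))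

-- The supremum of a tail is the limit of the maxima of L and finitely many
-- terms; including L makes the rate of convergence explicit.
module Limsup (a : ℕ → ℝ) (L : ℝ)
  (eventually≼ : ∀ ε → 0ℚ < ε → Eventually λ m → a m ≼ L +ᵣ 𝕢 ε)
  (frequently≽ : ∀ n → ∃ λ k → L ≼ a (n ℕ.+ k)) where

  private
    X : ℕ → ℕ → ℝ
    X n zero    = L
    X n (suc j) = X n j ⊔ᵣ a (n ℕ.+ j)

    X-mono′ : ∀ n i k → X n i ≼ X n (k ℕ.+ i)
    X-mono′ n i zero    = ≼-refl
    X-mono′ n i (suc k) = ≼-trans (X-mono′ n i k) (x≼x⊔y _ _)

    X-mono : ∀ n {i j} → i ℕ.≤ j → X n i ≼ X n j
    X-mono n {i} {j} i≤j = subst (λ j → X n i ≼ X n j) (ℕₚ.m∸n+n≡m i≤j) (X-mono′ n i (j ℕ.∸ i))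

    X-bounded′ : ∀ n {ε M} → 0ℚ < ε → (∀ m → M ℕ.≤ m → a m ≼ L +ᵣ 𝕢 ε) →
      ∀ i k → M ℕ.≤ n ℕ.+ i → X n (k ℕ.+ i) ≼ X n i +ᵣ 𝕢 ε
    X-bounded′ n {ε} 0<ε h i zero    M≤ = ≼-trans (≃⇒≼ (ring 1 (λ x → x ⊜ x ⊕ κ 0ℚ) ≃-refl (X n i))) (+𝕢-mono ≼-refl (<⇒≤ 0<ε))
    -- The new term is at most L + ε, and L is `X n 0`, hence below `X n i`.
    X-bounded′ n {ε} 0<ε h i (suc k) M≤ = ⊔ᵣ-lub (X-bounded′ n 0<ε h i k M≤)
      (≼-trans (h (n ℕ.+ (k ℕ.+ i)) (ℕₚ.≤-trans M≤ (ℕₚ.+-monoʳ-≤ n (ℕₚ.m≤n+m i k)))) (+-mono-≼ (X-mono n {0} {i} ℕ.z≤n) ≼-refl))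

    X-bounded : ∀ n ε → 0ℚ < ε → ∃ λ M → ∀ {i j} → M ℕ.≤ i → i ℕ.≤ j → X n j ≼ X n i +ᵣ 𝕢 ε
    X-bounded n ε 0<ε = let M , h = eventually≼ ε 0<ε in M , λ {i} {j} M≤i i≤j →
      subst (λ j → X n j ≼ X n i +ᵣ 𝕢 ε) (ℕₚ.m∸n+n≡m i≤j)
        (X-bounded′ n 0<ε h i (j ℕ.∸ i) (ℕₚ.≤-trans M≤i (ℕₚ.m≤n+m i n)))

    module Tail n = MonotoneLimit (X n) (X-mono n) (X-bounded n)

    -- Including `L` in the maxima does not raise the supremum: by `frequently≽` some term of the
    -- tail is at least `L`.
    ≺X⇒ : ∀ n j {y} → y ≺ X n j → ∃ λ k → y ≺ a (n ℕ.+ k)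
    ≺X⇒ n zero    y≺L = let k , le = frequently≽ n in k , ≺-≼-trans y≺L le
    ≺X⇒ n (suc j) y≺X with ≺⊔⇒ y≺X
    ... | inj₁ y≺Xj = ≺X⇒ n j y≺Xj
    ... | inj₂ y≺aj = j , y≺aj

    isSup : ∀ n → IsSup (λ k → a (n ℕ.+ k)) (Tail.lim n)
    isSup n = (λ k → ≼⇒≤ (≼-trans (y≼x⊔y (X n k) (a (n ℕ.+ k))) (Tail.X≼lim n (suc k)))) , λ y y<s →
      let ε , 0<ε , gap = ≺⇒half-gap {y} {Tail.lim n} ⟪ y<s ⟫
          j , le = Tail.lim≼X+ n ε 0<ε
          k , y≺a = ≺X⇒ n j (proj₁ gap le)
      in k , ≺⇒< y≺a

    isInf : IsInf Tail.lim L
    isInf = (λ n → ≼⇒≤ (Tail.X≼lim n 0)) , λ y L<y →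
      let ε , 0<ε , gap = ≺⇒half-gap {L} {y} ⟪ L<y ⟫
          M , h = eventually≼ ε 0<ε
          X≼ = λ j → subst (λ i → X M i ≼ L +ᵣ 𝕢 ε) (ℕₚ.+-identityʳ j)
                 (X-bounded′ M 0<ε h 0 j (ℕₚ.m≤m+n M 0))
      in M , ≺⇒< (proj₂ gap (Tail.lim≼ M X≼))

  isLimsup : IsLimsup a L
  isLimsup = Tail.lim , isSup , isInf

-- Lower limits by negation

neg-≺ : ∀ {x y} → x ≺ y → -ᵣ y ≺ -ᵣ x
neg-≺ {x} {y} h = let ε , 0<ε , le = ≺⇒gap h in gap⇒≺ 0<ε (≼-by (≼⇒0≼- le)
  (ring 3 (λ x y e → y ⊖ (x ⊕ e) ⊜ ⊝ x ⊖ (⊝ y ⊕ e)) ≃-refl x y (𝕢 ε)))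

neg-neg : ∀ x → -ᵣ (-ᵣ x) ≃ x
neg-neg x = ring 1 (λ x → ⊝ (⊝ x) ⊜ x) ≃-refl x

neg≺⇒ : ∀ {x y} → -ᵣ x ≺ y → -ᵣ y ≺ x
neg≺⇒ {x} h = ≺-≼-trans (neg-≺ h) (≃⇒≼ (neg-neg x))

≺neg⇒ : ∀ {x y} → x ≺ -ᵣ y → y ≺ -ᵣ x
≺neg⇒ {x} {y} h = ≼-≺-trans (≃⇒≼ (≃-sym (neg-neg y))) (neg-≺ h)

neg≼⇒ : ∀ {x y} → -ᵣ x ≼ y → -ᵣ y ≼ x
neg≼⇒ {x} h = ≼-trans (neg-mono-≼ h) (≃⇒≼ (neg-neg x))

neg-isSup : ∀ (a : ℕ → ℝ) s → IsSup (λ k → -ᵣ a k) s → IsInf a (-ᵣ s)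
neg-isSup a s (below , approached) =
  (λ k → ≼⇒≤ (neg≼⇒ {a k} {s} ⟪ below k ⟫)) , λ y -s<y →
    let k , -y<-a = approached (-ᵣ y) (≺⇒< (neg≺⇒ {s} {y} ⟪ -s<y ⟫)) in
    k , ≺⇒< (≺-≼-trans (≺neg⇒ { -ᵣ y} {a k} ⟪ -y<-a ⟫) (≃⇒≼ (neg-neg y)))

neg-isInf : ∀ (s : ℕ → ℝ) L → IsInf s (-ᵣ L) → IsSup (λ n → -ᵣ s n) L
neg-isInf s L (above , approached) =
  (λ n → ≼⇒≤ (neg≼⇒ {L} {s n} ⟪ above n ⟫)) , λ y y<L →
    let n , s<-y = approached (-ᵣ y) (≺⇒< (neg-≺ {y} {L} ⟪ y<L ⟫)) in
    n , ≺⇒< (≺neg⇒ {s n} {y} ⟪ s<-y ⟫)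

neg-isLimsup : ∀ (a : ℕ → ℝ) L → IsLimsup (λ m → -ᵣ a m) (-ᵣ L) → IsLiminf a L
neg-isLimsup a L (s , sups , inf) = (λ n → -ᵣ s n) ,
  (λ n → neg-isSup (λ k → a (n ℕ.+ k)) (s n) (sups n)) , neg-isInf s L inf

isLiminf : ∀ a L → (∀ ε → 0ℚ < ε → Eventually λ m → L ≼ a m +ᵣ 𝕢 ε) →
  (∀ n → ∃ λ k → a (n ℕ.+ k) ≼ L) → IsLiminf a L
isLiminf a L eventually≽ frequently≼ = neg-isLimsup a L (Limsup.isLimsup (λ m → -ᵣ a m) (-ᵣ L)
  (λ ε 0<ε → Ev-map (λ m le → ≼-by (≼⇒0≼- le)
    (ring 3 (λ a l e → a ⊕ e ⊖ l ⊜ ⊝ l ⊕ e ⊖ (⊝ a)) ≃-refl (a m) L (𝕢 ε))) (eventually≽ ε 0<ε))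
  (λ n → let k , le = frequently≼ n in k , neg-mono-≼ le))

-- The asymptotics of the products

½^n≤1 : ∀ n → ½ ^ℚ n ≤ 1ℚ
½^n≤1 zero    = ≤-refl
½^n≤1 (suc n) = *-mono-≤′ {½} {1ℚ} (0≤½^n n) (nonNegative⁻¹ 1ℚ) (≤ᵇ⇒≤ _) (½^n≤1 n)

½^[2+n]≤¼ : ∀ n → ½ ^ℚ suc (suc n) ≤ ¼
½^[2+n]≤¼ n = *-monoʳ-≤′ {½ * ½ ^ℚ n} {½} (nonNegative⁻¹ ½) (*-monoʳ-≤′ {½ ^ℚ n} {1ℚ} (nonNegative⁻¹ ½) (½^n≤1 n))

p*p≤p : ∀ {p} → 0ℚ ≤ p → p ≤ 1ℚ → p * p ≤ p
p*p≤p {p} 0≤p p≤1 = subst (p * p ≤_) (*-identityʳ p) (*-monoʳ-≤′ 0≤p p≤1)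

1/[1+_] : ℕ → ℚ
1/[1+ m ] = + 1 / suc m

1/n≤1 : ∀ m → 1/[1+ m ] ≤ 1ℚ
1/n≤1 m = subst₂ _≤_ (*-identityʳ 1/[1+ m ]) (1/n*n≡1 (suc m))
  (*-monoʳ-≤′ (0≤1/n (suc m)) (ι-mono-≤ {1} (ℕ.s≤s ℕ.z≤n)))

1/n-small : ∀ K → 0ℚ ≤ K → ∀ ε → 0ℚ < ε → Eventually λ m → K * 1/[1+ m ] ≤ ε
1/n-small K 0≤K ε 0<ε = let δ , 0<δ , Kδ<ε = shrink K 0≤K 0<ε in
  ↧ₙ δ , λ m d≤m → ≤-trans (*-monoʳ-≤′ 0≤K (begin
    1/[1+ m ]                          ≡⟨ *-identityʳ 1/[1+ m ] ⟨
    1/[1+ m ] * 1ℚ                     ≤⟨ *-monoʳ-≤′ (0≤1/n (suc m)) (1≤ι[↧p]*p 0<δ) ⟩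
    1/[1+ m ] * (ι (↧ₙ δ) * δ)         ≤⟨ *-monoʳ-≤′ (0≤1/n (suc m)) (*-monoˡ-≤′ (<⇒≤ 0<δ) (ι-mono-≤ (ℕₚ.m≤n⇒m≤1+n d≤m))) ⟩
    1/[1+ m ] * (ι (suc m) * δ)        ≡⟨ *-assoc 1/[1+ m ] (ι (suc m)) δ ⟨
    1/[1+ m ] * ι (suc m) * δ          ≡⟨ trans (cong (_* δ) (1/n*n≡1 (suc m))) (*-identityˡ δ) ⟩
    δ                                  ∎)) (<⇒≤ Kδ<ε)
  where open ≤-Reasoning

n≤ones : ∀ n → n ℕ.≤ ones n
n≤ones zero    = ℕ.z≤n
n≤ones (suc n) = ℕ.s≤s (ℕₚ.≤-trans (n≤ones n) (n≤double (ones n)))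

module Asymptotics (π : ℝ) (isPi : IsPi π) where
  open Products π isPi public

  -- Jordan's inequality at x₁ = ½ reads ½ ≤ sin (π/4), which is at most π/4. The bound serves
  -- `L≼1`.
  2≼π : 𝕢 (ι 2) ≼ π
  2≼π = begin
    𝕢 (ι 2)                  ≈⟨ 𝕢-· (ι 4) ½ ⟩
    𝕢 (ι 4) · 𝕢 ½            ≤⟨ *-monoʳ-≼ (0≼𝕢 (0≤ι 4)) (≼-trans (S[½x]≽x 0) (S≼π· {¼} (≤ᵇ⇒≤ _) (≤ᵇ⇒≤ _))) ⟩
    𝕢 (ι 4) · (π · 𝕢 ¼)      ≈⟨ ring 1 (λ p → κ (ι 4) ⊗ (p ⊗ κ ¼) ⊜ p) ≃-refl π ⟩
    π                        ∎
    where open ≼-Reasoning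

  -- The limes inferior

  module _ (k : ℕ) where
    private
      V r : ℚ
      V = ι (suc (ones k))
      r = ½ * ½ ^ℚ suc k

      0≤r : 0ℚ ≤ r
      0≤r = 0≤½^n (suc (suc k))

      r≤¼ : r ≤ ¼
      r≤¼ = ½^[2+n]≤¼ k

      4rV≡1 : ι 4 * (r * V) ≡ 1ℚ
      4rV≡1 = trans (solve 2 (λ h v → con (ι 4) :* (con ½ :* (con ½ :* h) :* v) := h :* v) refl (½ ^ℚ k) V) (½^n*ι[2^n]≡1 k)

      4RV≃1 : 𝕢 (ι 4) · (𝕢 r · 𝕢 V) ≃ 1#
      4RV≃1 = ≃-trans (≃-sym (≃-trans (𝕢-· (ι 4) (r * V)) (*-cong ≃-refl (𝕢-· r V)))) (≃-reflexive (cong 𝕢 4rV≡1))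

      P≃ : P (suc (ones (suc k))) ≃ 𝕢 (ι 4) · (S r · 𝕢 V)
      P≃ = ≃-trans (q-odd (ones k)) (*-cong ≃-refl (*-cong (≃-reflexive (cong (λ t → S (½ * t)) (vdc-2^ k))) (q-2^ k)))

    P[2^]≼π : P (suc (ones (suc k))) ≼ π
    P[2^]≼π = begin
      P (suc (ones (suc k)))              ≈⟨ P≃ ⟩
      𝕢 (ι 4) · (S r · 𝕢 V)               ≤⟨ *-monoʳ-≼ (0≼𝕢 (0≤ι 4)) (*-monoˡ-≼ (0≼𝕢 (0≤ι (suc (ones k)))) (S≼π· 0≤r r≤¼)) ⟩
      𝕢 (ι 4) · (π · 𝕢 r · 𝕢 V)           ≈⟨ ring 3 (λ p r v → κ (ι 4) ⊗ (p ⊗ r ⊗ v) ⊜ p ⊗ (κ (ι 4) ⊗ (r ⊗ v))) ≃-refl π (𝕢 r) (𝕢 V) ⟩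
      π · (𝕢 (ι 4) · (𝕢 r · 𝕢 V))         ≈⟨ *-cong ≃-refl 4RV≃1 ⟩
      π · 1#                              ≈⟨ ring 1 (λ p → p ⊗ κ 1ℚ ⊜ p) ≃-refl π ⟩
      π                                   ∎
      where open ≼-Reasoning

    private
      t : ℝ
      t = π · 𝕢 r

      c : ℚ
      c = 16/5 * r

      0≼t : 0# ≼ t
      0≼t = *-mono-0≼ (≺⇒≼ 0≺π) (0≼𝕢 0≤r)

      t≼c : t ≼ 𝕢 c
      t≼c = ≼-trans (*-monoˡ-≼ (0≼𝕢 0≤r) π≼16/5) (≃⇒≼ (≃-sym (𝕢-· 16/5 r)))

      0≤c : 0ℚ ≤ c
      0≤c = *-mono-0≤ {16/5} (≤ᵇ⇒≤ _) 0≤r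

      2r≡ : r + r ≡ 1/[1+ ones (suc k) ]
      2r≡ = inverse-unique (suc (ones (suc k))) (trans (cong ((r + r) *_) (ι-double (suc (ones k))))
        (trans (solve 2 (λ r v → (r :+ r) :* (con (ι 2) :* v) := con (ι 4) :* (r :* v)) refl r V) 4rV≡1))

      -- (16/5)³ = 32.768 is rounded up to 33. The generous step r² ≤ 2r expresses the error by the
      -- index m = `ones (suc k)`, since 2r = 1 / (m + 1).
      defect : π · (t · t) ≼ 𝕢 (ι 33 * 1/[1+ ones (suc k) ])
      defect = begin
        π · (t · t)                    ≤⟨ *-mono-≼ (*-mono-0≼ 0≼t 0≼t) (0≼𝕢 {16/5} (≤ᵇ⇒≤ _)) π≼16/5 (*-mono-≼ 0≼t (0≼𝕢 0≤c) t≼c t≼c) ⟩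
        𝕢 16/5 · (𝕢 c · 𝕢 c)           ≈⟨ ≃-trans (𝕢-· 16/5 (c * c)) (*-cong ≃-refl (𝕢-· c c)) ⟨
        𝕢 (16/5 * (c * c))             ≡⟨ cong 𝕢 (solve 1 (λ r → con 16/5 :* ((con 16/5 :* r) :* (con 16/5 :* r)) := con (16/5 * (16/5 * 16/5)) :* (r :* r)) refl r) ⟩
        𝕢 (16/5 * (16/5 * 16/5) * (r * r)) ≤⟨ 𝕢-mono (*-mono-≤′ {16/5 * (16/5 * 16/5)} {ι 33} (*-mono-0≤ 0≤r 0≤r) (0≤ι 33) (≤ᵇ⇒≤ _)
             (≤-trans (p*p≤p 0≤r (≤-trans r≤¼ (≤ᵇ⇒≤ _))) (subst (_≤ r + r) (+-identityʳ r) (+-monoʳ-≤ r 0≤r)))) ⟩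
        𝕢 (ι 33 * (r + r))             ≡⟨ cong (λ t → 𝕢 (ι 33 * t)) 2r≡ ⟩
        𝕢 (ι 33 * 1/[1+ ones (suc k) ]) ∎
        where open ≼-Reasoning

    -- As 4 r V = 1, the linear term of 4 S(r) V is π itself, and the cubic remainder costs at most
    -- π t².
    π≼P[2^] : π ≼ P (suc (ones (suc k))) +ᵣ 𝕢 (ι 33 * 1/[1+ ones (suc k) ])
    π≼P[2^] = begin
      π
        ≈⟨ ring 2 (λ p t → p ⊜ (p ⊖ p ⊗ (t ⊗ t)) ⊗ κ 1ℚ ⊕ p ⊗ (t ⊗ t)) ≃-refl π t ⟩
      (π -ᵣ π · (t · t)) · 1# +ᵣ π · (t · t)
        ≈⟨ +-cong (*-cong ≃-refl 4RV≃1) ≃-refl ⟨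
      (π -ᵣ π · (t · t)) · (𝕢 (ι 4) · (𝕢 r · 𝕢 V)) +ᵣ π · (t · t)
        ≈⟨ +-cong (ring 3 (λ p r v → (p ⊖ p ⊗ ((p ⊗ r) ⊗ (p ⊗ r))) ⊗ (κ (ι 4) ⊗ (r ⊗ v))
             ⊜ κ (ι 4) ⊗ ((p ⊗ r ⊖ p ⊗ r ⊗ (p ⊗ r) ⊗ (p ⊗ r)) ⊗ v)) ≃-refl π (𝕢 r) (𝕢 V)) ≃-refl ⟩
      𝕢 (ι 4) · ((t -ᵣ t · t · t) · 𝕢 V) +ᵣ π · (t · t)
        ≤⟨ +-mono-≼ (*-monoʳ-≼ (0≼𝕢 (0≤ι 4)) (*-monoˡ-≼ (0≼𝕢 (0≤ι (suc (ones k)))) (S≽π·- 0≤r r≤¼))) defect ⟩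
      𝕢 (ι 4) · (S r · 𝕢 V) +ᵣ 𝕢 (ι 33 * 1/[1+ ones (suc k) ])
        ≈⟨ +-cong P≃ ≃-refl ⟨
      P (suc (ones (suc k))) +ᵣ 𝕢 (ι 33 * 1/[1+ ones (suc k) ]) ∎
      where open ≼-Reasoning

  x≼x+𝕢 : ∀ {y r} → 0ℚ ≤ r → y ≼ y +ᵣ 𝕢 r
  x≼x+𝕢 {y} 0≤r = ≼-trans (≃⇒≼ (ring 1 (λ y → y ⊜ y ⊕ κ 0ℚ) ≃-refl y)) (+𝕢-mono ≼-refl 0≤r)

  -- Off the exceptional indices the product is at least 4 > 16/5 ≥ π, so the error term is spent
  -- only on powers of two. `1 ≤ m` rules out the first case of `4≼q`.
  π≼P+ : ∀ m → 1 ℕ.≤ m → π ≼ P (suc m) +ᵣ 𝕢 (ι 33 * 1/[1+ m ])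
  π≼P+ m 1≤m = Sum.[ (λ { (ℕ.s≤s (ℕ.s≤s m≤0)) → contradiction (ℕₚ.≤-trans 1≤m m≤0) λ () }) , Sum.[
    (λ { (k , refl) → π≼P[2^] k }) ,
    (λ 4≼P → ≼-trans π≼16/5 (≼-trans (𝕢-mono {16/5} {ι 4} (≤ᵇ⇒≤ _))
      (≼-trans 4≼P (x≼x+𝕢 (*-mono-0≤ (0≤ι 33) (0≤1/n (suc m))))))) ]′ ]′ (4≼q (binary (suc m)))

  module _ (b : ℕ → ℝ) (b≡ : ∀ m → b m ≡ P (suc m)) where
    liminf≡π : IsLiminf b π
    liminf≡π = isLiminf b π
      (λ ε 0<ε → Ev-zip (λ m 1≤m le → subst (λ y → π ≼ y +ᵣ 𝕢 ε) (sym (b≡ m))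
          (≼-trans (π≼P+ m 1≤m) (+𝕢-mono ≼-refl le)))
        (1 , λ _ 1≤m → 1≤m) (1/n-small (ι 33) (0≤ι 33) ε 0<ε))
      -- The chosen index `ones (suc n)` stands for N = 2ⁿ⁺¹, where the product is at most π.
      (λ n → ones (suc n) ℕ.∸ n , subst (λ m → b m ≼ π)
        (sym (ℕₚ.m+[n∸m]≡n (ℕₚ.≤-trans (ℕₚ.n≤1+n n) (n≤ones (suc n)))))
        (subst (_≼ π) (sym (b≡ (ones (suc n)))) (P[2^]≼π n)))

  -- The limes superior

  module _ (L : ℝ) (0≼L : 0# ≼ L) (L·2π≃1 : L · (𝕢 (ι 2) · π) ≃ 1#) where
    L≼1 : L ≼ 1#
    L≼1 = begin
      L                        ≈⟨ ring 1 (λ l → l ⊜ l ⊗ κ 1ℚ) ≃-refl L ⟩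
      L · 1#                   ≤⟨ *-monoʳ-≼ 0≼L (≼-trans (𝕢-mono {1ℚ} {ι 2 * ι 2} (≤ᵇ⇒≤ _)) (2·-mono 2≼π)) ⟩
      L · (𝕢 (ι 2) · π)        ≈⟨ L·2π≃1 ⟩
      1#                       ∎
      where open ≼-Reasoning

    5/32≼L : 𝕢 5/32 ≼ L
    5/32≼L = *-cancelˡ-≼ (*-mono-0≺ 0≺𝕢2 0≺π) (begin
      𝕢 (ι 2) · π · 𝕢 5/32             ≤⟨ *-monoˡ-≼ (0≼𝕢 {5/32} (≤ᵇ⇒≤ _)) (*-monoʳ-≼ (≺⇒≼ 0≺𝕢2) π≼16/5) ⟩
      𝕢 (ι 2) · 𝕢 16/5 · 𝕢 5/32        ≈⟨ ring 0 (κ (ι 2) ⊗ κ 16/5 ⊗ κ 5/32 ⊜ κ 1ℚ) ≃-refl ⟩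
      1#                               ≈⟨ L·2π≃1 ⟨
      L · (𝕢 (ι 2) · π)                ≈⟨ ·-comm L (𝕢 (ι 2) · π) ⟩
      𝕢 (ι 2) · π · L                  ∎)
      where open ≼-Reasoning

    module _ (n : ℕ) where
      private
        Q : ℕ
        Q = ones (suc (suc n))

        W r : ℚ
        W = ι (suc Q)
        r = ½ ^ℚ suc (suc n)

        0≤r : 0ℚ ≤ r
        0≤r = 0≤½^n (suc (suc n))

        r≤¼ : r ≤ ¼
        r≤¼ = ½^[2+n]≤¼ n

        RW≃1 : 𝕢 r · 𝕢 W ≃ 1#
        RW≃1 = ≃-trans (≃-sym (𝕢-· r W)) (≃-reflexive (cong 𝕢 (½^n*ι[2^n]≡1 (suc (suc n)))))

        t : ℝ
        t = π · 𝕢 r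

        0≼LW : 0# ≼ L · 𝕢 W
        0≼LW = *-mono-0≼ 0≼L (0≼𝕢 (0≤ι (suc Q)))

        -- L · 2π = 1 and r W = 1, so L W is the inverse of 2t. Multiplying `q-ones` by L W
        -- therefore isolates `q Q`, once `S r` is compared with `t`.
        scale : ∀ y → L · 𝕢 W · (q Q · (𝕢 (ι 2) · (t · y))) ≃ q Q · y
        scale y = begin-equality
          L · 𝕢 W · (q Q · (𝕢 (ι 2) · (π · 𝕢 r · y)))
            ≈⟨ ring 6 (λ l w q p r y → l ⊗ w ⊗ (q ⊗ (κ (ι 2) ⊗ (p ⊗ r ⊗ y))) ⊜ (l ⊗ (κ (ι 2) ⊗ p)) ⊗ (r ⊗ w) ⊗ (q ⊗ y)) ≃-refl L (𝕢 W) (q Q) π (𝕢 r) y ⟩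
          (L · (𝕢 (ι 2) · π)) · (𝕢 r · 𝕢 W) · (q Q · y)
            ≈⟨ *-cong (*-cong L·2π≃1 RW≃1) ≃-refl ⟩
          1# · 1# · (q Q · y)
            ≈⟨ ring 1 (λ z → κ 1ℚ ⊗ κ 1ℚ ⊗ z ⊜ z) ≃-refl (q Q · y) ⟩
          q Q · y ∎
          where open ≼-Reasoning

        LWW≃ : L · 𝕢 W · 𝕢 W ≃ L · 𝕢 (W * W)
        LWW≃ = ≃-trans (·-assoc L (𝕢 W) (𝕢 W)) (*-cong ≃-refl (≃-sym (𝕢-· W W)))

      LWW≼q-ones : L · 𝕢 (W * W) ≼ q Q
      LWW≼q-ones = begin
        L · 𝕢 (W * W)                               ≈⟨ LWW≃ ⟨
        L · 𝕢 W · 𝕢 W                               ≈⟨ *-cong ≃-refl (q-ones (suc n)) ⟨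
        L · 𝕢 W · (q Q · (𝕢 (ι 2) · S r))           ≤⟨ *-monoʳ-≼ 0≼LW (*-monoʳ-≼ (0≼q Q) (*-monoʳ-≼ (≺⇒≼ 0≺𝕢2) (S≼π· 0≤r r≤¼))) ⟩
        L · 𝕢 W · (q Q · (𝕢 (ι 2) · t))             ≈⟨ *-cong ≃-refl (*-cong ≃-refl (*-cong ≃-refl (ring 1 (λ t → t ⊜ t ⊗ κ 1ℚ) ≃-refl t))) ⟩
        L · 𝕢 W · (q Q · (𝕢 (ι 2) · (t · 1#)))      ≈⟨ scale 1# ⟩
        q Q · 1#                                    ≈⟨ ring 1 (λ t → t ⊗ κ 1ℚ ⊜ t) ≃-refl (q Q) ⟩
        q Q                                         ∎
        where open ≼-Reasoning

      q-ones≼ : Bounded 5/16 Q → q Q ≼ L · 𝕢 (W * W) +ᵣ 𝕢 16/5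
      q-ones≼ bound = begin
        q Q
          ≈⟨ ring 2 (λ q t → q ⊜ q ⊗ (κ 1ℚ ⊖ t ⊗ t) ⊕ q ⊗ (t ⊗ t)) ≃-refl (q Q) t ⟩
        q Q · (1# -ᵣ t · t) +ᵣ q Q · (t · t)
          ≈⟨ +-cong (scale (1# -ᵣ t · t)) ≃-refl ⟨
        L · 𝕢 W · (q Q · (𝕢 (ι 2) · (t · (1# -ᵣ t · t)))) +ᵣ q Q · (t · t)
          ≈⟨ +-cong (*-cong ≃-refl (*-cong ≃-refl (*-cong ≃-refl (ring 1 (λ t → t ⊗ (κ 1ℚ ⊖ t ⊗ t) ⊜ t ⊖ t ⊗ t ⊗ t) ≃-refl t)))) ≃-refl ⟩
        L · 𝕢 W · (q Q · (𝕢 (ι 2) · (t -ᵣ t · t · t))) +ᵣ q Q · (t · t)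
          ≤⟨ +-mono-≼ (*-monoʳ-≼ 0≼LW (*-monoʳ-≼ (0≼q Q) (*-monoʳ-≼ (≺⇒≼ 0≺𝕢2) (S≽π·- 0≤r r≤¼)))) defect ⟩
        L · 𝕢 W · (q Q · (𝕢 (ι 2) · S r)) +ᵣ 𝕢 16/5
          ≈⟨ +-cong (≃-trans (*-cong ≃-refl (q-ones (suc n))) LWW≃) ≃-refl ⟩
        L · 𝕢 (W * W) +ᵣ 𝕢 16/5 ∎
        where
        open ≼-Reasoning
        c : ℚ
        c = 16/5 * r
        0≤c : 0ℚ ≤ c
        0≤c = *-mono-0≤ {16/5} (≤ᵇ⇒≤ _) 0≤r
        0≼t : 0# ≼ t
        0≼t = *-mono-0≼ (≺⇒≼ 0≺π) (0≼𝕢 0≤r)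
        t≼c : t ≼ 𝕢 c
        t≼c = ≼-trans (*-monoˡ-≼ (0≼𝕢 0≤r) π≼16/5) (≃⇒≼ (≃-sym (𝕢-· 16/5 r)))
        Qr≤1 : ι Q * r ≤ 1ℚ
        Qr≤1 = subst (ι Q * r ≤_) (trans (*-comm W r) (½^n*ι[2^n]≡1 (suc (suc n)))) (*-monoˡ-≤′ 0≤r (ι-mono-≤ (ℕₚ.n≤1+n Q)))
        0≤Qr : 0ℚ ≤ ι Q * r
        0≤Qr = *-mono-0≤ (0≤ι Q) 0≤r
        -- Although `q Q` grows like 4ⁿ, the error stays bounded: 5/16 Q² · (16/5 r)² = 16/5 (Q r)²,
        -- and Q r ≤ 1.
        defect : q Q · (t · t) ≼ 𝕢 16/5
        defect = ≼-trans (*-mono-≼ (*-mono-0≼ 0≼t 0≼t) (0≼𝕢 (*-mono-0≤ {5/16} (≤ᵇ⇒≤ _) (*-mono-0≤ (0≤ι Q) (0≤ι Q))))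
            (q≼c·Q² bound) (*-mono-≼ 0≼t (0≼𝕢 0≤c) t≼c t≼c))
          (≼-trans (≃⇒≼ (≃-sym (≃-trans (𝕢-· (5/16 * (ι Q * ι Q)) (c * c)) (*-cong ≃-refl (𝕢-· c c)))))
            (𝕢-mono (≤-trans (≤-reflexive (solve 2 (λ q r → con 5/16 :* (q :* q) :* ((con 16/5 :* r) :* (con 16/5 :* r))
                := con 16/5 :* ((q :* r) :* (q :* r))) refl (ι Q) r))
              (*-monoʳ-≤′ {r = 16/5} (≤ᵇ⇒≤ _) (≤-trans (p*p≤p 0≤Qr Qr≤1) Qr≤1)))))

    q≼ : ∀ Q → Binary Q → 7 ℕ.≤ Q → q Q ≼ L · 𝕢 (ι (suc Q) * ι (suc Q)) +ᵣ 𝕢 16/5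
    q≼ Q b 7≤Q = Sum.[ allOnes , small ]′ (ones-or-small b 7≤Q)
      where
      allOnes : (∃ λ n → Q ≡ ones (suc n) × Bounded 5/16 Q) → q Q ≼ L · 𝕢 (ι (suc Q) * ι (suc Q)) +ᵣ 𝕢 16/5
      allOnes (zero  , refl , _)     = contradiction 7≤Q λ { (ℕ.s≤s ()) }
      allOnes (suc n , refl , bound) = q-ones≼ n bound
      up : ι Q ≤ ι (suc Q)
      up = ι-mono-≤ (ℕₚ.n≤1+n Q)
      small : Bounded 5/32 Q → q Q ≼ L · 𝕢 (ι (suc Q) * ι (suc Q)) +ᵣ 𝕢 16/5
      small (bounded le) = begin
        q Q                                          ≤⟨ le ⟩
        𝕢 (5/32 * (ι Q * ι Q))                       ≈⟨ 𝕢-· 5/32 (ι Q * ι Q) ⟩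
        𝕢 5/32 · 𝕢 (ι Q * ι Q)                       ≤⟨ *-mono-≼ (0≼𝕢 (*-mono-0≤ (0≤ι Q) (0≤ι Q))) 0≼L 5/32≼L
                                                         (𝕢-mono (*-mono-≤′ {ι Q} (0≤ι Q) (0≤ι (suc Q)) up up)) ⟩
        L · 𝕢 (ι (suc Q) * ι (suc Q))                ≤⟨ x≼x+𝕢 {r = 16/5} (≤ᵇ⇒≤ _) ⟩
        L · 𝕢 (ι (suc Q) * ι (suc Q)) +ᵣ 𝕢 16/5      ∎
        where open ≼-Reasoning

    a : ℕ → ℝ
    a m = 𝕢 (1/[1+ m ] * 1/[1+ m ]) · P (suc m)

    module _ (m : ℕ) where
      private
        u N W : ℚ
        u = 1/[1+ m ]
        N = ι (suc m)
        W = ι (suc (suc (suc m)))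

        0≤u : 0ℚ ≤ u
        0≤u = 0≤1/n (suc m)

        uN≡1 : u * N ≡ 1ℚ
        uN≡1 = 1/n*n≡1 (suc m)

        W≡ : W ≡ N + 1ℚ + 1ℚ
        W≡ = trans (ι-homo-+1 (suc (suc m))) (cong (_+ 1ℚ) (ι-homo-+1 (suc m)))

        -- W is N + 2, so W² / N² = (1 + 2u)² = 1 + d.
        d : ℚ
        d = ι 4 * u + ι 4 * (u * u)

        uuWW≡ : u * u * (W * W) ≡ 1ℚ + d
        uuWW≡ = trans (cong (λ w → u * u * (w * w)) W≡) (trans
          (solve 2 (λ u n → u :* u :* ((n :+ con 1ℚ :+ con 1ℚ) :* (n :+ con 1ℚ :+ con 1ℚ))
            := (u :* n) :* (u :* n) :+ (con (ι 4) :* u :* (u :* n) :+ con (ι 4) :* (u :* u))) refl u N)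
          (trans (cong (λ z → z * z + (ι 4 * u * z + ι 4 * (u * u))) uN≡1)
            (solve 1 (λ u → con 1ℚ :* con 1ℚ :+ (con (ι 4) :* u :* con 1ℚ :+ con (ι 4) :* (u :* u))
              := con 1ℚ :+ (con (ι 4) :* u :+ con (ι 4) :* (u :* u))) refl u)))

        0≤d : 0ℚ ≤ d
        0≤d = +-mono-0≤ (*-mono-0≤ (0≤ι 4) 0≤u) (*-mono-0≤ (0≤ι 4) (*-mono-0≤ 0≤u 0≤u))

        -- Each of the three summands is at most 4u, by u² ≤ u and 16/5 ≤ 4.
        d+≤ : d + u * u * 16/5 ≤ ι 12 * u
        d+≤ = begin
          ι 4 * u + ι 4 * (u * u) + u * u * 16/5
            ≤⟨ +-mono-≤ (+-monoʳ-≤ (ι 4 * u) (*-monoʳ-≤′ (0≤ι 4) uu≤u))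
                 (*-mono-≤′ {u * u} {u} {16/5} {ι 4} (≤ᵇ⇒≤ _) 0≤u uu≤u (≤ᵇ⇒≤ _)) ⟩
          ι 4 * u + ι 4 * u + u * ι 4
            ≡⟨ solve 1 (λ u → con (ι 4) :* u :+ con (ι 4) :* u :+ u :* con (ι 4) := con (ι 12) :* u) refl u ⟩
          ι 12 * u ∎
          where
          open ≤-Reasoning
          uu≤u : u * u ≤ u
          uu≤u = p*p≤p 0≤u (1/n≤1 m)

        0≼uu : 0# ≼ 𝕢 (u * u)
        0≼uu = 0≼𝕢 (*-mono-0≤ 0≤u 0≤u)

      a≼ : 7 ℕ.≤ suc (suc m) → a m ≼ L +ᵣ 𝕢 (ι 12 * u)
      a≼ 7≤Q = begin
        𝕢 (u * u) · P (suc m)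
          ≤⟨ *-monoʳ-≼ 0≼uu (q≼ (suc (suc m)) (binary (suc m)) 7≤Q) ⟩
        𝕢 (u * u) · (L · 𝕢 (W * W) +ᵣ 𝕢 16/5)
          ≈⟨ ring 3 (λ u l w → u ⊗ (l ⊗ w ⊕ κ 16/5) ⊜ l ⊗ (u ⊗ w) ⊕ u ⊗ κ 16/5) ≃-refl (𝕢 (u * u)) L (𝕢 (W * W)) ⟩
        L · (𝕢 (u * u) · 𝕢 (W * W)) +ᵣ 𝕢 (u * u) · 𝕢 16/5
          ≈⟨ +-cong (*-cong ≃-refl (≃-trans (≃-sym (𝕢-· (u * u) (W * W))) (≃-trans (≃-reflexive (cong 𝕢 uuWW≡)) (𝕢-+ 1ℚ d)))) (≃-sym (𝕢-· (u * u) 16/5)) ⟩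
        L · (1# +ᵣ 𝕢 d) +ᵣ 𝕢 (u * u * 16/5)
          ≈⟨ ring 3 (λ l d e → l ⊗ (κ 1ℚ ⊕ d) ⊕ e ⊜ l ⊕ (l ⊗ d ⊕ e)) ≃-refl L (𝕢 d) (𝕢 (u * u * 16/5)) ⟩
        L +ᵣ (L · 𝕢 d +ᵣ 𝕢 (u * u * 16/5))
          ≤⟨ +-mono-≼ ≼-refl (+-mono-≼ (*-monoˡ-≼ (0≼𝕢 0≤d) L≼1) ≼-refl) ⟩
        L +ᵣ (1# · 𝕢 d +ᵣ 𝕢 (u * u * 16/5))
          ≈⟨ +-cong ≃-refl (≃-trans (+-cong (·-identityˡ (𝕢 d)) ≃-refl) (≃-sym (𝕢-+ d (u * u * 16/5)))) ⟩
        L +ᵣ 𝕢 (d + u * u * 16/5)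
          ≤⟨ +𝕢-mono ≼-refl d+≤ ⟩
        L +ᵣ 𝕢 (ι 12 * u) ∎
        where open ≼-Reasoning

      L≼a : L · 𝕢 (W * W) ≼ P (suc m) → L ≼ a m
      L≼a LWW≼P = begin
        L                                   ≈⟨ ring 1 (λ l → l ⊜ l ⊗ κ 1ℚ) ≃-refl L ⟩
        L · 1#                              ≤⟨ *-monoʳ-≼ 0≼L (𝕢-mono 1≤) ⟩
        L · 𝕢 (u * u * (W * W))             ≈⟨ *-cong ≃-refl (𝕢-· (u * u) (W * W)) ⟩
        L · (𝕢 (u * u) · 𝕢 (W * W))         ≈⟨ ring 3 (λ l u w → l ⊗ (u ⊗ w) ⊜ u ⊗ (l ⊗ w)) ≃-refl L (𝕢 (u * u)) (𝕢 (W * W)) ⟩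
        𝕢 (u * u) · (L · 𝕢 (W * W))         ≤⟨ *-monoʳ-≼ 0≼uu LWW≼P ⟩
        a m                                 ∎
        where
        open ≼-Reasoning
        1≤ : 1ℚ ≤ u * u * (W * W)
        1≤ = subst (1ℚ ≤_) (sym uuWW≡) (subst (_≤ 1ℚ + d) (+-identityʳ 1ℚ) (+-monoʳ-≤ 1ℚ 0≤d))

    n≤4ones : ∀ n → n ℕ.≤ suc (double (double (ones n)))
    n≤4ones n = ℕₚ.m≤n⇒m≤1+n (ℕₚ.≤-trans (n≤ones n) (ℕₚ.≤-trans (n≤double (ones n)) (n≤double (double (ones n)))))

    module _ (b : ℕ → ℝ) (b≡ : ∀ m → b m ≡ a m) where
      limsup≡L : IsLimsup b L
      limsup≡L = Limsup.isLimsup b L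
        (λ ε 0<ε → Ev-zip (λ m 7≤m le → subst (_≼ L +ᵣ 𝕢 ε) (sym (b≡ m))
            (≼-trans (a≼ m (ℕₚ.m≤n⇒m≤1+n (ℕₚ.m≤n⇒m≤1+n 7≤m))) (+𝕢-mono ≼-refl le)))
          (7 , λ _ 7≤m → 7≤m) (1/n-small (ι 12) (0≤ι 12) ε 0<ε))
        -- This index is m = 2ⁿ⁺² - 3, for which Q = m + 2 reduces to `ones (suc (suc n))`.
        (λ n → suc (double (double (ones n))) ℕ.∸ n , subst (λ m → L ≼ b m)
          (sym (ℕₚ.m+[n∸m]≡n (n≤4ones n)))
          (subst (L ≼_) (sym (b≡ (suc (double (double (ones n)))))) (L≼a (suc (double (double (ones n)))) (LWW≼q-ones n))))

1/n²≡ : ∀ m → + 1 / (suc m ℕ.^ 2) ≡ 1/[1+ m ] * 1/[1+ m ]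
1/n²≡ m = sym (inverse-unique (suc m ℕ.^ 2) (trans (cong (u * u *_) (ι-homo-^ (suc m) 2))
  (trans (solve 2 (λ u n → u :* u :* (n :* (n :* con 1ℚ)) := (u :* n) :* (u :* n)) refl u (ι (suc m)))
    (cong (λ z → z * z) (1/n*n≡1 (suc m))))))
  where
  u = 1/[1+ m ]

theorem5 : (π : ℝ) (isPi : IsPi π) →
    let P = λ N → ∏ N (λ n → ∣ 2ᵣ *ᵣ sin (π *ᵣ fromℚ (vanDerCorput n)) ∣ᵣ) in
    IsLimsup (λ m → let N = suc m in fromℚ (+ 1 / (N ^ 2)) *ᵣ P N) (recip (2ᵣ *ᵣ π) (IsPi.2π-pos isPi))
    × IsLiminf (λ m → let N = suc m in P N) π
theorem5 π isPi =
  limsup≡L (recip (2ᵣ *ᵣ π) 2π-pos) (0≼recip (2ᵣ *ᵣ π) 2π-pos)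
    (subst (λ y → recip (2ᵣ *ᵣ π) 2π-pos · y ≃ 1#) 2π≡ (recip-inverse (2ᵣ *ᵣ π) 2π-pos))
    (λ m → fromℚ (+ 1 / (suc m ^ 2)) *ᵣ Π (suc m))
    (λ m → trans (·-def (fromℚ (+ 1 / (suc m ^ 2))) (Π (suc m)))
      (cong₂ _·_ (trans (𝕢-def (+ 1 / (suc m ^ 2))) (cong 𝕢 (1/n²≡ m))) (P-def′ (suc m)))) ,
  liminf≡π (λ m → Π (suc m)) (λ m → P-def′ (suc m))
  where
  open Asymptotics π isPi
  open IsPi isPi using (2π-pos)
  Π : ℕ → ℝ
  Π N = ∏ N (λ n → ∣ 2ᵣ *ᵣ sin (π *ᵣ fromℚ (vanDerCorput n)) ∣ᵣ)
  2π≡ : 2ᵣ *ᵣ π ≡ 𝕢 (ι 2) · π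
  2π≡ = trans (·-def 2ᵣ π) (cong (_· π) 2ᵣ-def)
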